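{- Let $\Gamma$ be an almost bipartite $Q$-polynomial distance-regular graph with diameter $D\ge 3$, valency $k\ge 3$, and girth $6$. Then $\Gamma$ is the Odd graph on a set of cardinality $2D+1$.
   Context: Graphs are finite, undirected, connected, simple. A distance-regular graph has intersection numbers $p^h_{ij}=|\Gamma_i(x)\cap\Gamma_j(y)|$ for $\partial(x,y)=h$, independent of $x,y$; set $a_i=p^i_{1i}$. $\Gamma$ is almost bipartite if $a_i=0$ for $0\le i\le D-1$ and $a_D\ne 0$. $Q$-polynomial: there is an ordering $E_0,\dots,E_D$ of the primitive idempotents of the Bose–Mesner algebra, with $E_0=|X|^{ -1}J$, such that the Krein parameters defined by $E_i\circ E_j=|X|^{ -1}\sum_h q^h_{ij}E_h$ satisfy, for distinct $i,j$, $q^1_{ij}\ne0$ iff $|i-j|=1$. The Odd graph on a $(2D+1)$-set has as vertices the $D$-subsets, two being adjacent when disjoint. -}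

module Defs where

open import Level using (Level; _⊔_) renaming (suc to lsuc)
open import Data.Bool using (Bool; true; false; _∧_; _∨_; if_then_else_)
open import Data.Nat using (ℕ; zero; suc; _<_; _≤_; _≡ᵇ_) renaming (_+_ to _+ℕ_)
open import Data.Fin using (Fin; toℕ; inject₁; fromℕ; _≟_)
import Data.Fin as Fin
open import Data.Fin.Subset using (Subset; ∣_∣; _∩_; Empty)
open import Data.List using (List; map; allFin)
open import Data.Nat.ListAction using (sum)
open import Data.Bool.ListAction using (any)
open import Data.Product using (Σ; ∃; _×_; _,_)
open import Data.Sum using (_⊎_)
open import Relation.Nullary using (¬_; does)
open import Relation.Binary.PropositionalEquality using (_≡_; _≢_)
open import Function.Bundles using (_⇔_)
open import Algebra.Bundles using (CommutativeRing)

record Graph : Set where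
  field
    n      : ℕ
    adj    : Fin n → Fin n → Bool
    sym    : ∀ x y → adj x y ≡ adj y x
    irrefl : ∀ x → adj x x ≡ false

module _ (G : Graph) where
  open Graph G

  count : (Fin n → Bool) → ℕ
  count P = sum (map (λ z → if P z then 1 else 0) (allFin n))

  degree : Fin n → ℕ
  degree x = count (adj x)

  reach : ℕ → Fin n → Fin n → Bool
  reach zero    x y = does (x ≟ y)
  reach (suc k) x y = reach k x y ∨ any (λ z → reach k x z ∧ adj z y) (allFin n)

  Connected : Set
  Connected = ∀ x y → reach n x y ≡ true

  dist : Fin n → Fin n → ℕ
  dist x y = go 0 n
    where
    go : ℕ → ℕ → ℕ
    go k zero    = k
    go k (suc f) = if reach k x y then k else go (suc k) f

  Diameter : ℕ → Set
  Diameter D = (∀ x y → dist x y ≤ D) × (∃ λ x → ∃ λ y → dist x y ≡ D)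

  pnum : Fin n → Fin n → ℕ → ℕ → ℕ
  pnum x y i j = count (λ z → (dist x z ≡ᵇ i) ∧ (dist y z ≡ᵇ j))

  DistanceRegular : ℕ → Set
  DistanceRegular D =
    Diameter D ×
    (∀ x y x' y' i j → dist x y ≡ dist x' y' → pnum x y i j ≡ pnum x' y' i j)

  AlmostBipartite : ℕ → Set
  AlmostBipartite D =
    (∀ x y → dist x y < D → pnum x y 1 (dist x y) ≡ 0) ×
    (∀ x y → dist x y ≡ D → pnum x y 1 D ≢ 0)

  Valency : ℕ → Set
  Valency k = ∀ x → degree x ≡ k

  -- a cycle of length (suc m): distinct vertices f 0, …, f m with
  -- f i ~ f (i+1) and f m ~ f 0
  record Cycle (m : ℕ) : Set where
    field
      f     : Fin (suc m) → Fin n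
      inj   : ∀ i j → f i ≡ f j → i ≡ j
      step  : ∀ (i : Fin m) → adj (f (inject₁ i)) (f (Fin.suc i)) ≡ true
      close : adj (f (fromℕ m)) (f Fin.zero) ≡ true

  Girth : ℕ → Set
  Girth g = (∃ λ m → suc m ≡ g × Cycle m) ×
            (∀ m → 3 ≤ suc m → suc m < g → ¬ Cycle m)

  record IsOddGraph (D : ℕ) : Set where
    field
      φ      : Fin n → Subset (suc (D +ℕ D))
      size   : ∀ x → ∣ φ x ∣ ≡ D
      inj    : ∀ x y → φ x ≡ φ y → x ≡ y
      surj   : ∀ (s : Subset (suc (D +ℕ D))) → ∣ s ∣ ≡ D → ∃ λ x → φ x ≡ s
      adjIff : ∀ x y → (adj x y ≡ true) ⇔ Empty (φ x ∩ φ y)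

ofℕ : ∀ {c ℓ} (R : CommutativeRing c ℓ) → ℕ → CommutativeRing.Carrier R
ofℕ R zero    = CommutativeRing.0# R
ofℕ R (suc m) = CommutativeRing._+_ R (CommutativeRing.1# R) (ofℕ R m)

record CharZeroField (c ℓ : Level) : Set (lsuc (c ⊔ ℓ)) where
  field
    cring : CommutativeRing c ℓ
  open CommutativeRing cring
  field
    1≉0   : ¬ (1# ≈ 0#)
    inv   : ∀ x → ¬ (x ≈ 0#) → ∃ λ y → (x * y) ≈ 1#
    char0 : ∀ m → ¬ (ofℕ cring (suc m) ≈ 0#)

module _ {c ℓ} (F : CharZeroField c ℓ) (G : Graph) where
  open CharZeroField F using (cring)
  open CommutativeRing cring
  open Graph G

  ∑ : ∀ {m} → (Fin m → Carrier) → Carrier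
  ∑ {zero}  g = 0#
  ∑ {suc m} g = g Fin.zero + ∑ (λ i → g (Fin.suc i))

  Mat : Set c
  Mat = Fin n → Fin n → Carrier

  _≈M_ : Mat → Mat → Set ℓ
  M ≈M N = ∀ x y → M x y ≈ N x y

  0M : Mat
  0M x y = 0#

  IM : Mat
  IM x y = if does (x ≟ y) then 1# else 0#

  _+M_ : Mat → Mat → Mat
  (M +M N) x y = M x y + N x y

  _·M_ : Mat → Mat → Mat
  (M ·M N) x y = ∑ (λ z → M x z * N z y)

  _∘M_ : Mat → Mat → Mat
  (M ∘M N) x y = M x y * N x y

  ∑M : ∀ {m} → (Fin m → Mat) → Mat
  ∑M Ms x y = ∑ (λ i → Ms i x y)

  Adist : ℕ → Mat
  Adist i x y = if dist G x y ≡ᵇ i then 1# else 0#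

  module _ (D : ℕ) where

    InBM : Mat → Set (c ⊔ ℓ)
    InBM M = ∃ λ (coef : Fin (suc D) → Carrier) →
               M ≈M ∑M (λ j x y → coef j * Adist (toℕ j) x y)

    Idempotent : Mat → Set (c ⊔ ℓ)
    Idempotent E = InBM E × ((E ·M E) ≈M E)

    Primitive : Mat → Set (c ⊔ ℓ)
    Primitive E = Idempotent E × ¬ (E ≈M 0M) ×
      (∀ E₁ E₂ → Idempotent E₁ → Idempotent E₂ → (E₁ ·M E₂) ≈M 0M →
         E ≈M (E₁ +M E₂) → (E₁ ≈M 0M) ⊎ (E₂ ≈M 0M))

    IdempotentOrdering : (Fin (suc D) → Mat) → Set (c ⊔ ℓ)
    IdempotentOrdering E =
      (∀ i → Primitive (E i)) ×
      (∀ i j → i ≢ j → ¬ (E i ≈M E j)) ×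
      (∀ P → Primitive P → ∃ λ i → P ≈M E i)

    -- Q-polynomial: an ordering with E_0 = |X|^{-1} J such that, writing
    -- E_i ∘ E_j = |X|^{-1} ∑_h q^h_{ij} E_h, for distinct i, j:
    -- q^1_{ij} ≠ 0 iff |i - j| = 1
    QPolynomial : Set (c ⊔ ℓ)
    QPolynomial = ∃ λ (E : Fin (suc D) → Mat) →
      IdempotentOrdering E ×
      (∀ x y → (ofℕ cring n * E Fin.zero x y) ≈ 1#) ×
      (∀ i j → ∃ λ (q : Fin (suc D) → Carrier) →
         (∀ x y → (ofℕ cring n * (E i ∘M E j) x y) ≈ ∑M (λ h x' y' → q h * E h x' y') x y) ×
         (i ≢ j → ∀ h → toℕ h ≡ 1 →
            (¬ (q h ≈ 0#)) ⇔ ((toℕ i ≡ suc (toℕ j)) ⊎ (toℕ j ≡ suc (toℕ i)))))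

{-# OPTIONS --safe #-}

-- Let u i be the entry at distance i of the first nontrivial idempotent E. Terwilliger's balanced
-- set condition says that for x and y at distance 3 the sum of the Ez over z in Γ(x) ∩ Γ₂(y) minus
-- the sum of the Ew over w in Γ₂(x) ∩ Γ(y) is a fixed multiple of Ex - Ey. The usual proof kills
-- triple products of idempotents because a sum of squares vanishes. Here F need not be formally
-- real; instead, an integer Gram matrix and its vectors have the same kernel over every field of
-- characteristic zero.
--
-- Pairing the condition with Ev for suitable v expresses everything through k, c₃ and the ratio
-- φ = (u 1 - u 3) / (u 4 - u 2), which is an integer because it is a difference of two
-- cardinalities. Signs exclude φ ≤ 0. If φ ≥ 2, running the three-term recurrence of u backwards
-- from distance D is contradictory for D ≥ 4, and for D = 3 the cardinality of Γ₃(x) is not an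
-- integer. Hence φ = 1, which gives c₃ = 2, k = D + 1 and the u i of the Odd graph.
--
-- Now Ex + Ez is the same for opposite edges of a hexagon. Up to this identification there are
-- 2D + 1 edges, playing the role of the points; the edge xz stands for the point outside the
-- disjoint sets x and z, and a vertex is recovered as a set of D such points.
--
-- Equality in F is undecidable, so statements about F are proved under a double negation; it is
-- removed once they have become equations between natural numbers.
module Submission where

open import Defs
open import Data.Nat using (ℕ; _≤_)

-- The hypothesis supplies as many primitive idempotents as the Bose-Mesner algebra has dimensions,
-- so they form a basis and F contains all eigenvalues. The balanced set condition is a commutator
-- identity: if A* is the diagonal matrix of row v of `E one`, then `E i` A* `E j` = 0 for |i - j| >
-- 1, and for the remaining i, j the coefficients of A₁A*A₂ - A₂A*A₁ telescope into those of KA* -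
-- A*K with K in the algebra.
--
-- The integer φ compares two kinds of v at distance 2 from x and 3 from y: adjacent to exactly one
-- vertex of Γ(x) ∩ Γ₂(y), or to none. The second kind needs c₃ ≤ k - 2, so c₃ = k - 1 has to be
-- excluded beforehand.
--
-- Put m = k - 2, s = c₃ - 1, h = c₃ - 2, R = k - c₃ - 1. Elimination leaves m(φ - 1)(φ(φ - 1)s +
-- (φ² + φ + 1)R) = hR², together with a natural number g such that mg = sh. At φ = 1 the left side
-- vanishes, which forces h = 0; for φ ≤ 0 it is negative. For φ ≥ 2 the two equations make φ(φ -
-- 1)s/R a root of a monic integer polynomial, hence a natural number, and the recurrence for the
-- differences of u, multiplied by φ, has integer coefficients.

-- Finite sums in commutative semirings.

module Summation where
  open import Level using (Level)
  open import Algebra.Bundles using (CommutativeSemiring)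
  open import Data.Bool using (Bool; true; false; if_then_else_)
  open import Data.Nat using (zero; suc)
  import Data.Nat.Properties as ℕₚ
  open import Data.Fin using (Fin)
  import Data.Fin as Fin
  open import Data.Fin.Properties using (suc-injective)
  open import Data.List using (List; []; _∷_; map; allFin; tabulate; _++_; cartesianProduct)
  open import Data.List.Properties using (map-tabulate)
  open import Data.Product using (_×_; _,_)
  open import Relation.Binary.PropositionalEquality as ≡ using (_≡_; _≢_)

  private variable
    a b : Level
    A : Set a
    B : Set b

  module ListSum {c ℓ} (S : CommutativeSemiring c ℓ) where
    open CommutativeSemiring S
    open import Relation.Binary.Reasoning.Setoid setoid
    open import Algebra.Properties.CommutativeSemigroup +-commutativeSemigroup using (interchange)

    sumOver : List A → (A → Carrier) → Carrier
    sumOver []       f = 0#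
    sumOver (x ∷ xs) f = f x + sumOver xs f

    sumOver-cong : ∀ (xs : List A) {f g : A → Carrier} → (∀ x → f x ≈ g x) → sumOver xs f ≈ sumOver xs g
    sumOver-cong []       h = refl
    sumOver-cong (x ∷ xs) h = +-cong (h x) (sumOver-cong xs h)

    sumOver-0 : ∀ (xs : List A) → sumOver xs (λ _ → 0#) ≈ 0#
    sumOver-0 []       = refl
    sumOver-0 (x ∷ xs) = trans (+-identityˡ _) (sumOver-0 xs)

    sumOver-zero : ∀ (xs : List A) {f : A → Carrier} → (∀ x → f x ≈ 0#) → sumOver xs f ≈ 0#
    sumOver-zero xs h = trans (sumOver-cong xs h) (sumOver-0 xs)

    sumOver-+ : ∀ (xs : List A) (f g : A → Carrier) →
      sumOver xs (λ x → f x + g x) ≈ sumOver xs f + sumOver xs g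
    sumOver-+ []       f g = sym (+-identityˡ 0#)
    sumOver-+ (x ∷ xs) f g = trans (+-congˡ (sumOver-+ xs f g)) (interchange _ _ _ _)

    *-distribˡ-sumOver : ∀ (xs : List A) y (f : A → Carrier) →
      y * sumOver xs f ≈ sumOver xs (λ x → y * f x)
    *-distribˡ-sumOver []       y f = zeroʳ y
    *-distribˡ-sumOver (x ∷ xs) y f = trans (distribˡ _ _ _) (+-congˡ (*-distribˡ-sumOver xs y f))

    *-distribʳ-sumOver : ∀ (xs : List A) y (f : A → Carrier) →
      sumOver xs f * y ≈ sumOver xs (λ x → f x * y)
    *-distribʳ-sumOver []       y f = zeroˡ y
    *-distribʳ-sumOver (x ∷ xs) y f = trans (distribʳ _ _ _) (+-congˡ (*-distribʳ-sumOver xs y f))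

    sumOver-swap : ∀ (xs : List A) (ys : List B) (f : A → B → Carrier) →
      sumOver xs (λ x → sumOver ys (f x)) ≈ sumOver ys (λ y → sumOver xs (λ x → f x y))
    sumOver-swap []       ys f = sym (sumOver-0 ys)
    sumOver-swap (x ∷ xs) ys f =
      trans (+-congˡ (sumOver-swap xs ys f)) (sym (sumOver-+ ys _ _))

    sumOver-* : ∀ (xs : List A) (ys : List B) (f : A → Carrier) (g : B → Carrier) →
      sumOver xs f * sumOver ys g ≈ sumOver xs (λ x → sumOver ys (λ y → f x * g y))
    sumOver-* xs ys f g = trans (*-distribʳ-sumOver xs _ f)
      (sumOver-cong xs (λ x → *-distribˡ-sumOver ys (f x) g))

    sumOver-++ : ∀ (xs ys : List A) (f : A → Carrier) → sumOver (xs ++ ys) f ≈ sumOver xs f + sumOver ys f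
    sumOver-++ []       ys f = sym (+-identityˡ _)
    sumOver-++ (x ∷ xs) ys f = trans (+-congˡ (sumOver-++ xs ys f)) (sym (+-assoc _ _ _))

    sumOver-map : ∀ (g : A → B) (xs : List A) (f : B → Carrier) →
      sumOver (map g xs) f ≈ sumOver xs (λ x → f (g x))
    sumOver-map g []       f = refl
    sumOver-map g (x ∷ xs) f = +-congˡ (sumOver-map g xs f)

    sumOver-× : ∀ (xs : List A) (ys : List B) (f : A × B → Carrier) →
      sumOver (cartesianProduct xs ys) f ≈ sumOver xs (λ x → sumOver ys (λ y → f (x , y)))
    sumOver-× []       ys f = refl
    sumOver-× (x ∷ xs) ys f = trans (sumOver-++ (map (x ,_) ys) (cartesianProduct xs ys) f)
      (+-cong (sumOver-map (x ,_) ys f) (sumOver-× xs ys f))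

    -- Opaque, since otherwise allFin (suc m) unfolds and blocks unification.
    opaque
      sumFin : ∀ {m} → (Fin m → Carrier) → Carrier
      sumFin {m} f = sumOver (allFin m) f

      sumFin≡sumOver : ∀ {m} (f : Fin m → Carrier) → sumFin f ≡ sumOver (allFin m) f
      sumFin≡sumOver f = ≡.refl

      sumFin-cong : ∀ {m} {f g : Fin m → Carrier} → (∀ i → f i ≈ g i) → sumFin f ≈ sumFin g
      sumFin-cong = sumOver-cong (allFin _)

      sumFin-zero : ∀ {m} {f : Fin m → Carrier} → (∀ i → f i ≈ 0#) → sumFin f ≈ 0#
      sumFin-zero = sumOver-zero (allFin _)

      sumFin-+ : ∀ {m} (f g : Fin m → Carrier) → sumFin (λ i → f i + g i) ≈ sumFin f + sumFin g
      sumFin-+ = sumOver-+ (allFin _)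

      *-distribˡ-sumFin : ∀ {m} y (f : Fin m → Carrier) → y * sumFin f ≈ sumFin (λ i → y * f i)
      *-distribˡ-sumFin = *-distribˡ-sumOver (allFin _)

      *-distribʳ-sumFin : ∀ {m} y (f : Fin m → Carrier) → sumFin f * y ≈ sumFin (λ i → f i * y)
      *-distribʳ-sumFin = *-distribʳ-sumOver (allFin _)

      sumFin-swap : ∀ {l m} (f : Fin l → Fin m → Carrier) →
        sumFin (λ i → sumFin (f i)) ≈ sumFin (λ j → sumFin (λ i → f i j))
      sumFin-swap = sumOver-swap (allFin _) (allFin _)

      sumFin-* : ∀ {l m} (f : Fin l → Carrier) (g : Fin m → Carrier) →
        sumFin f * sumFin g ≈ sumFin (λ i → sumFin (λ j → f i * g j))
      sumFin-* = sumOver-* (allFin _) (allFin _)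

      sumFin-suc : ∀ {m} (f : Fin (suc m) → Carrier) → sumFin f ≈ f Fin.zero + sumFin (λ i → f (Fin.suc i))
      sumFin-suc {m} f = +-congˡ (begin
        sumOver (tabulate Fin.suc) f            ≡⟨ ≡.cong (λ l → sumOver l f) (≡.sym (map-tabulate (λ i → i) Fin.suc)) ⟩
        sumOver (map Fin.suc (allFin m)) f      ≈⟨ sumOver-map Fin.suc (allFin m) f ⟩
        sumFin (λ i → f (Fin.suc i))            ∎)

    sumFin-only : ∀ {m} (f : Fin m → Carrier) j → (∀ i → i ≢ j → f i ≈ 0#) → sumFin f ≈ f j
    sumFin-only f Fin.zero h = begin
      sumFin f                                    ≈⟨ sumFin-suc f ⟩
      f Fin.zero + sumFin (λ i → f (Fin.suc i))   ≈⟨ +-congˡ (sumFin-zero (λ i → h (Fin.suc i) (λ ()))) ⟩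
      f Fin.zero + 0#                             ≈⟨ +-identityʳ _ ⟩
      f Fin.zero                                  ∎
    sumFin-only f (Fin.suc j) h = begin
      sumFin f                                    ≈⟨ sumFin-suc f ⟩
      f Fin.zero + sumFin (λ i → f (Fin.suc i))   ≈⟨ +-cong (h Fin.zero (λ ())) (sumFin-only (λ i → f (Fin.suc i)) j (λ i i≢j → h (Fin.suc i) (λ e → i≢j (suc-injective e)))) ⟩
      0# + f (Fin.suc j)                          ≈⟨ +-identityˡ _ ⟩
      f (Fin.suc j)                               ∎

    sumIf : ∀ {m} → (Fin m → Bool) → (Fin m → Carrier) → Carrier
    sumIf P f = sumFin (λ z → if P z then f z else 0#)

    sumIf-cong : ∀ {m} (P : Fin m → Bool) {f g : Fin m → Carrier} →
      (∀ z → P z ≡ true → f z ≈ g z) → sumIf P f ≈ sumIf P g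
    sumIf-cong P {f} {g} h = sumFin-cong (λ z → pointwise z (P z) ≡.refl)
      where
      pointwise : ∀ z p → P z ≡ p → (if p then f z else 0#) ≈ (if p then g z else 0#)
      pointwise z true  e = h z e
      pointwise z false e = refl

  module ℕSum = ListSum ℕₚ.+-*-commutativeSemiring

-- Fields of characteristic zero and polynomial identities in them.

module FieldTools where
  open Summation
  open import Algebra.Bundles using (CommutativeRing)
  open import Data.Bool using (T)
  open import Data.Nat using (ℕ; zero; suc)
  import Data.Nat as ℕ
  import Data.Nat.Properties as ℕₚ
  open import Data.Integer as ℤ using (ℤ; +_; -[1+_]; +[1+_]; _⊖_)
  import Data.Integer.Properties as ℤₚ
  open import Data.Fin using (Fin; _≟_)
  open import Data.List using (List; []; _∷_; allFin)
  open import Data.Maybe using (nothing)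
  open import Data.Product using (_,_)
  open import Data.Vec as Vec using (Vec; []; _∷_)
  open import Relation.Nullary using (¬_; yes; contradiction)
  open import Relation.Nullary.Decidable using (isYes)
  open import Relation.Binary.PropositionalEquality as ≡ using (_≡_; _≢_)
  import Tactic.RingSolver.Core.AlmostCommutativeRing as ACR
  open import Tactic.RingSolver.Core.Polynomial.Parameters using (Homomorphism)
  open import Tactic.RingSolver.Core.Expression using (Expr; Κ; Ι; _⊕_; _⊗_; ⊝_; _⊛_; module Eval)

  module Field {c ℓ} (F : CharZeroField c ℓ) where
    open CharZeroField F public using (cring; 1≉0; inv; char0)
    open CommutativeRing cring public hiding (zero)
    open import Relation.Binary.Reasoning.Setoid setoid public
    open import Algebra.Properties.Ring ring public
      using (-‿distribˡ-*; -‿distribʳ-*; -0#≈0#; -‿involutive; x∙y⁻¹≈ε⇒x≈y; x≈y⇒x∙y⁻¹≈ε)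
    open import Algebra.Properties.AbelianGroup +-abelianGroup public using (⁻¹-∙-comm)
    open ListSum commutativeSemiring public

    ι : ℕ → Carrier
    ι = ofℕ cring

    ι-+ : ∀ m n → ι (m ℕ.+ n) ≈ ι m + ι n
    ι-+ zero    n = sym (+-identityˡ _)
    ι-+ (suc m) n = trans (+-congˡ (ι-+ m n)) (sym (+-assoc _ _ _))

    ι-* : ∀ m n → ι (m ℕ.* n) ≈ ι m * ι n
    ι-* zero    n = sym (zeroˡ _)
    ι-* (suc m) n = begin
      ι (n ℕ.+ m ℕ.* n)      ≈⟨ ι-+ n (m ℕ.* n) ⟩
      ι n + ι (m ℕ.* n)      ≈⟨ +-cong (sym (*-identityˡ _)) (ι-* m n) ⟩
      1# * ι n + ι m * ι n   ≈⟨ distribʳ _ _ _ ⟨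
      (1# + ι m) * ι n       ∎

    ιℤ : ℤ → Carrier
    ιℤ (+ n)      = ι n
    ιℤ (-[1+ n ]) = - ι (suc n)

    ιℤ-⊖ : ∀ m n → ιℤ (m ⊖ n) ≈ ι m + - ι n
    ιℤ-⊖ m       zero    = sym (trans (+-congˡ -0#≈0#) (+-identityʳ _))
    ιℤ-⊖ zero    (suc n) = sym (+-identityˡ _)
    ιℤ-⊖ (suc m) (suc n) = begin
      ιℤ (suc m ⊖ suc n)             ≡⟨ ≡.cong ιℤ (ℤₚ.[1+m]⊖[1+n]≡m⊖n m n) ⟩
      ιℤ (m ⊖ n)                     ≈⟨ ιℤ-⊖ m n ⟩
      ι m + - ι n                    ≈⟨ +-congʳ (+-identityˡ _) ⟨
      0# + ι m + - ι n               ≈⟨ +-congʳ (+-congʳ (-‿inverseʳ 1#)) ⟨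
      1# + - 1# + ι m + - ι n        ≈⟨ +-congʳ (trans (+-assoc _ _ _) (trans (+-congˡ (+-comm _ _)) (sym (+-assoc _ _ _)))) ⟩
      1# + ι m + - 1# + - ι n        ≈⟨ +-assoc _ _ _ ⟩
      1# + ι m + (- 1# + - ι n)      ≈⟨ +-congˡ (⁻¹-∙-comm _ _) ⟩
      ι (suc m) + - ι (suc n)        ∎

    ιℤ-neg : ∀ i → ιℤ (ℤ.- i) ≈ - ιℤ i
    ιℤ-neg (+ zero)  = sym -0#≈0#
    ιℤ-neg +[1+ n ]  = refl
    ιℤ-neg -[1+ n ]  = sym (-‿involutive _)

    ιℤ-+ : ∀ i j → ιℤ (i ℤ.+ j) ≈ ιℤ i + ιℤ j
    ιℤ-+ (+ m)    (+ n)    = ι-+ m n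
    ιℤ-+ (+ m)    -[1+ n ] = ιℤ-⊖ m (suc n)
    ιℤ-+ -[1+ m ] (+ n)    = trans (ιℤ-⊖ n (suc m)) (+-comm _ _)
    ιℤ-+ -[1+ m ] -[1+ n ] = begin
      - ι (suc (suc (m ℕ.+ n)))      ≡⟨ ≡.cong (λ k → - ι (suc k)) (≡.sym (ℕₚ.+-suc m n)) ⟩
      - ι (suc m ℕ.+ suc n)          ≈⟨ -‿cong (ι-+ (suc m) (suc n)) ⟩
      - (ι (suc m) + ι (suc n))      ≈⟨ ⁻¹-∙-comm _ _ ⟨
      - ι (suc m) + - ι (suc n)      ∎

    ιℤ-+* : ∀ m j → ιℤ (+ m ℤ.* j) ≈ ι m * ιℤ j
    ιℤ-+* zero    j = sym (zeroˡ _)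
    ιℤ-+* (suc m) j = begin
      ιℤ (+ suc m ℤ.* j)        ≡⟨ ≡.cong ιℤ (ℤₚ.suc-* (+ m) j) ⟩
      ιℤ (j ℤ.+ + m ℤ.* j)      ≈⟨ ιℤ-+ j (+ m ℤ.* j) ⟩
      ιℤ j + ιℤ (+ m ℤ.* j)     ≈⟨ +-cong (sym (*-identityˡ _)) (ιℤ-+* m j) ⟩
      1# * ιℤ j + ι m * ιℤ j    ≈⟨ distribʳ _ _ _ ⟨
      ι (suc m) * ιℤ j          ∎

    ιℤ-* : ∀ i j → ιℤ (i ℤ.* j) ≈ ιℤ i * ιℤ j
    ιℤ-* (+ m)    j = ιℤ-+* m j
    ιℤ-* -[1+ m ] j = begin
      ιℤ (-[1+ m ] ℤ.* j)          ≡⟨ ≡.cong ιℤ (≡.sym (ℤₚ.neg-distribˡ-* (+ suc m) j)) ⟩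
      ιℤ (ℤ.- (+ suc m ℤ.* j))     ≈⟨ ιℤ-neg (+ suc m ℤ.* j) ⟩
      - ιℤ (+ suc m ℤ.* j)         ≈⟨ -‿cong (ιℤ-+* (suc m) j) ⟩
      - (ι (suc m) * ιℤ j)         ≈⟨ -‿distribˡ-* _ _ ⟩
      ιℤ -[1+ m ] * ιℤ j           ∎

    ι-1 : ι 1 ≈ 1#
    ι-1 = +-identityʳ 1#

    ι≈0⇒≡0 : ∀ m → ι m ≈ 0# → m ≡ 0
    ι≈0⇒≡0 zero    h = ≡.refl
    ι≈0⇒≡0 (suc m) h = contradiction h (char0 m)

    ιℤ≈0⇒≡0 : ∀ i → ιℤ i ≈ 0# → i ≡ ℤ.0ℤ
    ιℤ≈0⇒≡0 (+ m)    h = ≡.cong +_ (ι≈0⇒≡0 m h)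
    ιℤ≈0⇒≡0 -[1+ m ] h = contradiction (trans (sym (-‿involutive _)) (trans (-‿cong h) -0#≈0#)) (char0 m)

    ι≉0 : ∀ {m} → m ≢ 0 → ¬ ι m ≈ 0#
    ι≉0 m≢0 h = m≢0 (ι≈0⇒≡0 _ h)

    ιℤ-injective : ∀ i j → ιℤ i ≈ ιℤ j → i ≡ j
    ιℤ-injective i j h = ℤₚ.i-j≡0⇒i≡j i j (ιℤ≈0⇒≡0 (i ℤ.- j) (begin
      ιℤ (i ℤ.+ ℤ.- j)      ≈⟨ ιℤ-+ i (ℤ.- j) ⟩
      ιℤ i + ιℤ (ℤ.- j)     ≈⟨ +-cong h (ιℤ-neg j) ⟩
      ιℤ j + - ιℤ j         ≈⟨ -‿inverseʳ _ ⟩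
      0#                    ∎))

    ι-injective : ∀ m n → ι m ≈ ι n → m ≡ n
    ι-injective m n h = ℤₚ.+-injective (ιℤ-injective (+ m) (+ n) h)

    ι-sumOver : ∀ {a} {A : Set a} (xs : List A) (f : A → ℕ) →
      ι (ℕSum.sumOver xs f) ≈ sumOver xs (λ x → ι (f x))
    ι-sumOver []       f = refl
    ι-sumOver (x ∷ xs) f = trans (ι-+ (f x) _) (+-congˡ (ι-sumOver xs f))

    ι-sumFin : ∀ {m} (f : Fin m → ℕ) → ι (ℕSum.sumFin f) ≈ sumFin (λ i → ι (f i))
    ι-sumFin f = trans (reflexive (≡.cong ι (ℕSum.sumFin≡sumOver f)))
      (trans (ι-sumOver (allFin _) f) (reflexive (≡.sym (sumFin≡sumOver (λ i → ι (f i))))))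

    *-cancelˡ-≉0 : ∀ {x y z} → ¬ x ≈ 0# → x * y ≈ x * z → y ≈ z
    *-cancelˡ-≉0 {x} {y} {z} x≉0 h with inv x x≉0
    ... | x⁻¹ , xx⁻¹≈1 = begin
      y               ≈⟨ *-identityˡ y ⟨
      1# * y          ≈⟨ *-congʳ (trans (*-comm _ _) xx⁻¹≈1) ⟨
      x⁻¹ * x * y     ≈⟨ *-assoc _ _ _ ⟩
      x⁻¹ * (x * y)   ≈⟨ *-congˡ h ⟩
      x⁻¹ * (x * z)   ≈⟨ *-assoc _ _ _ ⟨
      x⁻¹ * x * z     ≈⟨ *-congʳ (trans (*-comm _ _) xx⁻¹≈1) ⟩
      1# * z          ≈⟨ *-identityˡ z ⟩
      z               ∎

    *-zero-cancelˡ : ∀ {x y} → ¬ x ≈ 0# → x * y ≈ 0# → y ≈ 0#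
    *-zero-cancelˡ x≉0 h = *-cancelˡ-≉0 x≉0 (trans h (sym (zeroʳ _)))

    *-≉0 : ∀ {x y} → ¬ x ≈ 0# → ¬ y ≈ 0# → ¬ x * y ≈ 0#
    *-≉0 x≉0 y≉0 h = y≉0 (*-zero-cancelˡ x≉0 h)

    private
      -- `ιℤ` sends 1 to `1# + 0#`; the extra clause makes the constant `:1` denote `1#` itself, so
      -- that solved identities match goals in which `1#` occurs.
      coefficient : ℤ → Carrier
      coefficient (+ 1) = 1#
      coefficient i     = ιℤ i

      coefficient≈ιℤ : ∀ i → coefficient i ≈ ιℤ i
      coefficient≈ιℤ (+ 0)           = refl
      coefficient≈ιℤ (+ 1)           = sym ι-1
      coefficient≈ιℤ (+ suc (suc n)) = refl
      coefficient≈ιℤ -[1+ n ]        = refl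

    -- Integer coefficients keep zero coefficients recognisable although _≈_ is not decidable.
    private
      field-acr : ACR.AlmostCommutativeRing _ _
      field-acr = ACR.fromCommutativeRing cring (λ _ → nothing)

      homomorphism : Homomorphism _ _ _ _
      homomorphism = record
        { from = record
          { rawRing = CommutativeRing.rawRing ℤₚ.+-*-commutativeRing
          ; isZero  = λ i → isYes (i ℤ.≟ ℤ.0ℤ)
          }
        ; to = field-acr
        ; morphism = record
          { ⟦_⟧    = coefficient
          ; +-homo = λ i j → trans (coefficient≈ιℤ (i ℤ.+ j)) (trans (ιℤ-+ i j)
                       (sym (+-cong (coefficient≈ιℤ i) (coefficient≈ιℤ j))))
          ; *-homo = λ i j → trans (coefficient≈ιℤ (i ℤ.* j)) (trans (ιℤ-* i j)
                       (sym (*-cong (coefficient≈ιℤ i) (coefficient≈ιℤ j))))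
          ; -‿homo = λ i → trans (coefficient≈ιℤ (ℤ.- i)) (trans (ιℤ-neg i)
                       (sym (-‿cong (coefficient≈ιℤ i))))
          ; 0-homo = refl
          ; 1-homo = refl
          }
        ; Zero-C⟶Zero-R = zero-homo
        }
        where
        zero-homo : ∀ i → T (isYes (i ℤ.≟ ℤ.0ℤ)) → 0# ≈ coefficient i
        zero-homo i t with i ℤ.≟ ℤ.0ℤ
        ... | yes ≡.refl = refl

      open Eval (ACR.AlmostCommutativeRing.rawRing field-acr) coefficient
      open import Tactic.RingSolver.Core.Polynomial.Base (Homomorphism.from homomorphism)
        using (Poly; _⊞_; _⊠_; ⊟_; _⊡_; κ) renaming (ι to variable′)
      open import Tactic.RingSolver.Core.Polynomial.Semantics homomorphism using () renaming (⟦_⟧ to ⟦_⟧ₚ)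
      open import Tactic.RingSolver.Core.Polynomial.Homomorphism homomorphism
      open import Algebra.Properties.Semiring.Exp.TCOptimised semiring using (^-congˡ)

      norm : ∀ {n} → Expr ℤ n → Poly n
      norm (Κ x)   = κ x
      norm (Ι x)   = variable′ x
      norm (x ⊕ y) = norm x ⊞ norm y
      norm (x ⊗ y) = norm x ⊠ norm y
      norm (⊝ x)   = ⊟ norm x
      norm (x ⊛ i) = norm x ⊡ i

      ⟦_⇓⟧ : ∀ {n} → Expr ℤ n → Vec Carrier n → Carrier
      ⟦ e ⇓⟧ = ⟦ norm e ⟧ₚ

      correct : ∀ {n} (e : Expr ℤ n) ρ → ⟦ e ⇓⟧ ρ ≈ ⟦ e ⟧ ρ
      correct (Κ x)   ρ = κ-hom x ρ
      correct (Ι x)   ρ = ι-hom x ρ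
      correct (x ⊕ y) ρ = trans (⊞-hom (norm x) (norm y) ρ) (+-cong (correct x ρ) (correct y ρ))
      correct (x ⊗ y) ρ = trans (⊠-hom (norm x) (norm y) ρ) (*-cong (correct x ρ) (correct y ρ))
      correct (⊝ x)   ρ = trans (⊟-hom (norm x) ρ) (-‿cong (correct x ρ))
      correct (x ⊛ i) ρ = trans (⊡-hom (norm x) i ρ) (^-congˡ i (correct x ρ))

    open import Relation.Binary.Reflection setoid Ι ⟦_⟧ ⟦_⇓⟧ correct public using (solve; _⊜_)

    :1 :2 : ∀ {n} → Expr ℤ n
    :1 = Κ (+ 1)
    :2 = Κ (+ 2)

    infixl 6 _:-_
    _:-_ : ∀ {n} → Expr ℤ n → Expr ℤ n → Expr ℤ n
    x :- y = x ⊕ ⊝ y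

    -- A certificate format for elimination: `a - b` is exhibited as a combination of the
    -- differences of the two sides of known equations, with explicit cofactors `s`. What remains is
    -- a polynomial identity, which the ring solver checks.
    by-linear₁ : ∀ {a b p q} s → p ≈ q → a ≈ b + s * (p + - q) → a ≈ b
    by-linear₁ {a} {b} {p} {q} s h e = begin
      a                     ≈⟨ e ⟩
      b + s * (p + - q)     ≈⟨ +-congˡ (*-congˡ (x≈y⇒x∙y⁻¹≈ε h)) ⟩
      b + s * 0#            ≈⟨ +-congˡ (zeroʳ s) ⟩
      b + 0#                ≈⟨ +-identityʳ b ⟩
      b                     ∎

    by-linear₂ : ∀ {a b p q p′ q′} s s′ → p ≈ q → p′ ≈ q′ →
      a ≈ b + s * (p + - q) + s′ * (p′ + - q′) → a ≈ b
    by-linear₂ s s′ h h′ e = by-linear₁ s h (by-linear₁ s′ h′ e)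

    by-linear₃ : ∀ {a b p q p′ q′ p″ q″} s s′ s″ → p ≈ q → p′ ≈ q′ → p″ ≈ q″ →
      a ≈ b + s * (p + - q) + s′ * (p′ + - q′) + s″ * (p″ + - q″) → a ≈ b
    by-linear₃ s s′ s″ h h′ h″ e = by-linear₂ s s′ h h′ (by-linear₁ s″ h″ e)

    by-linear₄ : ∀ {a b p q p′ q′ p″ q″ p‴ q‴} s s′ s″ s‴ → p ≈ q → p′ ≈ q′ → p″ ≈ q″ → p‴ ≈ q‴ →
      a ≈ b + s * (p + - q) + s′ * (p′ + - q′) + s″ * (p″ + - q″) + s‴ * (p‴ + - q‴) → a ≈ b
    by-linear₄ s s′ s″ s‴ h h′ h″ h‴ e = by-linear₃ s s′ s″ h h′ h″ (by-linear₁ s‴ h‴ e)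

    -- Identities between natural-number polynomials that hold in F hold in ℕ.
    data NatExpr (n : ℕ) : Set where
      `1       : NatExpr n
      `_       : Fin n → NatExpr n
      _`+_ _`*_ : NatExpr n → NatExpr n → NatExpr n

    infixl 6 _`+_
    infixl 7 _`*_
    infix 8 `_

    evalℕ : ∀ {n} → NatExpr n → Vec ℕ n → ℕ
    evalℕ `1       ρ = 1
    evalℕ (` i)    ρ = Vec.lookup ρ i
    evalℕ (e `+ f) ρ = evalℕ e ρ ℕ.+ evalℕ f ρ
    evalℕ (e `* f) ρ = evalℕ e ρ ℕ.* evalℕ f ρ

    evalF : ∀ {n} → NatExpr n → Vec ℕ n → Carrier
    evalF `1       ρ = 1#
    evalF (` i)    ρ = ι (Vec.lookup ρ i)
    evalF (e `+ f) ρ = evalF e ρ + evalF f ρ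
    evalF (e `* f) ρ = evalF e ρ * evalF f ρ

    ι-eval : ∀ {n} (e : NatExpr n) ρ → ι (evalℕ e ρ) ≈ evalF e ρ
    ι-eval `1       ρ = ι-1
    ι-eval (` i)    ρ = refl
    ι-eval (e `+ f) ρ = trans (ι-+ (evalℕ e ρ) (evalℕ f ρ)) (+-cong (ι-eval e ρ) (ι-eval f ρ))
    ι-eval (e `* f) ρ = trans (ι-* (evalℕ e ρ) (evalℕ f ρ)) (*-cong (ι-eval e ρ) (ι-eval f ρ))

    ℕ-identity : ∀ {n} (e f : NatExpr n) ρ → evalF e ρ ≈ evalF f ρ → evalℕ e ρ ≡ evalℕ f ρ
    ℕ-identity e f ρ h = ι-injective _ _ (trans (ι-eval e ρ) (trans h (sym (ι-eval f ρ))))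

-- The metric of a connected graph.

module GraphMetric where
  open Summation
  open import Data.Bool using (Bool; true; false; _∧_; _∨_; if_then_else_; T)
  open import Data.Bool.Properties using (∨-zeroʳ)
  open import Data.Bool.ListAction using (any)
  open import Data.Nat as ℕ using (ℕ; zero; suc; _≤_; _≡ᵇ_; z≤n)
  import Data.Nat.Properties as ℕₚ
  open import Data.Fin using (Fin; _≟_)
  open import Data.List using (_∷_; allFin)
  open import Data.List.Membership.Propositional using (_∈_)
  open import Data.List.Membership.Propositional.Properties using (∈-allFin)
  open import Data.List.Relation.Unary.Any using (here; there)
  open import Data.Product using (_×_; _,_; proj₁; proj₂; ∃; Σ)
  open import Data.Sum using (_⊎_; inj₁; inj₂)
  open import Relation.Nullary using (does; yes; contradiction)
  open import Relation.Nullary.Decidable using (dec-true)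
  open import Relation.Binary.PropositionalEquality as ≡ using (_≡_; _≢_; refl; sym; trans; cong; subst)

  true≢false : true ≢ false
  true≢false ()

  ∧-true⁻ : ∀ {a b} → a ∧ b ≡ true → a ≡ true × b ≡ true
  ∧-true⁻ {true} {true} _ = refl , refl

  ∧-true⁺ : ∀ {a b} → a ≡ true → b ≡ true → a ∧ b ≡ true
  ∧-true⁺ refl refl = refl

  ≢true⇒≡false : ∀ {b} → b ≢ true → b ≡ false
  ≢true⇒≡false {true}  h = contradiction refl h
  ≢true⇒≡false {false} h = refl

  does-≟⁻ : ∀ {n} {x y : Fin n} → does (x ≟ y) ≡ true → x ≡ y
  does-≟⁻ {x = x} {y} h with x ≟ y
  ... | yes e = e

  ≡ᵇ-true⁻ : ∀ {m n} → (m ≡ᵇ n) ≡ true → m ≡ n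
  ≡ᵇ-true⁻ {m} {n} h = ℕₚ.≡ᵇ⇒≡ m n (subst T (sym h) _)

  ≡ᵇ-true⁺ : ∀ {m n} → m ≡ n → (m ≡ᵇ n) ≡ true
  ≡ᵇ-true⁺ {m} refl = go m
    where
    go : ∀ m → (m ≡ᵇ m) ≡ true
    go zero    = refl
    go (suc m) = go m

  ≡ᵇ-false⁺ : ∀ {m n} → m ≢ n → (m ≡ᵇ n) ≡ false
  ≡ᵇ-false⁺ m≢n = ≢true⇒≡false (λ h → m≢n (≡ᵇ-true⁻ h))

  any-true⁻ : ∀ {A : Set} (p : A → Bool) xs → any p xs ≡ true → ∃ λ x → p x ≡ true
  any-true⁻ p (x ∷ xs) h with p x in e
  ... | true  = x , e
  ... | false = any-true⁻ p xs h

  any-true⁺ : ∀ {A : Set} (p : A → Bool) {xs x} → x ∈ xs → p x ≡ true → any p xs ≡ true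
  any-true⁺ p (here refl)           h rewrite h = refl
  any-true⁺ p (there {x = y} x∈xs)  h = trans (cong (p y ∨_) (any-true⁺ p x∈xs h)) (∨-zeroʳ (p y))

  leastFrom : (ℕ → Bool) → ℕ → ℕ → ℕ
  leastFrom p k zero    = k
  leastFrom p k (suc f) = if p k then k else leastFrom p (suc k) f

  -- When the fuel runs out, `k + f` is returned unchecked, hence the hypothesis there; for `dist`
  -- it is connectedness.
  leastFrom-true : ∀ (p : ℕ → Bool) k f → p (k ℕ.+ f) ≡ true → p (leastFrom p k f) ≡ true
  leastFrom-true p k zero    h = subst (λ j → p j ≡ true) (ℕₚ.+-identityʳ k) h
  leastFrom-true p k (suc f) h with p k in e
  ... | true  = e
  ... | false = leastFrom-true p (suc k) f (subst (λ j → p j ≡ true) (ℕₚ.+-suc k f) h)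

  leastFrom-≤ : ∀ (p : ℕ → Bool) k f j → k ≤ j → p j ≡ true → leastFrom p k f ≤ j
  leastFrom-≤ p k zero    j k≤j h = k≤j
  leastFrom-≤ p k (suc f) j k≤j h with p k in e
  ... | true  = k≤j
  ... | false with ℕₚ.m≤n⇒m<n∨m≡n k≤j
  ...   | inj₁ k<j  = leastFrom-≤ p (suc k) f j k<j h
  ...   | inj₂ refl = contradiction (trans (sym h) e) true≢false

  -- The search loop of dist is local to its definition: the underscore below can only be
  -- filled by unification, against the value of dist generalised over its fuel.
  private
    PointedGraph : Set
    PointedGraph = Σ Graph (λ H → Fin (Graph.n H) × Fin (Graph.n H))

    reachable : PointedGraph → ℕ → Bool
    reachable (H , x , y) k = reach H k x y

    mutual
      dist≡leastFrom′ : ∀ (H : PointedGraph) → dist (proj₁ H) (proj₁ (proj₂ H)) (proj₂ (proj₂ H)) ≡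
        leastFrom (reachable H) 0 (Graph.n (proj₁ H))
      dist≡leastFrom′ H with Graph.n (proj₁ H) | zero
      ... | f | k = search≡leastFrom H k f

      search≡leastFrom : ∀ (H : PointedGraph) k f → _ ≡ leastFrom (reachable H) k f
      search≡leastFrom H k zero    = refl
      search≡leastFrom H k (suc f) =
        cong (λ j → if reachable H k then k else j) (search≡leastFrom H (suc k) f)

  dist≡leastFrom : ∀ G x y → dist G x y ≡ leastFrom (λ k → reach G k x y) 0 (Graph.n G)
  dist≡leastFrom G x y = dist≡leastFrom′ (G , x , y)

  module Metric (G : Graph) (conn : Connected G) where
    open Graph G using (n; adj) renaming (sym to adj-sym; irrefl to adj-irrefl) public

    X : Set
    X = Fin n

    d : X → X → ℕ
    d = dist G

    reach-suc⁻ : ∀ k x y → reach G (suc k) x y ≡ true →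
      reach G k x y ≡ true ⊎ ∃ λ z → reach G k x z ≡ true × adj z y ≡ true
    reach-suc⁻ k x y h with reach G k x y
    ... | true  = inj₁ refl
    ... | false with any-true⁻ _ (allFin n) h
    ...   | z , h′ = inj₂ (z , ∧-true⁻ h′)

    reach-suc⁺ : ∀ k {x z y} → reach G k x z ≡ true → adj z y ≡ true → reach G (suc k) x y ≡ true
    reach-suc⁺ k {x} {z} {y} h h′ = trans
      (cong (reach G k x y ∨_) (any-true⁺ (λ z → reach G k x z ∧ adj z y) (∈-allFin z) (∧-true⁺ h h′)))
      (∨-zeroʳ _)

    reach-refl : ∀ x → reach G 0 x x ≡ true
    reach-refl x = dec-true (x ≟ x) refl

    reach-step : ∀ k {x y} → reach G k x y ≡ true → reach G (suc k) x y ≡ true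
    reach-step k h rewrite h = refl

    reach-≤ : ∀ {j k x y} → j ≤ k → reach G j x y ≡ true → reach G k x y ≡ true
    reach-≤ {j} {k} j≤k h = go (ℕₚ.≤⇒≤′ j≤k)
      where
      go : ∀ {k} → j ℕ.≤′ k → reach G k _ _ ≡ true
      go ℕ.≤′-refl       = h
      go (ℕ.≤′-step {k} p) = reach-step k (go p)

    reach-trans : ∀ j k {x y z} → reach G j x y ≡ true → reach G k y z ≡ true → reach G (j ℕ.+ k) x z ≡ true
    reach-trans j zero {x} h h′ =
      subst (λ w → reach G (j ℕ.+ 0) x w ≡ true) (does-≟⁻ h′) (reach-≤ {j} {j ℕ.+ 0} {x} (ℕₚ.≤-reflexive (sym (ℕₚ.+-identityʳ j))) h)
    reach-trans j (suc k) {x} {y} {z} h h′ with reach-suc⁻ k y z h′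
    ... | inj₁ p           = reach-≤ (ℕₚ.+-monoʳ-≤ j (ℕₚ.n≤1+n k)) (reach-trans j k h p)
    ... | inj₂ (w , p , q) = reach-≤ (ℕₚ.≤-reflexive (sym (ℕₚ.+-suc j k))) (reach-suc⁺ (j ℕ.+ k) (reach-trans j k h p) q)

    reach-sym : ∀ k {x y} → reach G k x y ≡ true → reach G k y x ≡ true
    reach-sym zero {x} {y} h = subst (λ w → reach G 0 w x ≡ true) (does-≟⁻ {x = x} {y} h) (reach-refl x)
    reach-sym (suc k) {x} {y} h with reach-suc⁻ k x y h
    ... | inj₁ p           = reach-step k (reach-sym k p)
    ... | inj₂ (z , p , q) = reach-trans 1 k
      {y} {z} {x} (reach-suc⁺ 0 {y} {y} {z} (reach-refl y) (trans (adj-sym y z) q)) (reach-sym k p)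

    reach-d : ∀ x y → reach G (d x y) x y ≡ true
    reach-d x y = subst (λ k → reach G k x y ≡ true) (sym (dist≡leastFrom G x y))
      (leastFrom-true (λ k → reach G k x y) 0 n (conn x y))

    d≤⇐reach : ∀ {k x y} → reach G k x y ≡ true → d x y ≤ k
    d≤⇐reach {k} {x} {y} h = subst (_≤ k) (sym (dist≡leastFrom G x y))
      (leastFrom-≤ (λ k → reach G k x y) 0 n k z≤n h)

    d-refl : ∀ x → d x x ≡ 0
    d-refl x = ℕₚ.n≤0⇒n≡0 (d≤⇐reach (reach-refl x))

    d≡0⇒≡ : ∀ {x y} → d x y ≡ 0 → x ≡ y
    d≡0⇒≡ {x} {y} e = does-≟⁻ (subst (λ k → reach G k x y ≡ true) e (reach-d x y))

    d-triangle : ∀ x y z → d x z ≤ d x y ℕ.+ d y z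
    d-triangle x y z = d≤⇐reach (reach-trans (d x y) (d y z) (reach-d x y) (reach-d y z))

    d-sym : ∀ x y → d x y ≡ d y x
    d-sym x y = ℕₚ.≤-antisym (flip≤ x y) (flip≤ y x)
      where
      flip≤ : ∀ x y → d x y ≤ d y x
      flip≤ x y = d≤⇐reach (reach-sym (d y x) (reach-d y x))

    adj⇒≢ : ∀ {x y} → adj x y ≡ true → x ≢ y
    adj⇒≢ {x} h refl = true≢false (trans (sym h) (adj-irrefl x))

    adj⇒d≡1 : ∀ {x y} → adj x y ≡ true → d x y ≡ 1
    adj⇒d≡1 {x} {y} h = ℕₚ.≤-antisym (d≤⇐reach {1} {x} {y} (reach-suc⁺ 0 {x} {x} {y} (reach-refl x) h))
      (ℕₚ.n≢0⇒n>0 (λ e → adj⇒≢ h (d≡0⇒≡ e)))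

    d-suc⇒∃ : ∀ {x y i} → d x y ≡ suc i → ∃ λ z → d x z ≡ i × d z y ≡ 1 × adj z y ≡ true
    d-suc⇒∃ {x} {y} {i} e with reach-suc⁻ i x y (subst (λ k → reach G k x y ≡ true) e (reach-d x y))
    ... | inj₁ p = contradiction (ℕₚ.≤-trans (ℕₚ.≤-reflexive (sym e)) (d≤⇐reach p)) (ℕₚ.<⇒≱ ℕₚ.≤-refl)
    ... | inj₂ (z , p , q) = z , ℕₚ.≤-antisym (d≤⇐reach p) (ℕ.s≤s⁻¹ (begin
        suc i               ≡⟨ e ⟨
        d x y               ≤⟨ d-triangle x z y ⟩
        d x z ℕ.+ d z y     ≡⟨ cong (d x z ℕ.+_) (adj⇒d≡1 q) ⟩
        d x z ℕ.+ 1         ≡⟨ ℕₚ.+-comm (d x z) 1 ⟩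
        suc (d x z)         ∎)) , adj⇒d≡1 q , q
      where open ℕₚ.≤-Reasoning

    d≡1⇒adj : ∀ {x y} → d x y ≡ 1 → adj x y ≡ true
    d≡1⇒adj {x} {y} e with d-suc⇒∃ e
    ... | z , xz , _ , a = subst (λ w → adj w y ≡ true) (sym (d≡0⇒≡ xz)) a

    d-adj-≤ : ∀ {x z} v → d x z ≡ 1 → d z v ≤ suc (d x v)
    d-adj-≤ {x} {z} v e = ℕₚ.≤-trans (d-triangle z x v)
      (ℕₚ.≤-reflexive (cong (ℕ._+ d x v) (trans (d-sym z x) e)))

-- Cardinalities and double counting.

module Counting where
  open Summation
  open GraphMetric
  open import Data.Bool using (Bool; true; false; _∧_; if_then_else_; not; T)
  open import Data.Nat as ℕ using (ℕ; suc; _≤_; z≤n; s≤s)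
  import Data.Nat.Properties as ℕₚ
  open import Data.Fin using (Fin; _≟_)
  open import Data.Fin.Properties using (any?)
  open import Data.List using ([]; _∷_; map; allFin)
  open import Data.Nat.ListAction using (sum)
  open import Data.Product using (_×_; _,_; proj₁; proj₂; ∃)
  import Data.Bool as Bool
  open import Relation.Nullary using (does; yes; no; contradiction)
  open import Relation.Nullary.Decidable using (dec-true; dec-false)
  open import Relation.Binary.PropositionalEquality as ≡ using (_≡_; _≢_; refl; sym; trans; cong; subst)

  -- Independent of a graph, unlike `count`: the points of the reconstructed set are counted as well
  -- as the vertices.
  #_ : ∀ {m} → (Fin m → Bool) → ℕ
  # P = ℕSum.sumFin (λ z → if P z then 1 else 0)

  count≡# : ∀ G (P : Fin (Graph.n G) → Bool) → count G P ≡ # P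
  count≡# G P = trans (go (allFin (Graph.n G))) (sym (ℕSum.sumFin≡sumOver _))
    where
    go : ∀ zs → sum (map (λ z → if P z then 1 else 0) zs) ≡ ℕSum.sumOver zs (λ z → if P z then 1 else 0)
    go []       = refl
    go (z ∷ zs) = cong ((if P z then 1 else 0) ℕ.+_) (go zs)

  module _ {m : ℕ} where
    infixl 6 _∖_
    _∖_ : (Fin m → Bool) → Fin m → Fin m → Bool
    (P ∖ w) z = P z ∧ not (does (z ≟ w))

    ∖⁺ : ∀ P {w z : Fin m} → P z ≡ true → z ≢ w → (P ∖ w) z ≡ true
    ∖⁺ P {w} {z} h z≢w = ∧-true⁺ h (cong not (dec-false (z ≟ w) z≢w))

    ∖⁻ : ∀ P {w z : Fin m} → (P ∖ w) z ≡ true → P z ≡ true × z ≢ w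
    ∖⁻ P {w} {z} h with ∧-true⁻ h
    ... | h₁ , h₂ = h₁ , λ e → true≢false (trans (sym h₂) (cong not (dec-true (z ≟ w) e)))

    #-cong : ∀ {P Q : Fin m → Bool} → (∀ z → P z ≡ Q z) → # P ≡ # Q
    #-cong h = ℕSum.sumFin-cong (λ z → cong (λ b → if b then 1 else 0) (h z))

    #-split : ∀ (P R : Fin m → Bool) → # P ≡ # (λ z → P z ∧ R z) ℕ.+ # (λ z → P z ∧ not (R z))
    #-split P R = trans (ℕSum.sumFin-cong (λ z → pointwise (P z) (R z)))
      (ℕSum.sumFin-+ _ _)
      where
      pointwise : ∀ p r → (if p then 1 else 0) ≡ (if p ∧ r then 1 else 0) ℕ.+ (if p ∧ not r then 1 else 0)
      pointwise true  true  = refl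
      pointwise true  false = refl
      pointwise false r     = refl

    #-only : ∀ (P : Fin m → Bool) w → P w ≡ true → (∀ z → P z ≡ true → z ≡ w) → # P ≡ 1
    #-only P w h only = trans (ℕSum.sumFin-only (λ z → if P z then 1 else 0) w
        (λ z z≢w → cong (λ b → if b then 1 else 0) (≢true⇒≡false (λ e → z≢w (only z e)))))
      (cong (λ b → if b then 1 else 0) h)

    #-∖ : ∀ (P : Fin m → Bool) {w} → P w ≡ true → # P ≡ suc (# (P ∖ w))
    #-∖ P {w} h = trans (#-split P (λ z → does (z ≟ w)))
      (cong (ℕ._+ # (P ∖ w)) (#-only _ w (∧-true⁺ h (dec-true (w ≟ w) refl))
        (λ z e → does-≟⁻ (proj₂ (∧-true⁻ {P z} e)))))

    #-none : ∀ (P : Fin m → Bool) → (∀ z → P z ≢ true) → # P ≡ 0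
    #-none P h = ℕSum.sumFin-zero (λ z → cong (λ b → if b then 1 else 0) (≢true⇒≡false (h z)))

    #≥1 : ∀ (P : Fin m → Bool) {w} → P w ≡ true → 1 ≤ # P
    #≥1 P h = subst (1 ≤_) (sym (#-∖ P h)) (s≤s z≤n)

    #≥2 : ∀ (P : Fin m → Bool) {w w′} → P w ≡ true → P w′ ≡ true → w ≢ w′ → 2 ≤ # P
    #≥2 P h h′ w≢w′ = subst (2 ≤_) (sym (#-∖ P h)) (s≤s (#≥1 _ (∖⁺ P h′ (λ e → w≢w′ (sym e)))))

    #≢0⇒∃ : ∀ (P : Fin m → Bool) → # P ≢ 0 → ∃ λ z → P z ≡ true
    #≢0⇒∃ P h with any? (λ z → P z Bool.≟ true)
    ... | yes e = e
    ... | no ne = contradiction (#-none P (λ z e → ne (z , e))) h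

    #≥1⇒∃ : ∀ (P : Fin m → Bool) → 1 ≤ # P → ∃ λ z → P z ≡ true
    #≥1⇒∃ P h = #≢0⇒∃ P (λ e → ℕₚ.<⇒≢ h (sym e))

    #≥2⇒∃₂ : ∀ (P : Fin m → Bool) → 2 ≤ # P → ∃ λ z → ∃ λ w → P z ≡ true × P w ≡ true × z ≢ w
    #≥2⇒∃₂ P h with #≥1⇒∃ P (ℕₚ.≤-trans (s≤s z≤n) h)
    ... | z , hz with #≥1⇒∃ (P ∖ z) (ℕ.s≤s⁻¹ (subst (2 ≤_) (#-∖ P hz) h))
    ...   | w , hw = z , w , hz , proj₁ (∖⁻ P hw) , λ e → proj₂ (∖⁻ P hw) (sym e)

    #≥2⇒∃-other : ∀ (P : Fin m → Bool) {w} → 2 ≤ # P → P w ≡ true → ∃ λ z → P z ≡ true × w ≢ z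
    #≥2⇒∃-other P {w} h hw with #≥1⇒∃ (P ∖ w) (ℕ.s≤s⁻¹ (subst (2 ≤_) (#-∖ P hw) h))
    ... | z , hz = z , proj₁ (∖⁻ P hz) , λ e → proj₂ (∖⁻ P hz) (sym e)

    #≤1⇒unique : ∀ (P : Fin m → Bool) {z w} → # P ≤ 1 → P z ≡ true → P w ≡ true → z ≡ w
    #≤1⇒unique P {z} {w} h hz hw with z ≟ w
    ... | yes e = e
    ... | no ne = contradiction (ℕₚ.≤-trans (#≥2 P hz hw ne) h) (λ { (s≤s ()) })

    double-count : ∀ (S T : Fin m → Bool) (_~_ : Fin m → Fin m → Bool) b c →
      (∀ y → S y ≡ true → # (λ z → T z ∧ (y ~ z)) ≡ b) →
      (∀ z → T z ≡ true → # (λ y → S y ∧ (y ~ z)) ≡ c) →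
      # S ℕ.* b ≡ # T ℕ.* c
    double-count S T _~_ b c hS hT = begin
      # S ℕ.* b
        ≡⟨ weigh S b (λ y z → T z ∧ (y ~ z)) hS ⟩
      ℕSum.sumFin (λ y → ℕSum.sumFin (λ z → if S y ∧ (T z ∧ (y ~ z)) then 1 else 0))
        ≡⟨ ℕSum.sumFin-swap _ ⟩
      ℕSum.sumFin (λ z → ℕSum.sumFin (λ y → if S y ∧ (T z ∧ (y ~ z)) then 1 else 0))
        ≡⟨ ℕSum.sumFin-cong (λ z → ℕSum.sumFin-cong (λ y → cong (λ e → if e then 1 else 0) (exchange (S y) (T z) (y ~ z)))) ⟩
      ℕSum.sumFin (λ z → ℕSum.sumFin (λ y → if T z ∧ (S y ∧ (y ~ z)) then 1 else 0))
        ≡⟨ weigh T c (λ z y → S y ∧ (y ~ z)) hT ⟨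
      # T ℕ.* c ∎
      where
      open ≡.≡-Reasoning
      exchange : ∀ p q r → p ∧ (q ∧ r) ≡ q ∧ (p ∧ r)
      exchange true  q     r = refl
      exchange false true  r = refl
      exchange false false r = refl
      weigh : ∀ (P : Fin m → Bool) a (R : Fin m → Fin m → Bool) → (∀ y → P y ≡ true → # (R y) ≡ a) →
        # P ℕ.* a ≡ ℕSum.sumFin (λ y → ℕSum.sumFin (λ z → if P y ∧ R y z then 1 else 0))
      weigh P a R h = trans (ℕSum.*-distribʳ-sumFin a _) (ℕSum.sumFin-cong (λ y → pointwise y (P y) refl))
        where
        pointwise : ∀ y p → P y ≡ p → (if p then 1 else 0) ℕ.* a ≡ ℕSum.sumFin (λ z → if p ∧ R y z then 1 else 0)
        pointwise y true  e = trans (ℕₚ.+-identityʳ a) (sym (h y e))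
        pointwise y false e = sym (ℕSum.sumFin-zero (λ z → refl))

-- Consequences of distance-regularity, of the vanishing a_i and of girth 6.

module AlmostBipartite where
  open Summation
  open GraphMetric
  open Counting
  open import Data.Bool using (Bool; true; false; _∧_)
  open import Data.Nat as ℕ using (ℕ; zero; suc; _≤_; _<_; _≡ᵇ_; z≤n; s≤s; _<?_)
  import Data.Nat.Properties as ℕₚ
  open import Data.Fin using (Fin; _≟_)
  import Data.Fin as Fin
  open import Data.Product using (_×_; _,_; proj₁; proj₂; ∃)
  open import Data.Sum using (_⊎_; inj₁; inj₂)
  open import Data.Empty using (⊥-elim)
  open import Relation.Nullary using (yes; no; contradiction)
  open import Relation.Binary.Definitions using (tri<; tri≈; tri>)
  open import Data.Bool.Properties using (∧-comm)
  open import Relation.Binary.PropositionalEquality as ≡ using (_≡_; _≢_; refl; sym; trans; cong; subst)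

  module AlmostBipartiteGraph (G : Graph) (conn : Connected G) (D k : ℕ) (dr : DistanceRegular G D)
    (ab : AlmostBipartite G D) (3≤D : 3 ≤ D) (val : Valency G k) (girth : Girth G 6) where
    open Metric G conn public

    d≤D : ∀ x y → d x y ≤ D
    d≤D = proj₁ (proj₁ dr)

    sphere² : X → X → ℕ → ℕ → X → Bool
    sphere² x y i j z = (d x z ≡ᵇ i) ∧ (d y z ≡ᵇ j)

    sphere²⁺ : ∀ {x y i j z} → d x z ≡ i → d z y ≡ j → sphere² x y i j z ≡ true
    sphere²⁺ {x} {y} {i} {j} {z} e e′ = ∧-true⁺ (≡ᵇ-true⁺ e) (≡ᵇ-true⁺ (trans (d-sym y z) e′))

    sphere²⁻ : ∀ {x y i j z} → sphere² x y i j z ≡ true → d x z ≡ i × d z y ≡ j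
    sphere²⁻ {x} {y} {i} {j} {z} h with ∧-true⁻ {d x z ≡ᵇ i} h
    ... | h₁ , h₂ = ≡ᵇ-true⁻ h₁ , trans (d-sym z y) (≡ᵇ-true⁻ h₂)

    #sphere²-const : ∀ x y x′ y′ i j → d x y ≡ d x′ y′ → # (sphere² x y i j) ≡ # (sphere² x′ y′ i j)
    #sphere²-const x y x′ y′ i j e = trans (sym (count≡# G (sphere² x y i j)))
      (trans (proj₂ dr x y x′ y′ i j e) (count≡# G (sphere² x′ y′ i j)))

    #sphere²-sym : ∀ x y i j → # (sphere² x y i j) ≡ # (sphere² x y j i)
    #sphere²-sym x y i j = trans (#sphere²-const x y y x i j (d-sym x y))
      (#-cong (λ z → ∧-comm (d y z ≡ᵇ i) (d x z ≡ᵇ j)))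

    #neighbours : ∀ x → # (λ z → d x z ≡ᵇ 1) ≡ k
    #neighbours x = trans (#-cong (λ z → sym (adj≡ z))) (trans (sym (count≡# G (adj x))) (val x))
      where
      adj≡ : ∀ z → adj x z ≡ (d x z ≡ᵇ 1)
      adj≡ z with adj x z in e
      ... | true  = sym (≡ᵇ-true⁺ (adj⇒d≡1 e))
      ... | false = sym (≡ᵇ-false⁺ (λ e′ → true≢false (trans (sym (d≡1⇒adj e′)) e)))

    -- A neighbour of a vertex at distance i is one step closer or at distance nxt i; nxt is junk above D.
    nxt : ℕ → ℕ
    nxt i with i <? D
    ... | yes _ = suc i
    ... | no  _ = D

    nxt-< : ∀ {i} → i < D → nxt i ≡ suc i
    nxt-< {i} i<D with i <? D
    ... | yes _   = refl
    ... | no i≮D = contradiction i<D i≮D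

    nxt-D : nxt D ≡ D
    nxt-D with D <? D
    ... | yes D<D = contradiction D<D (ℕₚ.<-irrefl refl)
    ... | no _    = refl

    ≤D-cases : ∀ {i} → i ≤ D → i < D ⊎ i ≡ D
    ≤D-cases = ℕₚ.m≤n⇒m<n∨m≡n

    nxt≤D : ∀ {i} → i ≤ D → nxt i ≤ D
    nxt≤D i≤D with ≤D-cases i≤D
    ... | inj₁ i<D  = subst (_≤ D) (sym (nxt-< i<D)) i<D
    ... | inj₂ refl = ℕₚ.≤-reflexive nxt-D

    i≤nxt : ∀ {i} → i ≤ D → i ≤ nxt i
    i≤nxt {i} i≤D with ≤D-cases i≤D
    ... | inj₁ i<D  = subst (i ≤_) (sym (nxt-< i<D)) (ℕₚ.n≤1+n i)
    ... | inj₂ refl = ℕₚ.≤-reflexive (sym nxt-D)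

    0<D : 0 < D
    0<D = ℕₚ.≤-trans (s≤s z≤n) 3≤D

    1<D : 1 < D
    1<D = ℕₚ.≤-trans (s≤s (s≤s z≤n)) 3≤D

    nxt-0 : nxt 0 ≡ 1
    nxt-0 = nxt-< 0<D

    nxt-1 : nxt 1 ≡ 2
    nxt-1 = nxt-< 1<D

    nxt-2 : nxt 2 ≡ 3
    nxt-2 = nxt-< 3≤D

    -- Below D, staying at the same distance is excluded by a_i = 0. At D it is the only alternative
    -- to descending.
    neighbour-distance : ∀ {x z} v → d x z ≡ 1 → suc (d z v) ≡ d x v ⊎ d z v ≡ nxt (d x v)
    neighbour-distance {x} {z} v xz with ≤D-cases (d≤D x v)
    ... | inj₂ e with ≤D-cases (d≤D z v)
    ...   | inj₁ lt = inj₁ (ℕₚ.≤-antisym (subst (suc (d z v) ≤_) (sym e) lt) (d-adj-≤ v (trans (d-sym z x) xz)))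
    ...   | inj₂ e′ = inj₂ (trans e′ (sym (trans (cong nxt e) nxt-D)))
    neighbour-distance {x} {z} v xz | inj₁ lt with ℕₚ.<-cmp (d z v) (d x v)
    ... | tri< a _ _ = inj₁ (ℕₚ.≤-antisym a (d-adj-≤ v (trans (d-sym z x) xz)))
    ... | tri≈ _ b _ = contradiction (#≥1 (sphere² x v 1 (d x v)) (sphere²⁺ xz b))
      (λ h → ℕₚ.<⇒≢ h (sym (trans (sym (count≡# G _)) (proj₁ ab x v lt))))
    ... | tri> _ _ c = inj₂ (trans (ℕₚ.≤-antisym (d-adj-≤ v xz) c) (sym (nxt-< lt)))

    ∃-at-distance : ∀ i → i ≤ D → ∃ λ x → ∃ λ y → d x y ≡ i
    ∃-at-distance i i≤D = go (D ℕ.∸ i) (ℕₚ.m∸n+n≡m i≤D)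
      where
      go : ∀ j {i} → j ℕ.+ i ≡ D → ∃ λ x → ∃ λ y → d x y ≡ i
      go zero    refl = proj₂ (proj₁ dr)
      go (suc j) {i} e with go j {suc i} (trans (ℕₚ.+-suc j i) e)
      ... | x , y , xy with d-suc⇒∃ xy
      ...   | z , xz , _ = x , z , xz

    -- Distance-regularity as a transfer principle: a nonzero intersection number is nonzero at
    -- every pair with the same distance.
    #sphere²-∃ : ∀ {x y i j} {x′ y′ z′} → d x y ≡ d x′ y′ → d x′ z′ ≡ i → d z′ y′ ≡ j →
      ∃ λ z → d x z ≡ i × d z y ≡ j
    #sphere²-∃ {x} {y} {i} {j} {x′} {y′} e h h′
      with #≥1⇒∃ (sphere² x y i j) (subst (1 ≤_) (#sphere²-const x′ y′ x y i j (sym e)) (#≥1 (sphere² x′ y′ i j) (sphere²⁺ h h′)))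
    ... | z , hz = z , sphere²⁻ hz

    -- Below D some geodesic can be prolonged, and transfer prolongs all of them; at D this is the
    -- hypothesis a_D ≠ 0.
    ∃-nxt : ∀ x v → ∃ λ z → d x z ≡ 1 × d z v ≡ nxt (d x v)
    ∃-nxt x v with ≤D-cases (d≤D x v)
    ... | inj₁ lt with ∃-at-distance (suc (d x v)) lt
    ...   | v′ , z′ , e with d-suc⇒∃ e
    ...     | x′ , v′x′ , x′z′ , _ with #sphere²-∃ {x} {v} (trans (sym v′x′) (d-sym v′ x′)) x′z′ (trans (d-sym z′ v′) e)
    ...       | z , xz , zv = z , xz , trans zv (sym (nxt-< lt))
    ∃-nxt x v | inj₂ e with #≢0⇒∃ (sphere² x v 1 D) (λ h → proj₂ ab x v e (trans (count≡# G _) h))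
    ... | z , hz with sphere²⁻ {x} {v} {1} {D} hz
    ...   | xz , zv = z , xz , trans zv (sym (trans (cong nxt e) nxt-D))

    ∃-prev : ∀ {x v i} → d x v ≡ suc i → ∃ λ z → d x z ≡ 1 × d z v ≡ i
    ∃-prev {x} {v} e with d-suc⇒∃ (trans (d-sym v x) e)
    ... | z , vz , zx , _ = z , trans (d-sym x z) zx , trans (d-sym z v) vz

    no-triangle : ∀ {x y z} → d x y ≡ 1 → d y z ≡ 1 → x ≢ z → d x z ≡ 2
    no-triangle {x} {y} {z} xy yz x≢z with neighbour-distance z (trans (d-sym y x) xy)
    ... | inj₁ e = contradiction (d≡0⇒≡ (ℕₚ.suc-injective (trans e yz))) x≢z
    ... | inj₂ e = trans e (trans (cong nxt yz) nxt-1)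

    -- A second common neighbour would close a 4-cycle; thus c₂ = 1.
    common-neighbour-unique : ∀ {x y z w} → d x y ≡ 2 → d x z ≡ 1 → d z y ≡ 1 → d x w ≡ 1 → d w y ≡ 1 → z ≡ w
    common-neighbour-unique {x} {y} {z} {w} xy xz zy xw wy with z ≟ w
    ... | yes e  = e
    ... | no z≢w = ⊥-elim (proj₂ girth 3 (s≤s (s≤s (s≤s z≤n))) (s≤s (s≤s (s≤s (s≤s (s≤s z≤n))))) record
      { f = f ; inj = inj ; step = step ; close = d≡1⇒adj (trans (d-sym w x) xw) })
      where
      f : Fin 4 → X
      f Fin.zero = x
      f (Fin.suc Fin.zero) = z
      f (Fin.suc (Fin.suc Fin.zero)) = y
      f (Fin.suc (Fin.suc (Fin.suc Fin.zero))) = w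
      apart : ∀ {u v i} → d u v ≡ suc i → u ≢ v
      apart {u} e refl = contradiction (trans (sym e) (d-refl u)) (λ ())
      inj : ∀ i j → f i ≡ f j → i ≡ j
      inj Fin.zero Fin.zero e = refl
      inj Fin.zero (Fin.suc Fin.zero) e = contradiction e (apart xz)
      inj Fin.zero (Fin.suc (Fin.suc Fin.zero)) e = contradiction e (apart xy)
      inj Fin.zero (Fin.suc (Fin.suc (Fin.suc Fin.zero))) e = contradiction e (apart xw)
      inj (Fin.suc Fin.zero) Fin.zero e = contradiction (sym e) (apart xz)
      inj (Fin.suc Fin.zero) (Fin.suc Fin.zero) e = refl
      inj (Fin.suc Fin.zero) (Fin.suc (Fin.suc Fin.zero)) e = contradiction e (apart zy)
      inj (Fin.suc Fin.zero) (Fin.suc (Fin.suc (Fin.suc Fin.zero))) e = contradiction e z≢w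
      inj (Fin.suc (Fin.suc Fin.zero)) Fin.zero e = contradiction (sym e) (apart xy)
      inj (Fin.suc (Fin.suc Fin.zero)) (Fin.suc Fin.zero) e = contradiction (sym e) (apart zy)
      inj (Fin.suc (Fin.suc Fin.zero)) (Fin.suc (Fin.suc Fin.zero)) e = refl
      inj (Fin.suc (Fin.suc Fin.zero)) (Fin.suc (Fin.suc (Fin.suc Fin.zero))) e = contradiction (sym e) (apart wy)
      inj (Fin.suc (Fin.suc (Fin.suc Fin.zero))) Fin.zero e = contradiction (sym e) (apart xw)
      inj (Fin.suc (Fin.suc (Fin.suc Fin.zero))) (Fin.suc Fin.zero) e = contradiction (sym e) z≢w
      inj (Fin.suc (Fin.suc (Fin.suc Fin.zero))) (Fin.suc (Fin.suc Fin.zero)) e = contradiction e (apart wy)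
      inj (Fin.suc (Fin.suc (Fin.suc Fin.zero))) (Fin.suc (Fin.suc (Fin.suc Fin.zero))) e = refl
      step : ∀ i → adj (f (Fin.inject₁ i)) (f (Fin.suc i)) ≡ true
      step Fin.zero = d≡1⇒adj xz
      step (Fin.suc Fin.zero) = d≡1⇒adj zy
      step (Fin.suc (Fin.suc Fin.zero)) = d≡1⇒adj (trans (d-sym y w) wy)

    -- The last step leads away from x: a w adjacent to x would be a second common neighbour of x
    -- and z.
    geodesic₃ : ∀ {x y z w} → d x y ≡ 1 → d y z ≡ 1 → d z w ≡ 1 → x ≢ z → y ≢ w → d x w ≡ 3
    geodesic₃ {x} {y} {z} {w} xy yz zw x≢z y≢w with no-triangle xy yz x≢z
    ... | xz with neighbour-distance x zw
    ...   | inj₂ e = trans (d-sym x w) (trans e (trans (cong nxt (trans (d-sym z x) xz)) nxt-2))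
    ...   | inj₁ e = contradiction
      (common-neighbour-unique xz xy yz (trans (d-sym x w) (ℕₚ.suc-injective (trans e (trans (d-sym z x) xz)))) (trans (d-sym w z) zw))
      y≢w

    -- Opposite vertices of a hexagon are at distance 3, and both neighbours of the one on the
    -- hexagon are at distance 2 from the other.
    2≤c₃ : ∀ {x y} → d x y ≡ 3 → 2 ≤ # (sphere² x y 1 2)
    2≤c₃ {x} {y} xy with proj₁ girth
    ... | 5 , refl , C = subst (2 ≤_) (#sphere²-const f₀ f₃ x y 1 2 (trans d₀₃ (sym xy)))
      (#≥2 (sphere² f₀ f₃ 1 2) {f₁} {f₅}
        (sphere²⁺ d₀₁ (no-triangle d₁₂ d₂₃ (distinct 1F 3F (λ ()))))
        (sphere²⁺ d₀₅ (no-triangle d₅₄ d₄₃ (distinct 5F 3F (λ ()))))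
        (distinct 1F 5F (λ ())))
      where
      open Cycle C
      open import Data.Fin.Patterns
      f₀ = f 0F
      f₁ = f 1F
      f₃ = f 3F
      f₅ = f 5F
      distinct : ∀ i j → i ≢ j → f i ≢ f j
      distinct i j i≢j e = i≢j (inj i j e)
      d₀₁ : d (f 0F) (f 1F) ≡ 1
      d₀₁ = adj⇒d≡1 (step 0F)
      d₁₂ : d (f 1F) (f 2F) ≡ 1
      d₁₂ = adj⇒d≡1 (step 1F)
      d₂₃ : d (f 2F) (f 3F) ≡ 1
      d₂₃ = adj⇒d≡1 (step 2F)
      d₄₃ : d (f 4F) (f 3F) ≡ 1
      d₄₃ = trans (d-sym (f 4F) (f 3F)) (adj⇒d≡1 (step 3F))
      d₅₄ : d (f 5F) (f 4F) ≡ 1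
      d₅₄ = trans (d-sym (f 5F) (f 4F)) (adj⇒d≡1 (step 4F))
      d₀₅ : d (f 0F) (f 5F) ≡ 1
      d₀₅ = trans (d-sym (f 0F) (f 5F)) (adj⇒d≡1 close)
      d₀₃ : d f₀ f₃ ≡ 3
      d₀₃ = geodesic₃ d₀₁ d₁₂ d₂₃ (distinct 0F 2F (λ ())) (distinct 1F 3F (λ ()))

-- Reasoning under double negation, Gram matrices and linear dependence.

module LinearAlgebraTools where
  open Summation
  open FieldTools
  open import Algebra.Bundles using (CommutativeRing)
  open import Data.Nat as ℕ using (ℕ; zero; suc)
  import Data.Nat.Properties as ℕₚ
  open import Data.Integer as ℤ using (ℤ; +_; -[1+_])
  import Data.Integer.Properties as ℤₚ
  open import Data.Fin using (Fin; punchIn)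
  import Data.Fin as Fin
  open import Data.List using (List; []; _∷_)
  open import Data.List.Membership.Propositional using (_∈_)
  open import Data.List.Relation.Unary.Any using (here; there)
  open import Data.Product using (_×_; _,_; ∃)
  open import Data.Sum using (_⊎_; inj₁; inj₂)
  open import Tactic.RingSolver.Core.Expression using (Κ; _⊕_; _⊗_; ⊝_)
  open import Data.Vec.Functional using (insertAt)
  open import Data.Vec.Functional.Properties using (insertAt-lookup; insertAt-punchIn)
  open import Relation.Nullary using (¬_; yes; no; contradiction)
  open import Relation.Binary.PropositionalEquality as ≡ using (_≡_)

  infixl 1 _>>=_
  _>>=_ : ∀ {a b} {A : Set a} {B : Set b} → ¬ ¬ A → (A → ¬ ¬ B) → ¬ ¬ B
  (m >>= f) k = m (λ x → f x k)

  pure : ∀ {a} {A : Set a} → A → ¬ ¬ A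
  pure x k = k x

  excluded-middle : ∀ {a} (A : Set a) → ¬ ¬ (A ⊎ ¬ A)
  excluded-middle A k = k (inj₂ (λ x → k (inj₁ x)))

  all-or-counterexample : ∀ {a m} (P : Fin m → Set a) → ¬ ¬ ((∀ i → P i) ⊎ ∃ λ i → ¬ P i)
  all-or-counterexample {m = zero}  P = pure (inj₁ (λ ()))
  all-or-counterexample {m = suc m} P = do
    inj₁ p₀ ← excluded-middle (P Fin.zero)
      where inj₂ ¬p₀ → pure (inj₂ (Fin.zero , ¬p₀))
    inj₁ p ← all-or-counterexample (λ i → P (Fin.suc i))
      where inj₂ (i , ¬p) → pure (inj₂ (Fin.suc i , ¬p))
    pure (inj₁ λ { Fin.zero → p₀ ; (Fin.suc i) → p i })

  ¬¬-∀Fin : ∀ {a m} {P : Fin m → Set a} → (∀ i → ¬ ¬ P i) → ¬ ¬ (∀ i → P i)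
  ¬¬-∀Fin {P = P} h = do
    inj₁ p ← all-or-counterexample P
      where inj₂ (i , ¬p) → contradiction ¬p (h i)
    pure p

  module ℤSum = ListSum (CommutativeRing.commutativeSemiring ℤₚ.+-*-commutativeRing)

  i*i≡+∣i∣*∣i∣ : ∀ i → i ℤ.* i ≡ + (ℤ.∣ i ∣ ℕ.* ℤ.∣ i ∣)
  i*i≡+∣i∣*∣i∣ (+ zero)  = ≡.refl
  i*i≡+∣i∣*∣i∣ (ℤ.+[1+ n ]) = ≡.refl
  i*i≡+∣i∣*∣i∣ -[1+ n ]  = ≡.refl

  sum-of-squares≡0 : ∀ {a} {A : Set a} (xs : List A) (f : A → ℤ) →
    ℤSum.sumOver xs (λ x → f x ℤ.* f x) ≡ ℤ.0ℤ → ∀ {x} → x ∈ xs → f x ≡ ℤ.0ℤ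
  sum-of-squares≡0 {A = A} xs f h x∈xs = ℤₚ.∣i∣≡0⇒i≡0 (square≡0 (parts xs (ℤₚ.+-injective (≡.trans (≡.sym (natural xs)) h)) x∈xs))
    where
    sq : A → ℕ
    sq x = ℤ.∣ f x ∣ ℕ.* ℤ.∣ f x ∣
    natural : ∀ xs → ℤSum.sumOver xs (λ x → f x ℤ.* f x) ≡ + ℕSum.sumOver xs sq
    natural []       = ≡.refl
    natural (x ∷ xs) = ≡.cong₂ ℤ._+_ (i*i≡+∣i∣*∣i∣ (f x)) (natural xs)
    parts : ∀ xs → ℕSum.sumOver xs sq ≡ 0 → ∀ {x} → x ∈ xs → sq x ≡ 0
    parts (x ∷ xs) e (here ≡.refl) = ℕₚ.m+n≡0⇒m≡0 (sq x) e
    parts (x ∷ xs) e (there p)     = parts xs (ℕₚ.m+n≡0⇒n≡0 (sq x) e) p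
    square≡0 : ∀ {m} → m ℕ.* m ≡ 0 → m ≡ 0
    square≡0 {zero} _ = ≡.refl

  module LinearAlgebra {c ℓ} (F : CharZeroField c ℓ) where
    open Field F

    ιℤ-sumOver : ∀ {a} {A : Set a} (xs : List A) (f : A → ℤ) →
      ιℤ (ℤSum.sumOver xs f) ≈ sumOver xs (λ x → ιℤ (f x))
    ιℤ-sumOver []       f = refl
    ιℤ-sumOver (x ∷ xs) f = trans (ιℤ-+ (f x) _) (+-congˡ (ιℤ-sumOver xs f))

    module _ {I J : Set} (is : List I) (complete : ∀ i → i ∈ is) where

      combination : List J → (J → I → ℤ) → (J → Carrier) → I → Carrier
      combination js φ ξ i = sumOver js (λ j → ξ j * ιℤ (φ j i))

      -- An integer Gram matrix and its vectors have the same kernel over any field of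
      -- characteristic zero: this replaces positivity, which F need not have.
      -- The induction is Gram-Schmidt without division.
      gram-kernel : ∀ js (φ : J → I → ℤ) (ξ : J → Carrier) →
        (∀ j → sumOver is (λ i → ιℤ (φ j i) * combination js φ ξ i) ≈ 0#) →
        ∀ i → combination js φ ξ i ≈ 0#
      gram-kernel []        φ ξ h i = refl
      gram-kernel (j₁ ∷ js) φ ξ h i = go (N ℤ.≟ ℤ.0ℤ)
        where
        w : I → Carrier
        w = combination (j₁ ∷ js) φ ξ
        g : J → ℤ
        g j = ℤSum.sumOver is (λ i → φ j₁ i ℤ.* φ j i)
        N : ℤ
        N = g j₁
        φ′ : J → I → ℤ
        φ′ j i = N ℤ.* φ j i ℤ.- g j ℤ.* φ j₁ i

        ιφ′ : ∀ j i → ιℤ (φ′ j i) ≈ ιℤ N * ιℤ (φ j i) + - (ιℤ (g j) * ιℤ (φ j₁ i))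
        ιφ′ j i = trans (ιℤ-+ (N ℤ.* φ j i) _) (+-cong (ιℤ-* N (φ j i))
          (trans (ιℤ-neg (g j ℤ.* φ j₁ i)) (-‿cong (ιℤ-* (g j) (φ j₁ i)))))

        ιg : ∀ j → ιℤ (g j) ≈ sumOver is (λ i → ιℤ (φ j₁ i) * ιℤ (φ j i))
        ιg j = trans (ιℤ-sumOver is _) (sumOver-cong is (λ i → ιℤ-* (φ j₁ i) (φ j i)))

        ∑ξg : sumOver (j₁ ∷ js) (λ j → ξ j * ιℤ (g j)) ≈ 0#
        ∑ξg = begin
          sumOver (j₁ ∷ js) (λ j → ξ j * ιℤ (g j))
            ≈⟨ sumOver-cong (j₁ ∷ js) (λ j → trans (*-congˡ (ιg j)) (*-distribˡ-sumOver is _ _)) ⟩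
          sumOver (j₁ ∷ js) (λ j → sumOver is (λ i → ξ j * (ιℤ (φ j₁ i) * ιℤ (φ j i))))
            ≈⟨ sumOver-swap (j₁ ∷ js) is _ ⟩
          sumOver is (λ i → sumOver (j₁ ∷ js) (λ j → ξ j * (ιℤ (φ j₁ i) * ιℤ (φ j i))))
            ≈⟨ sumOver-cong is (λ i → trans (sumOver-cong (j₁ ∷ js) (λ j →
                 solve 3 (λ a b c → a ⊗ (b ⊗ c) ⊜ b ⊗ (a ⊗ c)) refl _ _ _))
                 (sym (*-distribˡ-sumOver (j₁ ∷ js) _ _))) ⟩
          sumOver is (λ i → ιℤ (φ j₁ i) * w i)
            ≈⟨ h j₁ ⟩
          0# ∎

        -- The corrections add up to `φ j₁` times the inner product of `φ j₁` with w, apart from the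
        -- term of `j₁` itself. That product vanishes by `h j₁`, so the orthogonalised vectors with
        -- the same coefficients give w scaled by N.
        w′≈Nw : ∀ i → combination js φ′ ξ i ≈ ιℤ N * w i
        w′≈Nw i = begin
          sumOver js (λ j → ξ j * ιℤ (φ′ j i))
            ≈⟨ sumOver-cong js (λ j → trans (*-congˡ (ιφ′ j i))
                 (solve 5 (λ x n p q r → x ⊗ (n ⊗ p :- q ⊗ r) ⊜ n ⊗ (x ⊗ p) ⊕ (⊝ r) ⊗ (x ⊗ q)) refl _ _ _ _ _)) ⟩
          sumOver js (λ j → ιℤ N * (ξ j * ιℤ (φ j i)) + - ιℤ (φ j₁ i) * (ξ j * ιℤ (g j)))
            ≈⟨ trans (sumOver-+ js _ _) (+-cong (sym (*-distribˡ-sumOver js _ _)) (sym (*-distribˡ-sumOver js _ _))) ⟩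
          ιℤ N * combination js φ ξ i + - ιℤ (φ j₁ i) * sumOver js (λ j → ξ j * ιℤ (g j))
            ≈⟨ by-linear₁ (- ιℤ (φ j₁ i)) ∑ξg
                 (solve 5 (λ n v p s x → n ⊗ v ⊕ (⊝ p) ⊗ s
                   ⊜ n ⊗ (x ⊗ p ⊕ v) ⊕ (⊝ p) ⊗ (x ⊗ n ⊕ s :- Κ (+ 0))) refl _ _ _ _ _) ⟩
          ιℤ N * w i ∎

        h′ : ∀ j → sumOver is (λ i → ιℤ (φ′ j i) * combination js φ′ ξ i) ≈ 0#
        h′ j = begin
          sumOver is (λ i → ιℤ (φ′ j i) * combination js φ′ ξ i)
            ≈⟨ sumOver-cong is (λ i → trans (*-cong (ιφ′ j i) (w′≈Nw i))
                 (solve 5 (λ n p q r v → (n ⊗ p :- q ⊗ r) ⊗ (n ⊗ v) ⊜ n ⊗ n ⊗ (p ⊗ v) ⊕ (⊝ (n ⊗ q)) ⊗ (r ⊗ v)) refl _ _ _ _ _)) ⟩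
          sumOver is (λ i → ιℤ N * ιℤ N * (ιℤ (φ j i) * w i) + - (ιℤ N * ιℤ (g j)) * (ιℤ (φ j₁ i) * w i))
            ≈⟨ trans (sumOver-+ is _ _) (+-cong (sym (*-distribˡ-sumOver is _ _)) (sym (*-distribˡ-sumOver is _ _))) ⟩
          ιℤ N * ιℤ N * sumOver is (λ i → ιℤ (φ j i) * w i) + - (ιℤ N * ιℤ (g j)) * sumOver is (λ i → ιℤ (φ j₁ i) * w i)
            ≈⟨ +-cong (trans (*-congˡ (h j)) (zeroʳ _)) (trans (*-congˡ (h j₁)) (zeroʳ _)) ⟩
          0# + 0#  ≈⟨ +-identityˡ 0# ⟩
          0# ∎

        go : _ → w i ≈ 0#
        go (no N≢0)  = *-zero-cancelˡ (λ e → N≢0 (ιℤ≈0⇒≡0 N e))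
          (trans (sym (w′≈Nw i)) (gram-kernel js φ′ ξ h′ i))
        go (yes N≡0) = trans (w≈tail i) (gram-kernel js φ ξ
            (λ j → trans (sumOver-cong is (λ i → *-congˡ (sym (w≈tail i)))) (h j)) i)
          where
          w≈tail : ∀ i → w i ≈ combination js φ ξ i
          w≈tail i = begin
            ξ j₁ * ιℤ (φ j₁ i) + combination js φ ξ i
              ≡⟨ ≡.cong (λ z → ξ j₁ * ιℤ z + combination js φ ξ i) (sum-of-squares≡0 is (φ j₁) N≡0 (complete i)) ⟩
            ξ j₁ * 0# + combination js φ ξ i    ≈⟨ +-congʳ (zeroʳ _) ⟩
            0# + combination js φ ξ i           ≈⟨ +-identityˡ _ ⟩
            combination js φ ξ i                ∎

    sumFin-punchIn : ∀ {m} (p : Fin (suc m)) (f : Fin (suc m) → Carrier) →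
      sumFin f ≈ f p + sumFin (λ i → f (punchIn p i))
    sumFin-punchIn Fin.zero f = sumFin-suc f
    sumFin-punchIn {suc m} (Fin.suc p) f = begin
      sumFin f
        ≈⟨ sumFin-suc f ⟩
      f Fin.zero + sumFin (λ i → f (Fin.suc i))
        ≈⟨ +-congˡ (sumFin-punchIn p (λ i → f (Fin.suc i))) ⟩
      f Fin.zero + (f (Fin.suc p) + sumFin (λ i → f (Fin.suc (punchIn p i))))
        ≈⟨ solve 3 (λ a b c → a ⊕ (b ⊕ c) ⊜ b ⊕ (a ⊕ c)) refl _ _ _ ⟩
      f (Fin.suc p) + (f Fin.zero + sumFin (λ i → f (Fin.suc (punchIn p i))))
        ≈⟨ +-congˡ (sumFin-suc (λ i → f (punchIn (Fin.suc p) i))) ⟨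
      f (Fin.suc p) + sumFin (λ i → f (punchIn (Fin.suc p) i))
        ∎

    Dependent : ∀ {m r} → (Fin m → Fin r → Carrier) → Set _
    Dependent {m} v = ∃ λ (α : Fin m → Carrier) → (∃ λ i → ¬ α i ≈ 0#) × (∀ j → sumFin (λ i → α i * v i j) ≈ 0#)

    -- Gaussian elimination on the first coordinate. The search for a pivot is what needs the double
    -- negation. The other rows are cross-multiplied with the pivot row, which avoids division, and
    -- the coefficient of the pivot row is chosen last.
    dependency : ∀ m (v : Fin (suc m) → Fin m → Carrier) → ¬ ¬ Dependent v
    dependency zero    v = pure ((λ _ → 1#) , (Fin.zero , 1≉0) , λ ())
    dependency (suc m) v = do
      inj₂ (p , vₚ≉0) ← all-or-counterexample (λ i → v i Fin.zero ≈ 0#)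
        where
        inj₁ all≈0 → do
          (α , (i , αᵢ≉0) , αv≈0) ← dependency m (λ i j → v (Fin.suc i) (Fin.suc j))
          let β : Fin (suc (suc m)) → Carrier
              β = λ { Fin.zero → 0# ; (Fin.suc i) → α i }
          pure (β , (Fin.suc i , αᵢ≉0) , λ
            { Fin.zero    → sumFin-zero (λ i → trans (*-congˡ (all≈0 i)) (zeroʳ _))
            ; (Fin.suc j) → trans (sumFin-suc (λ i → β i * v i (Fin.suc j)))
                              (trans (+-cong (zeroˡ _) (αv≈0 j)) (+-identityˡ _)) })
      (α , (i , αᵢ≉0) , αv≈0) ← dependency m (λ i j →
        v p Fin.zero * v (punchIn p i) (Fin.suc j) + - (v (punchIn p i) Fin.zero * v p (Fin.suc j)))
      let S = sumFin (λ i → α i * v (punchIn p i) Fin.zero)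
          β = insertAt (λ i → α i * v p Fin.zero) p (- S)
          βₚ : β p ≈ - S
          βₚ = reflexive (insertAt-lookup (λ i → α i * v p Fin.zero) p (- S))
          βᵢ : ∀ i → β (punchIn p i) ≈ α i * v p Fin.zero
          βᵢ = λ i → reflexive (insertAt-punchIn (λ i → α i * v p Fin.zero) p (- S) i)
          expand : ∀ j → sumFin (λ i → β i * v i j) ≈ - S * v p j + sumFin (λ i → α i * v p Fin.zero * v (punchIn p i) j)
          expand = λ j → trans (sumFin-punchIn p (λ i → β i * v i j))
            (+-cong (*-congʳ βₚ) (sumFin-cong (λ i → *-congʳ (βᵢ i))))
      pure (β , (punchIn p i , λ e → *-≉0 αᵢ≉0 vₚ≉0 (trans (sym (βᵢ i)) e)) , λ
        { Fin.zero → begin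
            sumFin (λ i → β i * v i Fin.zero)
              ≈⟨ expand Fin.zero ⟩
            - S * v p Fin.zero + sumFin (λ i → α i * v p Fin.zero * v (punchIn p i) Fin.zero)
              ≈⟨ +-congˡ (trans (sumFin-cong (λ i → solve 3 (λ a b c → a ⊗ b ⊗ c ⊜ b ⊗ (a ⊗ c)) refl _ _ _))
                   (sym (*-distribˡ-sumFin _ _))) ⟩
            - S * v p Fin.zero + v p Fin.zero * S
              ≈⟨ solve 2 (λ s x → (⊝ s) ⊗ x ⊕ x ⊗ s ⊜ Κ (+ 0)) refl _ _ ⟩
            0# ∎
        ; (Fin.suc j) → begin
            sumFin (λ i → β i * v i (Fin.suc j))
              ≈⟨ expand (Fin.suc j) ⟩
            - S * v p (Fin.suc j) + sumFin (λ i → α i * v p Fin.zero * v (punchIn p i) (Fin.suc j))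
              ≈⟨ +-congʳ (trans (solve 2 (λ s x → (⊝ s) ⊗ x ⊜ (⊝ x) ⊗ s) refl _ _) (*-distribˡ-sumFin _ _)) ⟩
            sumFin (λ i → - v p (Fin.suc j) * (α i * v (punchIn p i) Fin.zero)) + sumFin (λ i → α i * v p Fin.zero * v (punchIn p i) (Fin.suc j))
              ≈⟨ sumFin-+ _ _ ⟨
            sumFin (λ i → - v p (Fin.suc j) * (α i * v (punchIn p i) Fin.zero) + α i * v p Fin.zero * v (punchIn p i) (Fin.suc j))
              ≈⟨ sumFin-cong (λ i → solve 5 (λ a b c d e →
                   (⊝ a) ⊗ (b ⊗ c) ⊕ b ⊗ d ⊗ e ⊜ b ⊗ (d ⊗ e :- c ⊗ a)) refl _ _ _ _ _) ⟩
            sumFin (λ i → α i * (v p Fin.zero * v (punchIn p i) (Fin.suc j) + - (v (punchIn p i) Fin.zero * v p (Fin.suc j))))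
              ≈⟨ αv≈0 j ⟩
            0# ∎ })

-- The Bose-Mesner algebra and its primitive idempotents.

module BoseMesnerAlgebra where
  open Summation
  open FieldTools
  open GraphMetric
  open Counting
  open AlmostBipartite
  open LinearAlgebraTools
  open import Data.Bool using (Bool; true; false; _∧_; if_then_else_)
  open import Data.Nat as ℕ using (ℕ; zero; suc; _≤_; _≡ᵇ_; s≤s; _≤?_)
  open import Data.Integer as ℤ using (+_)
  open import Data.Fin using (Fin; toℕ; fromℕ<)
  import Data.Fin as Fin
  open import Data.Fin.Properties using (toℕ-fromℕ<; toℕ-injective; toℕ<n)
  open import Data.Product using (_×_; _,_; proj₁; proj₂; ∃)
  open import Data.Sum using (_⊎_; inj₁; inj₂)
  import Data.Sum as Sum
  open import Data.Empty using (⊥-elim)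
  open import Relation.Nullary using (¬_; yes; no; contradiction)
  open import Relation.Binary.PropositionalEquality as ≡ using (_≡_; _≢_)
  open import Tactic.RingSolver.Core.Expression using (Κ; _⊕_; _⊗_; ⊝_)

  module BoseMesner {c ℓ} (F : CharZeroField c ℓ) (G : Graph) (conn : Connected G) (D k : ℕ)
    (dr : DistanceRegular G D) (ab : AlmostBipartite G D) (3≤D : 3 ≤ D) (val : Valency G k) (girth : Girth G 6) where

    open AlmostBipartiteGraph G conn D k dr ab 3≤D val girth
    open Field F
    open LinearAlgebra F

    ∑≈sumFin : ∀ {m} (g : Fin m → Carrier) → ∑ F G g ≈ sumFin g
    ∑≈sumFin {zero}  g = reflexive (≡.sym (sumFin≡sumOver g))
    ∑≈sumFin {suc m} g = trans (+-congˡ (∑≈sumFin (λ i → g (Fin.suc i)))) (sym (sumFin-suc g))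

    Matrix : Set c
    Matrix = X → X → Carrier

    infix 4 _≋_
    _≋_ : Matrix → Matrix → Set ℓ
    M ≋ N = ∀ x y → M x y ≈ N x y

    ≋-trans : ∀ {L M N} → L ≋ M → M ≋ N → L ≋ N
    ≋-trans h h′ x y = trans (h x y) (h′ x y)

    ≋-sym : ∀ {M N} → M ≋ N → N ≋ M
    ≋-sym h x y = sym (h x y)

    infixl 7 _⊙_
    _⊙_ : Matrix → Matrix → Matrix
    (M ⊙ N) x y = sumFin (λ z → M x z * N z y)

    ⊙≋·M : ∀ M N → M ⊙ N ≋ _·M_ F G M N
    ⊙≋·M M N x y = sym (∑≈sumFin _)

    ⊙-cong : ∀ {M M′ N N′} → M ≋ M′ → N ≋ N′ → M ⊙ N ≋ M′ ⊙ N′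
    ⊙-cong h h′ x y = sumFin-cong (λ z → *-cong (h x z) (h′ z y))

    ⊙-assoc : ∀ L M N → (L ⊙ M) ⊙ N ≋ L ⊙ (M ⊙ N)
    ⊙-assoc L M N x y = begin
      sumFin (λ z → sumFin (λ w → L x w * M w z) * N z y)
        ≈⟨ sumFin-cong (λ z → *-distribʳ-sumFin _ _) ⟩
      sumFin (λ z → sumFin (λ w → L x w * M w z * N z y))
        ≈⟨ sumFin-swap _ ⟩
      sumFin (λ w → sumFin (λ z → L x w * M w z * N z y))
        ≈⟨ sumFin-cong (λ w → trans (sumFin-cong (λ z → *-assoc _ _ _)) (sym (*-distribˡ-sumFin _ _))) ⟩
      sumFin (λ w → L x w * sumFin (λ z → M w z * N z y)) ∎

    infixl 6 _⊟_
    _⊟_ : Matrix → Matrix → Matrix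
    (M ⊟ N) x y = M x y + - N x y

    sumFin-⊟ : ∀ {m} (f g : Fin m → Carrier) → sumFin (λ i → f i + - g i) ≈ sumFin f + - sumFin g
    sumFin-⊟ f g = trans (sumFin-+ f (λ i → - g i)) (+-congˡ (begin
      sumFin (λ i → - g i)          ≈⟨ sumFin-cong (λ i → solve 1 (λ a → ⊝ a ⊜ (⊝ :1) ⊗ a) refl _) ⟩
      sumFin (λ i → - 1# * g i)     ≈⟨ *-distribˡ-sumFin _ _ ⟨
      - 1# * sumFin g               ≈⟨ solve 1 (λ a → (⊝ :1) ⊗ a ⊜ ⊝ a) refl _ ⟩
      - sumFin g ∎))

    ⊙-distribʳ-⊟ : ∀ L M N → (M ⊟ N) ⊙ L ≋ M ⊙ L ⊟ N ⊙ L
    ⊙-distribʳ-⊟ L M N x y = trans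
      (sumFin-cong (λ z → solve 3 (λ a b c → (a :- b) ⊗ c ⊜ a ⊗ c :- b ⊗ c) refl _ _ _)) (sumFin-⊟ _ _)

    ⊙-distribˡ-⊟ : ∀ L M N → L ⊙ (M ⊟ N) ≋ L ⊙ M ⊟ L ⊙ N
    ⊙-distribˡ-⊟ L M N x y = trans
      (sumFin-cong (λ z → solve 3 (λ a b c → c ⊗ (a :- b) ⊜ c ⊗ a :- c ⊗ b) refl _ _ _)) (sumFin-⊟ _ _)

    δ : ℕ → ℕ → Carrier
    δ h i = if h ≡ᵇ i then 1# else 0#

    δ-≡ : ∀ {h i} → h ≡ i → δ h i ≈ 1#
    δ-≡ e = reflexive (≡.cong (λ b → if b then 1# else 0#) (≡ᵇ-true⁺ e))

    δ-≢ : ∀ {h i} → h ≢ i → δ h i ≈ 0#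
    δ-≢ ne = reflexive (≡.cong (λ b → if b then 1# else 0#) (≡ᵇ-false⁺ ne))

    Index : Set
    Index = Fin (suc D)

    index : ∀ h → h ≤ D → Index
    index h h≤D = fromℕ< (s≤s h≤D)

    toℕ-index : ∀ {h} (h≤D : h ≤ D) → toℕ (index h h≤D) ≡ h
    toℕ-index h≤D = toℕ-fromℕ< (s≤s h≤D)

    toℕ≤D : ∀ (i : Index) → toℕ i ≤ D
    toℕ≤D i = ℕ.s≤s⁻¹ (toℕ<n i)

    by-distance : ∀ (f : ℕ → Carrier) {h} → h ≤ D → f h ≈ sumFin (λ (i : Index) → f (toℕ i) * δ h (toℕ i))
    by-distance f {h} h≤D = sym (begin
      sumFin (λ i → f (toℕ i) * δ h (toℕ i))
        ≈⟨ sumFin-only _ (index h h≤D) (λ i i≢ → trans (*-congˡ (δ-≢ (λ e → i≢ (toℕ-injective (≡.trans (≡.sym e) (≡.sym (toℕ-index h≤D))))))) (zeroʳ _)) ⟩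
      f (toℕ (index h h≤D)) * δ h (toℕ (index h h≤D))
        ≈⟨ *-cong (reflexive (≡.cong f (toℕ-index h≤D))) (δ-≡ (≡.sym (toℕ-index h≤D))) ⟩
      f h * 1#
        ≈⟨ *-identityʳ _ ⟩
      f h ∎)

    -- Membership in the Bose-Mesner algebra without coefficients; `radial⇒InBM` and `InBM⇒radial`
    -- translate.
    Radial : Matrix → Set ℓ
    Radial M = ∀ x y x′ y′ → d x y ≡ d x′ y′ → M x y ≈ M x′ y′

    pair : Index → X × X
    pair i with ∃-at-distance (toℕ i) (toℕ≤D i)
    ... | x , y , _ = x , y

    d-pair : ∀ i → d (proj₁ (pair i)) (proj₂ (pair i)) ≡ toℕ i
    d-pair i with ∃-at-distance (toℕ i) (toℕ≤D i)
    ... | x , y , e = e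

    infixl 9 _at_
    -- The common value on a distance class, read at a chosen pair; 0 above D is a default value.
    _at_ : Matrix → ℕ → Carrier
    M at h with h ≤? D
    ... | yes h≤D = M (proj₁ (pair (index h h≤D))) (proj₂ (pair (index h h≤D)))
    ... | no _    = 0#

    radial-at : ∀ {M} → Radial M → ∀ x y → M x y ≈ M at (d x y)
    radial-at r x y with d x y ≤? D
    ... | yes h≤D = r _ _ _ _ (≡.sym (≡.trans (d-pair (index (d x y) h≤D)) (toℕ-index h≤D)))
    ... | no ¬h≤D = contradiction (d≤D x y) ¬h≤D

    radial⇒InBM : ∀ {M} → Radial M → InBM F G D M
    radial⇒InBM {M} r = (λ i → M at toℕ i) , λ x y →
      trans (radial-at r x y) (trans (by-distance (M at_) (d≤D x y)) (sym (∑≈sumFin _)))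

    InBM⇒radial : ∀ {M} → InBM F G D M → Radial M
    InBM⇒radial (coef , h) x y x′ y′ e = trans (h x y) (trans
      (reflexive (≡.cong (λ j → ∑ F G (λ i → coef i * δ j (toℕ i))) e)) (sym (h x′ y′)))

    radial-sym : ∀ {M} → Radial M → ∀ x y → M x y ≈ M y x
    radial-sym r x y = r x y y x (d-sym x y)

    ι-if : ∀ b → ι (if b then 1 else 0) ≈ (if b then 1# else 0#)
    ι-if true  = ι-1
    ι-if false = refl

    if-∧ : ∀ a b → (if a ∧ b then 1# else 0#) ≈ (if a then 1# else 0#) * (if b then 1# else 0#)
    if-∧ true  b = sym (*-identityˡ _)
    if-∧ false b = sym (zeroˡ _)

    ι-# : ∀ (P : X → Bool) → ι (# P) ≈ sumFin (λ z → if P z then 1# else 0#)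
    ι-# P = begin
      ι (# P)                                               ≈⟨ ι-sumFin _ ⟩
      sumFin (λ z → ι (if P z then 1 else 0))               ≈⟨ sumFin-cong (λ z → ι-if (P z)) ⟩
      sumFin (λ z → if P z then 1# else 0#) ∎

    -- The pair x, y enters only through intersection numbers, which makes the algebra closed under
    -- products.
    ⊙-by-distance : ∀ {M N} → Radial M → Radial N → ∀ x y →
      (M ⊙ N) x y ≈ sumFin (λ (i : Index) → sumFin (λ (j : Index) →
        M at toℕ i * N at toℕ j * ι (# (sphere² x y (toℕ i) (toℕ j)))))
    ⊙-by-distance {M} {N} r s x y = begin
      sumFin (λ z → M x z * N z y)
        ≈⟨ sumFin-cong (λ z → *-cong (trans (radial-at r x z) (by-distance (M at_) (d≤D x z)))
             (trans (radial-sym s z y) (trans (radial-at s y z) (by-distance (N at_) (d≤D y z))))) ⟩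
      sumFin (λ z → sumFin (λ i → M at toℕ i * δ (d x z) (toℕ i)) * sumFin (λ j → N at toℕ j * δ (d y z) (toℕ j)))
        ≈⟨ sumFin-cong (λ z → sumFin-* _ _) ⟩
      sumFin (λ z → sumFin (λ i → sumFin (λ j → M at toℕ i * δ (d x z) (toℕ i) * (N at toℕ j * δ (d y z) (toℕ j)))))
        ≈⟨ trans (sumFin-swap _) (sumFin-cong (λ i → sumFin-swap _)) ⟩
      sumFin (λ i → sumFin (λ j → sumFin (λ z → M at toℕ i * δ (d x z) (toℕ i) * (N at toℕ j * δ (d y z) (toℕ j)))))
        ≈⟨ sumFin-cong (λ i → sumFin-cong (λ j → trans (sumFin-cong (λ z →
             trans (solve 4 (λ a b p q → a ⊗ p ⊗ (b ⊗ q) ⊜ a ⊗ b ⊗ (p ⊗ q)) refl _ _ _ _)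
                   (*-congˡ (sym (if-∧ (d x z ≡ᵇ toℕ i) (d y z ≡ᵇ toℕ j))))))
             (trans (sym (*-distribˡ-sumFin _ _)) (*-congˡ (sym (ι-# (sphere² x y (toℕ i) (toℕ j)))))))) ⟩
      sumFin (λ i → sumFin (λ j → M at toℕ i * N at toℕ j * ι (# (sphere² x y (toℕ i) (toℕ j))))) ∎

    ⊙-radial : ∀ {M N} → Radial M → Radial N → Radial (M ⊙ N)
    ⊙-radial r s x y x′ y′ e = trans (⊙-by-distance r s x y) (trans
      (sumFin-cong (λ i → sumFin-cong (λ j → *-congˡ (reflexive (≡.cong ι (#sphere²-const x y x′ y′ (toℕ i) (toℕ j) e))))))
      (sym (⊙-by-distance r s x′ y′)))

    -- Radial matrices are symmetric, and symmetric matrices with a symmetric product commute.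
    ⊙-comm : ∀ {M N} → Radial M → Radial N → M ⊙ N ≋ N ⊙ M
    ⊙-comm {M} {N} r s x y = trans (sumFin-cong (λ z →
      trans (*-cong (radial-sym r x z) (radial-sym s z y)) (*-comm _ _))) (radial-sym (⊙-radial s r) y x)

    ⊟-radial : ∀ {M N} → Radial M → Radial N → Radial (M ⊟ N)
    ⊟-radial r s x y x′ y′ e = +-cong (r x y x′ y′ e) (-‿cong (s x y x′ y′ e))

    A : ℕ → Matrix
    A h x y = δ (d x y) h

    A-radial : ∀ h → Radial (A h)
    A-radial h x y x′ y′ e = reflexive (≡.cong (λ j → δ j h) e)

    A₀-identity : ∀ M → A 0 ⊙ M ≋ M
    A₀-identity M x y = begin
      sumFin (λ z → δ (d x z) 0 * M z y)
        ≈⟨ sumFin-only _ x (λ z z≢x → trans (*-congʳ (δ-≢ (λ e → z≢x (≡.sym (d≡0⇒≡ e))))) (zeroˡ _)) ⟩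
      δ (d x x) 0 * M x y    ≈⟨ *-congʳ (δ-≡ (d-refl x)) ⟩
      1# * M x y             ≈⟨ *-identityˡ _ ⟩
      M x y ∎

    module Idempotents (E : Index → Matrix) (ord : IdempotentOrdering F G D E) where

      E-primitive : ∀ i → Primitive F G D (E i)
      E-primitive = proj₁ ord

      E-radial : ∀ i → Radial (E i)
      E-radial i = InBM⇒radial (proj₁ (proj₁ (E-primitive i)))

      E-idem : ∀ i → E i ⊙ E i ≋ E i
      E-idem i = ≋-trans (⊙≋·M (E i) (E i)) (proj₂ (proj₁ (E-primitive i)))

      E-≉0 : ∀ i → ¬ (∀ x y → E i x y ≈ 0#)
      E-≉0 i = proj₁ (proj₂ (E-primitive i))

      -- Primitivity is applied to the splitting of `E i` into the orthogonal idempotents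
      -- `E i ⊙ E j` and `E i ⊟ E i ⊙ E j`, one of which must vanish.
      E-absorb : ∀ i j → (∀ x y → (E i ⊙ E j) x y ≈ 0#) ⊎ (E i ⊙ E j ≋ E i)
      E-absorb i j = Sum.map₂ (λ h x y → sym (x∙y⁻¹≈ε⇒x≈y _ _ (h x y)))
        (proj₂ (proj₂ (E-primitive i)) P R
          (radial⇒InBM {P} P-radial , λ x y → trans (sym (⊙≋·M P P x y)) (PP x y))
          (radial⇒InBM {R} R-radial , λ x y → trans (sym (⊙≋·M R R x y)) (RR x y))
          (λ x y → trans (sym (⊙≋·M P R x y)) (PR x y))
          (λ x y → solve 2 (λ e p → e ⊜ p ⊕ (e :- p)) refl (E i x y) (P x y)))
        where
        P R : Matrix
        P = E i ⊙ E j
        R = E i ⊟ P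
        P-radial : Radial P
        P-radial = ⊙-radial (E-radial i) (E-radial j)
        R-radial : Radial R
        R-radial = ⊟-radial (E-radial i) P-radial
        EP : E i ⊙ P ≋ P
        EP = ≋-trans (≋-sym (⊙-assoc (E i) (E i) (E j))) (⊙-cong (E-idem i) (λ _ _ → refl))
        PE : P ⊙ E i ≋ P
        PE = ≋-trans (⊙-comm P-radial (E-radial i)) EP
        PEⱼ : P ⊙ E j ≋ P
        PEⱼ = ≋-trans (⊙-assoc (E i) (E j) (E j)) (⊙-cong (λ _ _ → refl) (E-idem j))
        PP : P ⊙ P ≋ P
        PP = ≋-trans (≋-sym (⊙-assoc P (E i) (E j))) (≋-trans (⊙-cong PE (λ _ _ → refl)) PEⱼ)
        PR : ∀ x y → (P ⊙ R) x y ≈ 0#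
        PR x y = trans (⊙-distribˡ-⊟ P (E i) P x y) (trans (+-cong (PE x y) (-‿cong (PP x y))) (-‿inverseʳ _))
        RR : R ⊙ R ≋ R
        RR x y = begin
          (R ⊙ R) x y                      ≈⟨ ⊙-distribʳ-⊟ R (E i) P x y ⟩
          (E i ⊙ R) x y + - (P ⊙ R) x y    ≈⟨ +-cong (⊙-distribˡ-⊟ (E i) (E i) P x y) (-‿cong (PR x y)) ⟩
          (E i ⊙ E i) x y + - (E i ⊙ P) x y + - 0#  ≈⟨ +-cong (+-cong (E-idem i x y) (-‿cong (EP x y))) -0#≈0# ⟩
          E i x y + - P x y + 0#           ≈⟨ +-identityʳ _ ⟩
          R x y ∎

      -- If neither product vanished, both idempotents would equal their common product.
      E-orth : ∀ {i j} → i ≢ j → ∀ x y → (E i ⊙ E j) x y ≈ 0#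
      E-orth {i} {j} i≢j = go (E-absorb i j) (E-absorb j i)
        where
        comm : ∀ x y → (E i ⊙ E j) x y ≈ (E j ⊙ E i) x y
        comm = ⊙-comm {E i} {E j} (E-radial i) (E-radial j)
        go : (∀ x y → (E i ⊙ E j) x y ≈ 0#) ⊎ (E i ⊙ E j ≋ E i) →
             (∀ x y → (E j ⊙ E i) x y ≈ 0#) ⊎ (E j ⊙ E i ≋ E j) → ∀ x y → (E i ⊙ E j) x y ≈ 0#
        go (inj₁ h) _         = h
        go (inj₂ h) (inj₁ h′) = λ x y → trans (comm x y) (h′ x y)
        go (inj₂ h) (inj₂ h′) = ⊥-elim (proj₁ (proj₂ ord) i j i≢j
          (λ x y → trans (sym (h x y)) (trans (comm x y) (h′ x y))))

      span : (Index → Carrier) → Matrix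
      span α x y = sumFin (λ i → α i * E i x y)

      span-component : ∀ α j x y → (span α ⊙ E j) x y ≈ α j * E j x y
      span-component α j x y = begin
        sumFin (λ z → sumFin (λ i → α i * E i x z) * E j z y)
          ≈⟨ sumFin-cong (λ z → trans (*-distribʳ-sumFin _ _) (sumFin-cong (λ i → *-assoc _ _ _))) ⟩
        sumFin (λ z → sumFin (λ i → α i * (E i x z * E j z y)))
          ≈⟨ trans (sumFin-swap _) (sumFin-cong (λ i → sym (*-distribˡ-sumFin _ _))) ⟩
        sumFin (λ i → α i * (E i ⊙ E j) x y)
          ≈⟨ sumFin-only _ j (λ i i≢j → trans (*-congˡ (E-orth i≢j x y)) (zeroʳ _)) ⟩
        α j * (E j ⊙ E j) x y
          ≈⟨ *-congˡ (E-idem j x y) ⟩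
        α j * E j x y ∎

      scaled-zero : ∀ {α j} → ¬ α ≈ 0# → ¬ (∀ x y → α * E j x y ≈ 0#)
      scaled-zero {α} {j} α≉0 h = E-≉0 j (λ x y → *-zero-cancelˡ α≉0 (h x y))

      -- M and the D + 1 idempotents are D + 2 functions on D + 1 distances, hence dependent. The
      -- coefficient of M is nonzero because orthogonality makes the idempotents independent.
      spanning : ∀ {M} → Radial M → ¬ ¬ (∃ λ α → M ≋ span α)
      spanning {M} r = do
        (α , (i , αᵢ≉0) , αv≈0) ← dependency (suc D) v
        let relation : ∀ x y → α Fin.zero * M x y + span (λ i → α (Fin.suc i)) x y ≈ 0#
            relation = λ x y → trans (sym (sumFin-suc (λ i → α i * W i x y)))
              (trans (sumFin-cong (λ i → *-congˡ (transport i x y))) (αv≈0 (index (d x y) (d≤D x y))))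
        inj₂ α₀≉0 ← excluded-middle (α Fin.zero ≈ 0#)
          where inj₁ α₀≈0 → λ _ → no-relation α i αᵢ≉0 α₀≈0 relation
        let (β , α₀β≈1) = inv (α Fin.zero) α₀≉0
        pure ((λ i → - β * α (Fin.suc i)) , λ x y → begin
          M x y
            ≈⟨ by-linear₂ (- M x y) β α₀β≈1 (relation x y)
                 (solve 4 (λ m a b s → m ⊜ (⊝ b) ⊗ s ⊕ (⊝ m) ⊗ (a ⊗ b :- :1) ⊕ b ⊗ (a ⊗ m ⊕ s :- Κ (+ 0))) refl _ _ _ _) ⟩
          - β * span (λ i → α (Fin.suc i)) x y
            ≈⟨ trans (*-distribˡ-sumFin _ _) (sumFin-cong (λ i → sym (*-assoc _ _ _))) ⟩
          span (λ i → - β * α (Fin.suc i)) x y ∎)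
        where
        W : Fin (suc (suc D)) → Matrix
        W Fin.zero    = M
        W (Fin.suc i) = E i
        v : Fin (suc (suc D)) → Index → Carrier
        v i j = W i (proj₁ (pair j)) (proj₂ (pair j))
        W-radial : ∀ i → Radial (W i)
        W-radial Fin.zero    = r
        W-radial (Fin.suc i) = E-radial i
        transport : ∀ i x y → W i x y ≈ v i (index (d x y) (d≤D x y))
        transport i x y = W-radial i _ _ _ _ (≡.sym (≡.trans (d-pair (index (d x y) (d≤D x y))) (toℕ-index (d≤D x y))))
        no-relation : ∀ α i → ¬ α i ≈ 0# → α Fin.zero ≈ 0# →
          ¬ (∀ x y → α Fin.zero * M x y + span (λ i → α (Fin.suc i)) x y ≈ 0#)
        no-relation α Fin.zero    αᵢ≉0 α₀≈0 h = αᵢ≉0 α₀≈0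
        no-relation α (Fin.suc i) αᵢ≉0 α₀≈0 h = scaled-zero {j = i} αᵢ≉0 (λ x y → trans
          (sym (span-component (λ i → α (Fin.suc i)) i x y))
          (sumFin-zero (λ z → trans (*-congʳ (trans (sym (trans (+-congʳ (trans (*-congʳ α₀≈0) (zeroˡ _))) (+-identityˡ _))) (h x z))) (zeroˡ _))))

-- Krein parameters and the vanishing of triple products.

module KreinParameters where
  open Summation
  open FieldTools
  open GraphMetric
  open Counting
  open AlmostBipartite
  open LinearAlgebraTools
  open BoseMesnerAlgebra
  open import Algebra.Bundles using (CommutativeRing)
  open import Data.Bool using (Bool; _∧_; if_then_else_)
  open import Data.Nat as ℕ using (ℕ; zero; suc; _≤_; _≡ᵇ_; z≤n)
  import Data.Nat.Properties as ℕₚ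
  open import Data.Integer as ℤ using (ℤ; +_)
  open import Data.Fin using (Fin; toℕ)
  open import Data.List using (List; allFin; cartesianProduct)
  open import Data.List.Membership.Propositional using (_∈_)
  open import Data.List.Membership.Propositional.Properties using (∈-allFin; ∈-cartesianProduct⁺)
  open import Data.Product using (_×_; _,_; proj₁; proj₂; ∃)
  open import Relation.Nullary using (¬_)
  open import Relation.Binary.PropositionalEquality as ≡ using (_≡_; _≢_)
  open import Tactic.RingSolver.Core.Expression using (_⊕_; _⊗_)

  module KreinTheory {c ℓ} (F : CharZeroField c ℓ) (G : Graph) (conn : Connected G) (D k : ℕ)
    (dr : DistanceRegular G D) (ab : AlmostBipartite G D) (3≤D : 3 ≤ D) (val : Valency G k) (girth : Girth G 6)
    (E : Fin (suc D) → Fin (Graph.n G) → Fin (Graph.n G) → CommutativeRing.Carrier (CharZeroField.cring F))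
    (ord : IdempotentOrdering F G D E) where

    open AlmostBipartiteGraph G conn D k dr ab 3≤D val girth
    open Field F
    open LinearAlgebra F
    open BoseMesner F G conn D k dr ab 3≤D val girth
    open Idempotents E ord

    one : Index
    one = index 1 (ℕₚ.<⇒≤ 1<D)

    trace : Index → Carrier
    trace l = sumFin (λ x → E l x x)

    -- A symmetric form of the Krein parameters: up to the nonzero factors n and `trace l` it is the
    -- coefficient q^l_{ij}, yet it does not distinguish the three indices.
    κ : Index → Index → Index → Carrier
    κ i j l = sumFin (λ x → sumFin (λ y → E i x y * E j x y * E l x y))

    -- By symmetry, the sum of the entries of the entrywise product is the trace of the matrix
    -- product.
    E·E-sum : ∀ i j → i ≢ j → sumFin (λ x → sumFin (λ y → E i x y * E j x y)) ≈ 0#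
    E·E-sum i j i≢j = sumFin-zero (λ x → trans
      (sumFin-cong (λ y → *-congˡ (radial-sym (E-radial j) x y))) (E-orth i≢j x x))

    E·E-trace : ∀ i → sumFin (λ x → sumFin (λ y → E i x y * E i x y)) ≈ trace i
    E·E-trace i = sumFin-cong (λ x → trans
      (sumFin-cong (λ y → *-congˡ (radial-sym (E-radial i) x y))) (E-idem i x x))

    Krein : Index → Index → (Index → Carrier) → Set ℓ
    Krein i j q = ∀ x y → ι n * (E i x y * E j x y) ≈ sumFin (λ h → q h * E h x y)

    krein-κ : ∀ {i j q} → Krein i j q → ∀ l → ι n * κ i j l ≈ q l * trace l
    krein-κ {i} {j} {q} h l = begin
      ι n * κ i j l
        ≈⟨ trans (*-distribˡ-sumFin _ _) (sumFin-cong (λ x → trans (*-distribˡ-sumFin _ _) (sumFin-cong (λ y → sym (*-assoc _ _ _))))) ⟩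
      sumFin (λ x → sumFin (λ y → ι n * (E i x y * E j x y) * E l x y))
        ≈⟨ sumFin-cong (λ x → sumFin-cong (λ y → trans (*-congʳ (h x y)) (trans (*-distribʳ-sumFin _ _) (sumFin-cong (λ t → *-assoc _ _ _))))) ⟩
      sumFin (λ x → sumFin (λ y → sumFin (λ t → q t * (E t x y * E l x y))))
        ≈⟨ trans (sumFin-cong (λ x → sumFin-swap _)) (sumFin-swap _) ⟩
      sumFin (λ t → sumFin (λ x → sumFin (λ y → q t * (E t x y * E l x y))))
        ≈⟨ sumFin-cong (λ t → trans (sumFin-cong (λ x → sym (*-distribˡ-sumFin _ _))) (sym (*-distribˡ-sumFin _ _))) ⟩
      sumFin (λ t → q t * sumFin (λ x → sumFin (λ y → E t x y * E l x y)))
        ≈⟨ sumFin-only _ l (λ t t≢l → trans (*-congˡ (E·E-sum t l t≢l)) (zeroʳ _)) ⟩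
      q l * sumFin (λ x → sumFin (λ y → E l x y * E l x y))
        ≈⟨ *-congˡ (E·E-trace l) ⟩
      q l * trace l ∎

    κ-cycle : ∀ i j l → κ i j l ≈ κ j l i
    κ-cycle i j l = sumFin-cong (λ x → sumFin-cong (λ y → solve 3 (λ a b e → a ⊗ b ⊗ e ⊜ b ⊗ e ⊗ a) refl _ _ _))

    x₀ : X
    x₀ = proj₁ (∃-at-distance 0 z≤n)

    n≢0 : n ≢ 0
    n≢0 e with ≡.subst Fin e x₀
    ... | ()

    ιn≉0 : ¬ ι n ≈ 0#
    ιn≉0 = ι≉0 n≢0

    sumFin-const : ∀ m a → sumFin {m} (λ _ → a) ≈ ι m * a
    sumFin-const zero    a = trans (reflexive (sumFin≡sumOver _)) (sym (zeroˡ _))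
    sumFin-const (suc m) a = trans (sumFin-suc _) (trans (+-congˡ (sumFin-const m a))
      (solve 2 (λ a b → a ⊕ b ⊗ a ⊜ (:1 ⊕ b) ⊗ a) refl _ _))

    -- The eigenvalue expansion is available only under a double negation and is therefore a
    -- parameter.
    module Spectral
      (spectrum : ∀ (h : Index) → ∃ λ (θ : Index → Carrier) → A (toℕ h) ≋ span θ) where

      θ : Index → Index → Carrier
      θ h = proj₁ (spectrum h)

      A≋span : ∀ h → A (toℕ h) ≋ span (θ h)
      A≋span h = proj₂ (spectrum h)

      eigen : ∀ h j x y → (A (toℕ h) ⊙ E j) x y ≈ θ h j * E j x y
      eigen h j x y = trans (sumFin-cong (λ z → *-congʳ (A≋span h x z))) (span-component (θ h) j x y)

      -- The diagonal of `E l` is constant, so trace zero makes it vanish. As `E l` consists of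
      -- eigenvectors of every distance matrix, row x is then orthogonal to the distance indicators
      -- at x. These are integer vectors and row x is a combination of them, so `gram-kernel`
      -- applies.
      trace≉0 : ∀ l → ¬ trace l ≈ 0#
      trace≉0 l trace≈0 = E-≉0 l E≈0
        where
        diagonal≈0 : ∀ x → E l x x ≈ 0#
        diagonal≈0 x = *-zero-cancelˡ ιn≉0 (trans (sym (sumFin-const n (E l x x)))
          (trans (sumFin-cong (λ z → E-radial l x x z z (≡.trans (d-refl x) (≡.sym (d-refl z))))) trace≈0))
        φ : X → Index → X → ℤ
        φ x j y = + (if d x y ≡ᵇ toℕ j then 1 else 0)
        ιφ : ∀ x j y → ιℤ (φ x j y) ≈ δ (d x y) (toℕ j)
        ιφ x j y = ι-if (d x y ≡ᵇ toℕ j)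
        E≈combination : ∀ x y → E l x y ≈ combination (allFin n) ∈-allFin (allFin (suc D)) (φ x) (λ j → E l at toℕ j) y
        E≈combination x y = begin
          E l x y
            ≈⟨ trans (radial-at (E-radial l) x y) (by-distance (E l at_) (d≤D x y)) ⟩
          sumFin (λ j → E l at toℕ j * δ (d x y) (toℕ j))
            ≈⟨ sumFin-cong (λ j → *-congˡ (sym (ιφ x j y))) ⟩
          sumFin (λ j → E l at toℕ j * ιℤ (φ x j y))
            ≡⟨ sumFin≡sumOver _ ⟩
          combination (allFin n) ∈-allFin (allFin (suc D)) (φ x) (λ j → E l at toℕ j) y ∎
        E≈0 : ∀ x y → E l x y ≈ 0#
        E≈0 x y = trans (E≈combination x y) (gram-kernel (allFin n) ∈-allFin (allFin (suc D)) (φ x) _ orthogonal y)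
          where
          orthogonal : ∀ j → sumOver (allFin n) (λ y → ιℤ (φ x j y) * combination (allFin n) ∈-allFin (allFin (suc D)) (φ x) (λ j → E l at toℕ j) y) ≈ 0#
          orthogonal j = begin
            sumOver (allFin n) (λ y → ιℤ (φ x j y) * combination (allFin n) ∈-allFin (allFin (suc D)) (φ x) (λ j → E l at toℕ j) y)
              ≈⟨ sumOver-cong (allFin n) (λ y → *-cong (ιφ x j y) (trans (sym (E≈combination x y)) (radial-sym (E-radial l) x y))) ⟩
            sumOver (allFin n) (λ y → A (toℕ j) x y * E l y x)
              ≡⟨ sumFin≡sumOver _ ⟨
            (A (toℕ j) ⊙ E l) x x
              ≈⟨ trans (eigen j l x x) (trans (*-congˡ (diagonal≈0 x)) (zeroʳ _)) ⟩
            0# ∎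

      -- The x, y entry of `E i` times the diagonal matrix of row v of `E j` times `E l`: a product
      -- in the Terwilliger algebra with respect to v.
      triple : Index → Index → Index → X → X → X → Carrier
      triple i j l x v y = sumFin (λ z → E i x z * E j v z * E l z y)

      -- The triple product vanishes with the Krein parameter; over the reals this is the
      -- vanishing of a sum of squares, here the integer matrix of triple intersection numbers
      -- plays that role through gram-kernel.
      module _ (i j l : Index) (κ≈0 : κ i j l ≈ 0#) where
        private
          X³ : List (X × X × X)
          X³ = cartesianProduct (allFin n) (cartesianProduct (allFin n) (allFin n))

          complete : ∀ t → t ∈ X³
          complete (x , v , y) = ∈-cartesianProduct⁺ (∈-allFin x) (∈-cartesianProduct⁺ (∈-allFin v) (∈-allFin y))

          Index³ : List (Index × Index × Index)
          Index³ = cartesianProduct (allFin (suc D)) (cartesianProduct (allFin (suc D)) (allFin (suc D)))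

          sumOver³ : ∀ m (f : Fin m × Fin m × Fin m → Carrier) →
            sumOver (cartesianProduct (allFin m) (cartesianProduct (allFin m) (allFin m))) f ≈
            sumFin (λ a → sumFin (λ b → sumFin (λ e → f (a , b , e))))
          sumOver³ m f = trans (sumOver-× (allFin m) (cartesianProduct (allFin m) (allFin m)) f)
            (trans (sumOver-cong (allFin m) (λ a → trans (sumOver-× (allFin m) (allFin m) (λ t → f (a , t)))
              (trans (sumOver-cong (allFin m) (λ b → reflexive (≡.sym (sumFin≡sumOver _)))) (reflexive (≡.sym (sumFin≡sumOver _))))))
              (reflexive (≡.sym (sumFin≡sumOver _))))

          meet : Index × Index × Index → X × X × X → X → Bool
          meet (a , b , e) (x , v , y) z = (d x z ≡ᵇ toℕ a) ∧ ((d v z ≡ᵇ toℕ b) ∧ (d z y ≡ᵇ toℕ e))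

          φ : Index × Index × Index → X × X × X → ℤ
          φ s t = + # (meet s t)

          ξ : Index × Index × Index → Carrier
          ξ (a , b , e) = E i at toℕ a * E j at toℕ b * E l at toℕ e

          ιφ : ∀ a b e x v y → ιℤ (φ (a , b , e) (x , v , y)) ≈ sumFin (λ z → A (toℕ a) x z * (A (toℕ b) v z * A (toℕ e) z y))
          ιφ a b e x v y = trans (ι-# (meet (a , b , e) (x , v , y)))
            (sumFin-cong (λ z → trans (if-∧ (d x z ≡ᵇ toℕ a) _) (*-congˡ (if-∧ (d v z ≡ᵇ toℕ b) (d z y ≡ᵇ toℕ e)))))

          expand : ∀ h x y → E h x y ≈ sumFin (λ (a : Index) → E h at toℕ a * A (toℕ a) x y)
          expand h x y = trans (radial-at (E-radial h) x y) (by-distance (E h at_) (d≤D x y))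

          triple≈combination : ∀ x v y → triple i j l x v y ≈ combination X³ complete Index³ φ ξ (x , v , y)
          triple≈combination x v y = begin
            sumFin (λ z → E i x z * E j v z * E l z y)
              ≈⟨ sumFin-cong (λ z → *-cong (*-cong (expand i x z) (expand j v z)) (expand l z y)) ⟩
            sumFin (λ z → sumFin (f₁ z) * sumFin (f₂ z) * sumFin (f₃ z))
              ≈⟨ sumFin-cong (λ z → trans (*-assoc _ _ _) (trans (*-congˡ (sumFin-* (f₂ z) (f₃ z))) (trans (*-distribʳ-sumFin _ _)
                   (sumFin-cong (λ a → trans (*-distribˡ-sumFin _ _) (sumFin-cong (λ b → *-distribˡ-sumFin _ _))))))) ⟩
            sumFin (λ z → sumFin (λ a → sumFin (λ b → sumFin (λ e → f₁ z a * (f₂ z b * f₃ z e)))))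
              ≈⟨ trans (sumFin-swap _) (sumFin-cong (λ a → trans (sumFin-swap _) (sumFin-cong (λ b → sumFin-swap _)))) ⟩
            sumFin (λ a → sumFin (λ b → sumFin (λ e → sumFin (λ z → f₁ z a * (f₂ z b * f₃ z e)))))
              ≈⟨ sumFin-cong (λ a → sumFin-cong (λ b → sumFin-cong (λ e → trans
                   (sumFin-cong (λ z → solve 6 (λ p q r s t u → p ⊗ q ⊗ (r ⊗ s ⊗ (t ⊗ u)) ⊜ p ⊗ r ⊗ t ⊗ (q ⊗ (s ⊗ u))) refl
                      (E i at toℕ a) (A (toℕ a) x z) (E j at toℕ b) (A (toℕ b) v z) (E l at toℕ e) (A (toℕ e) z y)))
                   (trans (sym (*-distribˡ-sumFin _ _)) (*-congˡ (sym (ιφ a b e x v y))))))) ⟩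
            sumFin (λ a → sumFin (λ b → sumFin (λ e → ξ (a , b , e) * ιℤ (φ (a , b , e) (x , v , y)))))
              ≈⟨ sumOver³ (suc D) (λ s → ξ s * ιℤ (φ s (x , v , y))) ⟨
            combination X³ complete Index³ φ ξ (x , v , y) ∎
            where
            f₁ f₂ f₃ : X → Index → Carrier
            f₁ z a = E i at toℕ a * A (toℕ a) x z
            f₂ z b = E j at toℕ b * A (toℕ b) v z
            f₃ z e = E l at toℕ e * A (toℕ e) z y

          product³ : ∀ (f g h : X → Carrier) →
            sumFin (λ x → sumFin (λ v → sumFin (λ y → f x * (g v * h y)))) ≈ sumFin f * (sumFin g * sumFin h)
          product³ f g h = sym (trans (*-congˡ (sumFin-* g h)) (trans (*-distribʳ-sumFin _ _)
            (sumFin-cong (λ x → trans (*-distribˡ-sumFin _ _) (sumFin-cong (λ v → *-distribˡ-sumFin _ _))))))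

          A⊙E : ∀ a h z w → sumFin (λ x → A (toℕ a) x z * E h x w) ≈ θ a h * E h z w
          A⊙E a h z w = trans (sumFin-cong (λ x → *-congʳ (radial-sym (A-radial (toℕ a)) x z))) (eigen a h z w)

          -- For fixed z and w the sum over x, v, y factors into three products of a distance matrix
          -- with an idempotent. Each of them acts as an eigenvalue, and the sum over z and w that
          -- is left is κ.
          orthogonal : ∀ s → sumOver X³ (λ t → ιℤ (φ s t) * combination X³ complete Index³ φ ξ t) ≈ 0#
          orthogonal (a , b , e) = begin
            sumOver X³ (λ t → ιℤ (φ (a , b , e) t) * combination X³ complete Index³ φ ξ t)
              ≈⟨ sumOver³ n _ ⟩
            sumFin (λ x → sumFin (λ v → sumFin (λ y → ιℤ (φ (a , b , e) (x , v , y)) * combination X³ complete Index³ φ ξ (x , v , y))))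
              ≈⟨ sumFin-cong (λ x → sumFin-cong (λ v → sumFin-cong (λ y → trans
                   (*-cong (ιφ a b e x v y) (sym (triple≈combination x v y))) (sumFin-* _ _)))) ⟩
            sumFin (λ x → sumFin (λ v → sumFin (λ y → sumFin (λ z → sumFin (λ w →
              A (toℕ a) x z * (A (toℕ b) v z * A (toℕ e) z y) * (E i x w * E j v w * E l w y))))))
              ≈⟨ sumFin-cong (λ x → sumFin-cong (λ v → trans (sumFin-swap _) (sumFin-cong (λ z → sumFin-swap _)))) ⟩
            sumFin (λ x → sumFin (λ v → sumFin (λ z → sumFin (λ w → sumFin (λ y →
              A (toℕ a) x z * (A (toℕ b) v z * A (toℕ e) z y) * (E i x w * E j v w * E l w y))))))
              ≈⟨ sumFin-cong (λ x → trans (sumFin-swap _) (sumFin-cong (λ z → sumFin-swap _))) ⟩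
            sumFin (λ x → sumFin (λ z → sumFin (λ w → sumFin (λ v → sumFin (λ y →
              A (toℕ a) x z * (A (toℕ b) v z * A (toℕ e) z y) * (E i x w * E j v w * E l w y))))))
              ≈⟨ trans (sumFin-swap _) (sumFin-cong (λ z → sumFin-swap _)) ⟩
            sumFin (λ z → sumFin (λ w → sumFin (λ x → sumFin (λ v → sumFin (λ y →
              A (toℕ a) x z * (A (toℕ b) v z * A (toℕ e) z y) * (E i x w * E j v w * E l w y))))))
              ≈⟨ sumFin-cong (λ z → sumFin-cong (λ w → trans
                   (sumFin-cong (λ x → sumFin-cong (λ v → sumFin-cong (λ y →
                     solve 6 (λ p q r s t u → p ⊗ (q ⊗ r) ⊗ (s ⊗ t ⊗ u) ⊜ p ⊗ s ⊗ (q ⊗ t ⊗ (r ⊗ u))) refl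
                       (A (toℕ a) x z) (A (toℕ b) v z) (A (toℕ e) z y) (E i x w) (E j v w) (E l w y)))))
                   (product³ (λ x → A (toℕ a) x z * E i x w) (λ v → A (toℕ b) v z * E j v w) (λ y → A (toℕ e) z y * E l w y)))) ⟩
            sumFin (λ z → sumFin (λ w → sumFin (λ x → A (toℕ a) x z * E i x w) *
              (sumFin (λ v → A (toℕ b) v z * E j v w) * sumFin (λ y → A (toℕ e) z y * E l w y))))
              ≈⟨ sumFin-cong (λ z → sumFin-cong (λ w → *-cong (A⊙E a i z w) (*-cong (A⊙E b j z w)
                   (trans (sumFin-cong (λ y → *-congˡ (radial-sym (E-radial l) w y))) (eigen e l z w))))) ⟩
            sumFin (λ z → sumFin (λ w → θ a i * E i z w * (θ b j * E j z w * (θ e l * E l z w))))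
              ≈⟨ sumFin-cong (λ z → trans (sumFin-cong (λ w →
                   solve 6 (λ p q r s t u → p ⊗ q ⊗ (r ⊗ s ⊗ (t ⊗ u)) ⊜ p ⊗ r ⊗ t ⊗ (q ⊗ s ⊗ u)) refl
                     (θ a i) (E i z w) (θ b j) (E j z w) (θ e l) (E l z w))) (sym (*-distribˡ-sumFin _ _))) ⟩
            sumFin (λ z → θ a i * θ b j * θ e l * sumFin (λ w → E i z w * E j z w * E l z w))
              ≈⟨ *-distribˡ-sumFin _ _ ⟨
            θ a i * θ b j * θ e l * κ i j l
              ≈⟨ trans (*-congˡ κ≈0) (zeroʳ _) ⟩
            0# ∎

        triple≈0 : ∀ x v y → triple i j l x v y ≈ 0#
        triple≈0 x v y = trans (triple≈combination x v y) (gram-kernel X³ complete Index³ φ ξ orthogonal (x , v , y))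

-- The balanced set condition.

module BalancedSets where
  open Summation
  open FieldTools
  open GraphMetric
  open AlmostBipartite
  open LinearAlgebraTools
  open BoseMesnerAlgebra
  open KreinParameters
  open import Algebra.Bundles using (CommutativeRing)
  open import Data.Nat as ℕ using (ℕ; zero; suc; _≤_; _<_; z≤n; _≤?_)
  import Data.Nat.Properties as ℕₚ
  open import Data.Integer as ℤ using (+_)
  open import Data.Fin using (Fin; _≟_; toℕ)
  import Data.Fin as Fin
  open import Data.Fin.Properties using (toℕ-injective)
  open import Data.Product using (∃)
  open import Data.Sum using (_⊎_; inj₁; inj₂)
  open import Data.Empty using (⊥-elim)
  open import Relation.Nullary using (¬_; yes; no; contradiction)
  open import Relation.Binary.Definitions using (tri<; tri≈; tri>)
  open import Relation.Binary.PropositionalEquality as ≡ using (_≡_; _≢_)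
  open import Tactic.RingSolver.Core.Expression using (_⊗_)

  module BalancedSetTheory {c ℓ} (F : CharZeroField c ℓ) (G : Graph) (conn : Connected G) (D k : ℕ)
    (dr : DistanceRegular G D) (ab : AlmostBipartite G D) (3≤D : 3 ≤ D) (val : Valency G k) (girth : Girth G 6)
    (E : Fin (suc D) → Fin (Graph.n G) → Fin (Graph.n G) → CommutativeRing.Carrier (CharZeroField.cring F))
    (ord : IdempotentOrdering F G D E)
    (E₀ : ∀ x y → CommutativeRing._≈_ (CharZeroField.cring F)
      (CommutativeRing._*_ (CharZeroField.cring F) (ofℕ (CharZeroField.cring F) (Graph.n G)) (E Fin.zero x y))
      (CommutativeRing.1# (CharZeroField.cring F))) where

    open AlmostBipartiteGraph G conn D k dr ab 3≤D val girth
    open Field F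
    open LinearAlgebra F
    open BoseMesner F G conn D k dr ab 3≤D val girth
    open Idempotents E ord

    open KreinTheory F G conn D k dr ab 3≤D val girth E ord

    Neighbours : Index → Index → Set
    Neighbours i j = (toℕ i ≡ suc (toℕ j)) ⊎ (toℕ j ≡ suc (toℕ i))

    toℕ-one : toℕ one ≡ 1
    toℕ-one = toℕ-index (ℕₚ.<⇒≤ 1<D)

    κ-swap : ∀ i j l → κ i j l ≈ κ j i l
    κ-swap i j l = sumFin-cong (λ x → sumFin-cong (λ y → *-congʳ (*-comm _ _)))

    module Consequences
      (spectrum : ∀ (h : Index) → ∃ λ (θ : Index → Carrier) → A (toℕ h) ≋ span θ)
      (q : Index → Index → Index → Carrier)
      (krein : ∀ i j → Krein i j (q i j))
      (q≉0 : ∀ i j → toℕ j ≡ suc (toℕ i) → ¬ q i j one ≈ 0#)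
      (q≈0 : ∀ i j → suc (toℕ i) < toℕ j → q i j one ≈ 0#) where
      open Spectral spectrum

      κ-far : ∀ i j → suc (toℕ i) < toℕ j → κ i j one ≈ 0#
      κ-far i j lt = *-zero-cancelˡ ιn≉0 (trans (krein-κ (krein i j) one) (trans (*-congʳ (q≈0 i j lt)) (zeroˡ _)))

      κ-near : ∀ i j → toℕ j ≡ suc (toℕ i) → ¬ κ i j one ≈ 0#
      κ-near i j e κ≈0 = *-≉0 (q≉0 i j e) (trace≉0 one)
        (trans (sym (krein-κ (krein i j) one)) (trans (*-congˡ κ≈0) (zeroʳ _)))

      triple-far : ∀ i j x v y → suc (toℕ i) < toℕ j → triple i one j x v y ≈ 0#
      triple-far i j x v y lt = triple≈0 i one j
        (trans (κ-cycle i one j) (trans (κ-cycle one j i) (trans (κ-swap j i one) (κ-far i j lt)))) x v y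

      triple-far′ : ∀ i j x v y → suc (toℕ j) < toℕ i → triple i one j x v y ≈ 0#
      triple-far′ i j x v y lt = triple≈0 i one j
        (trans (κ-cycle i one j) (trans (κ-cycle one j i) (κ-far j i lt))) x v y

      span-bilinear : ∀ α β x v y → sumFin (λ z → span α x z * E one v z * span β z y) ≈
        sumFin (λ i → sumFin (λ j → α i * β j * triple i one j x v y))
      span-bilinear α β x v y = begin
        sumFin (λ z → span α x z * E one v z * span β z y)
          ≈⟨ sumFin-cong (λ z → trans (*-assoc _ _ _) (trans (*-distribʳ-sumFin _ _) (sumFin-cong (λ i →
               trans (*-congˡ (*-distribˡ-sumFin _ _)) (*-distribˡ-sumFin _ _))))) ⟩
        sumFin (λ z → sumFin (λ i → sumFin (λ j → α i * E i x z * (E one v z * (β j * E j z y)))))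
          ≈⟨ trans (sumFin-swap _) (sumFin-cong (λ i → sumFin-swap _)) ⟩
        sumFin (λ i → sumFin (λ j → sumFin (λ z → α i * E i x z * (E one v z * (β j * E j z y)))))
          ≈⟨ sumFin-cong (λ i → sumFin-cong (λ j → trans (sumFin-cong (λ z →
               solve 5 (λ a p e b r → a ⊗ p ⊗ (e ⊗ (b ⊗ r)) ⊜ a ⊗ b ⊗ (p ⊗ e ⊗ r)) refl
                 (α i) (E i x z) (E one v z) (β j) (E j z y))) (sym (*-distribˡ-sumFin _ _)))) ⟩
        sumFin (λ i → sumFin (λ j → α i * β j * triple i one j x v y)) ∎

      zeroth : Index
      zeroth = index 0 z≤n

      -- The coefficients of A 0 in the E i are only known to satisfy θ_i E_i = E_i.
      A₀≋∑E : ∀ x y → A 0 x y ≈ span (λ _ → 1#) x y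
      A₀≋∑E x y = begin
        A 0 x y                          ≡⟨ ≡.cong (λ h → A h x y) (toℕ-index z≤n) ⟨
        A (toℕ zeroth) x y               ≈⟨ A≋span zeroth x y ⟩
        span (θ zeroth) x y              ≈⟨ sumFin-cong (λ i → trans (unit i) (sym (*-identityˡ _))) ⟩
        span (λ _ → 1#) x y ∎
        where
        unit : ∀ i → θ zeroth i * E i x y ≈ E i x y
        unit i = trans (sym (eigen zeroth i x y))
          (trans (sumFin-cong (λ z → *-congʳ (reflexive (≡.cong (λ h → A h x z) (toℕ-index z≤n))))) (A₀-identity (E i) x y))

      -- The idempotents sum to the identity matrix, so all coefficients 1 reduce the sum to the
      -- term at y.
      span-1-right : ∀ α x v y → sumFin (λ z → span α x z * E one v z * span (λ _ → 1#) z y) ≈ span α x y * E one v y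
      span-1-right α x v y = trans (sumFin-cong (λ z → *-congˡ (sym (A₀≋∑E z y)))) (trans
        (sumFin-only _ y (λ z z≢y → trans (*-congˡ (δ-≢ (λ e → z≢y (d≡0⇒≡ e)))) (zeroʳ _)))
        (trans (*-congˡ (δ-≡ (d-refl y))) (*-identityʳ _)))

      span-1-left : ∀ α x v y → sumFin (λ z → span (λ _ → 1#) x z * E one v z * span α z y) ≈ E one v x * span α x y
      span-1-left α x v y = trans (sumFin-cong (λ z → *-congʳ (*-congʳ (sym (A₀≋∑E x z))))) (trans
        (sumFin-only _ x (λ z z≢x → trans (*-congʳ (trans (*-congʳ (δ-≢ (λ e → z≢x (≡.sym (d≡0⇒≡ e))))) (zeroˡ _))) (zeroˡ _)))
        (*-congʳ (trans (*-congʳ (δ-≡ (d-refl x))) (*-identityˡ _))))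

      module _ (α β : Index → Carrier) where
        private
          ext : (Index → Carrier) → ℕ → Carrier
          ext γ h with h ≤? D
          ... | yes h≤D = γ (index h h≤D)
          ... | no _    = 0#

          ext-toℕ : ∀ γ i → γ i ≈ ext γ (toℕ i)
          ext-toℕ γ i with toℕ i ≤? D
          ... | yes h≤D = reflexive (≡.cong γ (toℕ-injective (≡.sym (toℕ-index h≤D))))
          ... | no ¬h≤D = contradiction (toℕ≤D i) ¬h≤D

          -- Negated partial sums of the discrete Wronskian of α and β, so that its value between i
          -- and i + 1 is `g i - g (i + 1)`.
          g : ℕ → Carrier
          g zero    = 0#
          g (suc h) = g h + - (ext α h * ext β (suc h) + - (ext β h * ext α (suc h)))

          -- α β′ − β α′ telescopes on neighbouring eigenspaces, the only ones the triple product links.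
          telescope : ∀ i j x v y → (α i * β j + - (β i * α j)) * triple i one j x v y ≈
            (g (toℕ i) + - g (toℕ j)) * triple i one j x v y
          telescope i j x v y with ℕₚ.<-cmp (toℕ i) (toℕ j)
          ... | tri≈ _ e _ with toℕ-injective e
          ...   | ≡.refl = solve 4 (λ a b h t → (a ⊗ b :- b ⊗ a) ⊗ t ⊜ (h :- h) ⊗ t) refl _ _ _ _
          telescope i j x v y | tri< i<j _ _ with ℕₚ.m≤n⇒m<n∨m≡n i<j
          ... | inj₁ lt = trans (trans (*-congˡ (triple-far i j x v y lt)) (zeroʳ _))
                            (sym (trans (*-congˡ (triple-far i j x v y lt)) (zeroʳ _)))
          ... | inj₂ e = *-congʳ (begin
            α i * β j + - (β i * α j)
              ≈⟨ +-cong (*-cong (ext-toℕ α i) (ext-toℕ β j)) (-‿cong (*-cong (ext-toℕ β i) (ext-toℕ α j))) ⟩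
            ext α (toℕ i) * ext β (toℕ j) + - (ext β (toℕ i) * ext α (toℕ j))
              ≡⟨ ≡.cong (λ h → ext α (toℕ i) * ext β h + - (ext β (toℕ i) * ext α h)) e ⟨
            ext α (toℕ i) * ext β (suc (toℕ i)) + - (ext β (toℕ i) * ext α (suc (toℕ i)))
              ≈⟨ solve 2 (λ h t → t ⊜ h :- (h :- t)) refl (g (toℕ i)) _ ⟩
            g (toℕ i) + - g (suc (toℕ i))
              ≡⟨ ≡.cong (λ h → g (toℕ i) + - g h) e ⟩
            g (toℕ i) + - g (toℕ j) ∎)
          telescope i j x v y | tri> _ _ j<i with ℕₚ.m≤n⇒m<n∨m≡n j<i
          ... | inj₁ lt = trans (trans (*-congˡ (triple-far′ i j x v y lt)) (zeroʳ _))
                            (sym (trans (*-congˡ (triple-far′ i j x v y lt)) (zeroʳ _)))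
          ... | inj₂ e = *-congʳ (begin
            α i * β j + - (β i * α j)
              ≈⟨ +-cong (*-cong (ext-toℕ α i) (ext-toℕ β j)) (-‿cong (*-cong (ext-toℕ β i) (ext-toℕ α j))) ⟩
            ext α (toℕ i) * ext β (toℕ j) + - (ext β (toℕ i) * ext α (toℕ j))
              ≡⟨ ≡.cong (λ h → ext α h * ext β (toℕ j) + - (ext β h * ext α (toℕ j))) e ⟨
            ext α (suc (toℕ j)) * ext β (toℕ j) + - (ext β (suc (toℕ j)) * ext α (toℕ j))
              ≈⟨ solve 5 (λ h a b a′ b′ → a′ ⊗ b :- b′ ⊗ a ⊜ h :- (a ⊗ b′ :- b ⊗ a′) :- h) refl
                   (g (toℕ j)) (ext α (toℕ j)) (ext β (toℕ j)) (ext α (suc (toℕ j))) (ext β (suc (toℕ j))) ⟩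
            g (suc (toℕ j)) + - g (toℕ j)
              ≡⟨ ≡.cong (λ h → g h + - g (toℕ j)) e ⟩
            g (toℕ i) + - g (toℕ j) ∎)

        commutator : Matrix
        commutator = span (λ i → g (toℕ i))

        commutator-radial : Radial commutator
        commutator-radial x y x′ y′ e = sumFin-cong (λ i → *-congˡ (E-radial i x y x′ y′ e))

        -- With A* the diagonal matrix of row v of `E one`, this is MA*N - NA*M = KA* - A*K for M =
        -- `span α`, N = `span β` and K = `commutator`. Both sides are expanded in the products
        -- `E i` A* `E j`, and `telescope` compares the coefficients.
        balanced : ∀ x v y →
          sumFin (λ z → span α x z * E one v z * span β z y) + - sumFin (λ z → span β x z * E one v z * span α z y)
          ≈ commutator x y * (E one v y + - E one v x)
        balanced x v y = begin
          sumFin (λ z → span α x z * E one v z * span β z y) + - sumFin (λ z → span β x z * E one v z * span α z y)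
            ≈⟨ antisymmetrise α β β α ⟩
          sumFin (λ i → sumFin (λ j → (α i * β j + - (β i * α j)) * triple i one j x v y))
            ≈⟨ sumFin-cong (λ i → sumFin-cong (λ j → telescope i j x v y)) ⟩
          sumFin (λ i → sumFin (λ j → (g (toℕ i) + - g (toℕ j)) * triple i one j x v y))
            ≈⟨ sumFin-cong (λ i → sumFin-cong (λ j → *-congʳ (+-cong (sym (*-identityʳ _)) (-‿cong (sym (*-identityˡ _)))))) ⟩
          sumFin (λ i → sumFin (λ j → (g (toℕ i) * 1# + - (1# * g (toℕ j))) * triple i one j x v y))
            ≈⟨ antisymmetrise (λ i → g (toℕ i)) (λ _ → 1#) (λ _ → 1#) (λ i → g (toℕ i)) ⟨
          sumFin (λ z → commutator x z * E one v z * span (λ _ → 1#) z y) + - sumFin (λ z → span (λ _ → 1#) x z * E one v z * commutator z y)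
            ≈⟨ +-cong (span-1-right _ x v y) (-‿cong (span-1-left _ x v y)) ⟩
          commutator x y * E one v y + - (E one v x * commutator x y)
            ≈⟨ solve 3 (λ m a b → m ⊗ a :- b ⊗ m ⊜ m ⊗ (a :- b)) refl _ _ _ ⟩
          commutator x y * (E one v y + - E one v x) ∎
          where
          antisymmetrise : ∀ a b a′ b′ →
            sumFin (λ z → span a x z * E one v z * span b z y) + - sumFin (λ z → span a′ x z * E one v z * span b′ z y)
            ≈ sumFin (λ i → sumFin (λ j → (a i * b j + - (a′ i * b′ j)) * triple i one j x v y))
          antisymmetrise a b a′ b′ = trans (+-cong (span-bilinear a b x v y) (-‿cong (span-bilinear a′ b′ x v y)))
            (sym (trans (sumFin-cong (λ i → trans (sumFin-cong (λ j →
              solve 3 (λ p r t → (p :- r) ⊗ t ⊜ p ⊗ t :- r ⊗ t) refl _ _ _)) (sumFin-⊟ _ _))) (sumFin-⊟ _ _)))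

      -- The idempotents are polynomials in E one under entrywise multiplication, so they cannot
      -- separate distances that E one does not separate.
      E-one-injective : ∀ x y x′ y′ → E one x y ≈ E one x′ y′ → d x y ≡ d x′ y′
      E-one-injective x y x′ y′ h with d x y ℕ.≟ d x′ y′
      ... | yes e = e
      ... | no ne = ⊥-elim (1≉0 (begin
        1#                              ≈⟨ δ-≡ (≡.sym (toℕ-index (d≤D x y))) ⟨
        A (toℕ a) x y                   ≈⟨ A≋span a x y ⟩
        span (θ a) x y                  ≈⟨ sumFin-cong (λ i → *-congˡ (agree D i (toℕ≤D i))) ⟩
        span (θ a) x′ y′                ≈⟨ A≋span a x′ y′ ⟨
        A (toℕ a) x′ y′                 ≈⟨ δ-≢ (λ e → ne (≡.sym (≡.trans e (toℕ-index (d≤D x y))))) ⟩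
        0# ∎))
        where
        a : Index
        a = index (d x y) (d≤D x y)
        agree-suc : ∀ m → (∀ i → toℕ i ≤ m → E i x y ≈ E i x′ y′) → ∀ i → toℕ i ≡ suc m → E i x y ≈ E i x′ y′
        agree-suc zero _ i e with toℕ-injective {i = i} {j = one} (≡.trans e (≡.sym toℕ-one))
        ... | ≡.refl = h
        -- The expansions of the entrywise product of `E one` and `E p` at the two pairs are
        -- compared: terms below i agree by induction, those above i have coefficient zero, and the
        -- coefficient at i is not zero.
        agree-suc (suc m) ih i e = *-cancelˡ-≉0 qᵢ≉0 (x∙y⁻¹≈ε⇒x≈y _ _ (begin
          q one p i * E i x y + - (q one p i * E i x′ y′)
            ≈⟨ solve 3 (λ a b c → a ⊗ b :- a ⊗ c ⊜ a ⊗ (b :- c)) refl _ _ _ ⟩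
          q one p i * (E i x y + - E i x′ y′)
            ≈⟨ sumFin-only (λ l → q one p l * (E l x y + - E l x′ y′)) i vanish ⟨
          sumFin (λ l → q one p l * (E l x y + - E l x′ y′))
            ≈⟨ trans (sumFin-cong (λ l → solve 3 (λ a b c → a ⊗ (b :- c) ⊜ a ⊗ b :- a ⊗ c) refl _ _ _)) (sumFin-⊟ _ _) ⟩
          span (q one p) x y + - span (q one p) x′ y′
            ≈⟨ +-cong (sym (krein one p x y)) (-‿cong (sym (krein one p x′ y′))) ⟩
          ι n * (E one x y * E p x y) + - (ι n * (E one x′ y′ * E p x′ y′))
            ≈⟨ x≈y⇒x∙y⁻¹≈ε (*-congˡ (*-cong h (ih p (ℕₚ.≤-reflexive toℕ-p)))) ⟩
          0# ∎))
          where
          p : Index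
          p = index (suc m) (ℕₚ.≤-trans (ℕₚ.n≤1+n (suc m)) (≡.subst (_≤ D) e (toℕ≤D i)))
          toℕ-p : toℕ p ≡ suc m
          toℕ-p = toℕ-index (ℕₚ.≤-trans (ℕₚ.n≤1+n (suc m)) (≡.subst (_≤ D) e (toℕ≤D i)))
          κ-one-p : ∀ l → ι n * κ p l one ≈ q one p l * trace l
          κ-one-p l = trans (*-congˡ (sym (κ-cycle one p l))) (krein-κ (krein one p) l)
          qᵢ≉0 : ¬ q one p i ≈ 0#
          qᵢ≉0 q≈0 = *-≉0 ιn≉0 (κ-near p i (≡.trans e (≡.cong suc (≡.sym toℕ-p))))
            (trans (κ-one-p i) (trans (*-congʳ q≈0) (zeroˡ _)))
          vanish : ∀ l → l ≢ i → q one p l * (E l x y + - E l x′ y′) ≈ 0#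
          vanish l l≢i with ℕₚ.<-cmp (toℕ l) (toℕ i)
          ... | tri< lt _ _ = trans (*-congˡ (x≈y⇒x∙y⁻¹≈ε (ih l (ℕ.s≤s⁻¹ (≡.subst (toℕ l <_) e lt))))) (zeroʳ _)
          ... | tri≈ _ e′ _ = contradiction (toℕ-injective e′) l≢i
          ... | tri> _ _ gt = trans (*-congʳ (*-zero-cancelˡ (trace≉0 l) (trans (*-comm _ _) (trans (sym (κ-one-p l))
            (trans (*-congˡ (κ-far p l (≡.subst (_< toℕ l) (≡.trans e (≡.cong suc (≡.sym toℕ-p))) gt))) (zeroʳ _)))))) (zeroˡ _)
        agree : ∀ m i → toℕ i ≤ m → E i x y ≈ E i x′ y′
        agree zero Fin.zero _ = *-cancelˡ-≉0 ιn≉0 (trans (E₀ x y) (sym (E₀ x′ y′)))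
        agree (suc m) i le with ℕₚ.m≤n⇒m<n∨m≡n le
        ... | inj₁ lt = agree m i (ℕ.s≤s⁻¹ lt)
        ... | inj₂ e  = agree-suc m (agree m) i e

-- From an idempotent to a sequence indexed by distance.

module BalancedSequenceConstruction where
  open Summation
  open FieldTools
  open GraphMetric
  open AlmostBipartite
  open LinearAlgebraTools
  open BoseMesnerAlgebra
  open KreinParameters
  open BalancedSets
  open import Level using (_⊔_)
  open import Data.Bool using (true; false; if_then_else_)
  open import Data.Nat as ℕ using (ℕ; suc; _≤_; _<_; _≡ᵇ_; _<?_)
  import Data.Nat.Properties as ℕₚ
  open import Data.Integer as ℤ using (+_)
  open import Data.Fin using (toℕ)
  open import Data.Product using (_,_; proj₁; proj₂; ∃)
  open import Data.Sum using (inj₁; inj₂)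
  open import Function.Bundles using (Equivalence)
  open import Relation.Nullary using (¬_; Dec; yes; no; contradiction)
  open import Relation.Binary.PropositionalEquality as ≡ using (_≡_)
  open import Tactic.RingSolver.Core.Expression using (_⊗_; ⊝_)

  module BalancedSequences {c ℓ} (F : CharZeroField c ℓ) (G : Graph) (conn : Connected G) (D k : ℕ)
    (dr : DistanceRegular G D) (ab : AlmostBipartite G D) (3≤D : 3 ≤ D) (val : Valency G k) (girth : Girth G 6) where

    open AlmostBipartiteGraph G conn D k dr ab 3≤D val girth
    open Field F
    open BoseMesner F G conn D k dr ab 3≤D val girth

    -- The interface between algebra and combinatorics: u lists the entries of `E one` by distance
    -- and t is the eigenvalue of the graph on it. All fields survive multiplication of u by a
    -- nonzero scalar.
    record BalancedSequence : Set (c ⊔ ℓ) where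
      field
        u        : ℕ → Carrier
        t γ      : Carrier
        distinct : ∀ {i j} → i ≤ D → j ≤ D → u i ≈ u j → i ≡ j
        eigen    : ∀ x v → sumIf (λ z → d x z ≡ᵇ 1) (λ z → u (d z v)) ≈ t * u (d x v)
        balanced : ∀ x y v → d x y ≡ 3 →
          sumIf (sphere² x y 1 2) (λ z → u (d z v)) + - sumIf (sphere² x y 2 1) (λ z → u (d z v))
            ≈ γ * (u (d x v) + - u (d y v))

    if-* : ∀ b a → (if b then 1# else 0#) * a ≈ (if b then a else 0#)
    if-* true  a = *-identityˡ a
    if-* false a = zeroˡ a

    sphere²-sum : ∀ x y i j (f : X → Carrier) →
      sumFin (λ z → A i x z * f z * A j z y) ≈ sumIf (sphere² x y i j) f
    sphere²-sum x y i j f = sumFin-cong (λ z → begin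
      A i x z * f z * A j z y          ≈⟨ solve 3 (λ p q r → p ⊗ q ⊗ r ⊜ p ⊗ r ⊗ q) refl _ _ _ ⟩
      A i x z * A j z y * f z          ≈⟨ *-congʳ (*-congˡ (radial-sym (A-radial j) z y)) ⟩
      A i x z * A j y z * f z          ≈⟨ *-congʳ (if-∧ (d x z ≡ᵇ i) (d y z ≡ᵇ j)) ⟨
      (if sphere² x y i j z then 1# else 0#) * f z  ≈⟨ if-* (sphere² x y i j z) (f z) ⟩
      (if sphere² x y i j z then f z else 0#) ∎)

    balancedSequence : QPolynomial F G D → ¬ ¬ BalancedSequence
    balancedSequence (E , ord , E₀ , kr) = do
      spectrum ← ¬¬-∀Fin (λ h → spanning (A-radial (toℕ h)))
      -- For indices that are not neighbours, `QPolynomial` only refutes that q is nonzero; that it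
      -- is zero holds under a double negation.
      q≈0 ← ¬¬-∀Fin (λ i → ¬¬-∀Fin (λ j → krein-zero i j (suc (toℕ i) <? toℕ j)))
      pure (fromSpectrum spectrum q≈0)
      where
      open Idempotents E ord
      open KreinTheory F G conn D k dr ab 3≤D val girth E ord
      open BalancedSetTheory F G conn D k dr ab 3≤D val girth E ord E₀

      q : Index → Index → Index → Carrier
      q i j = proj₁ (kr i j)

      krein : ∀ i j → Krein i j (q i j)
      krein i j x y = trans (proj₁ (proj₂ (kr i j)) x y) (∑≈sumFin _)

      krein-zero : ∀ i j → Dec (suc (toℕ i) < toℕ j) → ¬ ¬ (suc (toℕ i) < toℕ j → q i j one ≈ 0#)
      krein-zero i j (no ¬lt) = pure (λ lt → contradiction lt ¬lt)
      krein-zero i j (yes lt) = λ h → far (Equivalence.to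
          (proj₂ (proj₂ (kr i j)) (λ { ≡.refl → ℕₚ.<-irrefl ≡.refl (ℕₚ.<-trans (ℕₚ.n<1+n _) lt) }) one toℕ-one)
          (λ q≈0 → h (λ _ → q≈0)))
        where
        far : ¬ Neighbours i j
        far (inj₁ e) = ℕₚ.<-asym (ℕₚ.<-trans (ℕₚ.n<1+n _) lt) (≡.subst (toℕ j <_) (≡.sym e) (ℕₚ.n<1+n _))
        far (inj₂ e) = ℕₚ.<-irrefl (≡.sym e) lt

      q≉0 : ∀ i j → toℕ j ≡ suc (toℕ i) → ¬ q i j one ≈ 0#
      q≉0 i j e = Equivalence.from
        (proj₂ (proj₂ (kr i j)) (λ { ≡.refl → ℕₚ.<-irrefl e (ℕₚ.n<1+n _) }) one toℕ-one) (inj₂ e)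

      fromSpectrum : (∀ (h : Index) → ∃ λ (θ : Index → Carrier) → A (toℕ h) ≋ span θ) →
        (∀ i j → suc (toℕ i) < toℕ j → q i j one ≈ 0#) → BalancedSequence
      fromSpectrum spectrum q≈0 = record
        { u = u ; t = θ one one ; γ = γ
        ; distinct = distinct ; eigen = eigen′ ; balanced = balanced′ }
        where
        open Spectral spectrum
        open Consequences spectrum q krein q≉0 q≈0
        u : ℕ → Carrier
        u = E one at_
        E≈u : ∀ x y → E one x y ≈ u (d x y)
        E≈u = radial-at (E-radial one)
        E≈u′ : ∀ x y → E one x y ≈ u (d y x)
        E≈u′ x y = trans (E≈u x y) (reflexive (≡.cong u (d-sym x y)))
        two : Index
        two = index 2 (ℕₚ.<⇒≤ 3≤D)
        -- The sign reverses the difference of entries: y comes before x in the commutator identity.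
        γ : Carrier
        γ = - (commutator (θ one) (θ two) at 3)
        span-A : ∀ h {i} → toℕ h ≡ i → ∀ x y → span (θ h) x y ≈ A i x y
        span-A h ≡.refl x y = sym (A≋span h x y)
        toℕ-two : toℕ two ≡ 2
        toℕ-two = toℕ-index (ℕₚ.<⇒≤ 3≤D)
        distinct : ∀ {i j} → i ≤ D → j ≤ D → u i ≈ u j → i ≡ j
        distinct {i} {j} i≤D j≤D h with ∃-at-distance i i≤D | ∃-at-distance j j≤D
        ... | x , y , ≡.refl | x′ , y′ , ≡.refl = E-one-injective x y x′ y′
          (trans (E≈u x y) (trans h (sym (E≈u x′ y′))))
        eigen′ : ∀ x v → sumIf (λ z → d x z ≡ᵇ 1) (λ z → u (d z v)) ≈ θ one one * u (d x v)
        eigen′ x v = begin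
          sumIf (λ z → d x z ≡ᵇ 1) (λ z → u (d z v))
            ≈⟨ sumFin-cong (λ z → sym (if-* (d x z ≡ᵇ 1) (u (d z v)))) ⟩
          sumFin (λ z → A 1 x z * u (d z v))
            ≈⟨ sumFin-cong (λ z → *-cong (trans (sym (span-A one toℕ-one x z)) (sym (A≋span one x z))) (sym (E≈u z v))) ⟩
          sumFin (λ z → A (toℕ one) x z * E one z v)
            ≈⟨ KreinTheory.Spectral.eigen F G conn D k dr ab 3≤D val girth E ord spectrum one one x v ⟩
          θ one one * E one x v
            ≈⟨ *-congˡ (E≈u x v) ⟩
          θ one one * u (d x v) ∎
        part : ∀ x y v h h′ {i j} → toℕ h ≡ i → toℕ h′ ≡ j →
          sumFin (λ z → span (θ h) x z * E one v z * span (θ h′) z y) ≈ sumIf (sphere² x y i j) (λ z → u (d z v))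
        part x y v h h′ {i} {j} e e′ = trans
          (sumFin-cong (λ z → *-cong (*-cong (span-A h e x z) (E≈u′ v z)) (span-A h′ e′ z y)))
          (sphere²-sum x y i j (λ z → u (d z v)))
        balanced′ : ∀ x y v → d x y ≡ 3 →
          sumIf (sphere² x y 1 2) (λ z → u (d z v)) + - sumIf (sphere² x y 2 1) (λ z → u (d z v))
            ≈ γ * (u (d x v) + - u (d y v))
        balanced′ x y v e = begin
          sumIf (sphere² x y 1 2) (λ z → u (d z v)) + - sumIf (sphere² x y 2 1) (λ z → u (d z v))
            ≈⟨ +-cong (part x y v one two toℕ-one toℕ-two) (-‿cong (part x y v two one toℕ-two toℕ-one)) ⟨
          _ ≈⟨ Consequences.balanced spectrum q krein q≉0 q≈0 (θ one) (θ two) x v y ⟩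
          commutator (θ one) (θ two) x y * (E one v y + - E one v x)
            ≈⟨ *-cong (trans (radial-at (commutator-radial (θ one) (θ two)) x y)
                 (reflexive (≡.cong (commutator (θ one) (θ two) at_) e)))
                 (+-cong (E≈u′ v y) (-‿cong (E≈u′ v x))) ⟩
          commutator (θ one) (θ two) at 3 * (u (d y v) + - u (d x v))
            ≈⟨ solve 3 (λ m a b → m ⊗ (a :- b) ⊜ (⊝ m) ⊗ (b :- a)) refl _ _ _ ⟩
          γ * (u (d x v) + - u (d y v)) ∎

-- Configurations around two vertices at distance 3.

module LocalCounting where
  open GraphMetric
  open Counting
  open AlmostBipartite
  open import Data.Bool using (Bool; true; _∧_; not)
  open import Data.Nat as ℕ using (ℕ; suc; _≤_; _<_; _≡ᵇ_; z≤n; s≤s; _+_; _*_; _∸_)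
  import Data.Nat.Properties as ℕₚ
  open import Data.Integer as ℤ using (+_)
  open import Data.Product using (_×_; _,_; proj₁; proj₂; ∃)
  open import Data.Sum using (_⊎_; inj₁; inj₂)
  open import Data.Bool.Properties using (∧-comm)
  open import Relation.Nullary using (contradiction)
  open import Relation.Binary.PropositionalEquality using (_≡_; _≢_; refl; sym; trans; cong; cong₂; subst; subst₂; module ≡-Reasoning)

  module LocalCounts (G : Graph) (conn : Connected G) (D k : ℕ)
    (dr : DistanceRegular G D) (ab : AlmostBipartite G D) (3≤D : 3 ≤ D) (val : Valency G k) (girth : Girth G 6)
    (3≤k : 3 ≤ k) where

    open AlmostBipartiteGraph G conn D k dr ab 3≤D val girth public

    opaque
      c₃ : ℕ
      c₃ = # (sphere² (proj₁ (∃-at-distance 3 3≤D)) (proj₁ (proj₂ (∃-at-distance 3 3≤D))) 1 2)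

      #P : ∀ {x y} → d x y ≡ 3 → # (sphere² x y 1 2) ≡ c₃
      #P {x} {y} e = #sphere²-const x y _ _ 1 2 (trans e (sym (proj₂ (proj₂ (∃-at-distance 3 3≤D)))))

    #Q : ∀ {x y} → d x y ≡ 3 → # (sphere² x y 2 1) ≡ c₃
    #Q {x} {y} e = trans (#sphere²-sym x y 2 1) (#P e)

    c₃≥2 : 2 ≤ c₃
    c₃≥2 with ∃-at-distance 3 3≤D
    ... | x , y , e = subst (2 ≤_) (#P e) (2≤c₃ e)

    d-flip : ∀ {x y i} → d x y ≡ i → d y x ≡ i
    d-flip {x} {y} e = trans (d-sym y x) e

    d≢ : ∀ {x y i j} v → d x v ≡ i → d y v ≡ j → i ≢ j → x ≢ y
    d≢ v e e′ i≢j refl = i≢j (trans (sym e) e′)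

    -- The neighbour of x at distance `nxt 3`, at least 3, from y is not counted by c₃.
    c₃<k : c₃ < k
    c₃<k with ∃-at-distance 3 3≤D
    ... | x , y , e with ∃-nxt x y
    ...   | z , xz , zy = subst₂ ℕ._≤_ (ℕₚ.+-comm _ 1) (trans (sym (#-split (λ z → d x z ≡ᵇ 1) (λ z → d y z ≡ᵇ 2))) (#neighbours x))
      (ℕₚ.+-mono-≤ (ℕₚ.≤-reflexive (sym (#P e)))
        (#≥1 (λ z → (d x z ≡ᵇ 1) ∧ not (d y z ≡ᵇ 2)) (∧-true⁺ (≡ᵇ-true⁺ xz) (cong not (≡ᵇ-false⁺ z≁2)))))
      where
      z≁2 : d y z ≢ 2
      z≁2 yz = ℕₚ.<⇒≱ {2} {3} ℕₚ.≤-refl (ℕₚ.≤-trans (i≤nxt 3≤D) (ℕₚ.≤-reflexive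
        (trans (sym (trans zy (cong nxt e))) (d-flip yz))))

    -- As c₂ = 1, the edges between Γ(x) ∩ Γ₂(y) and Γ₂(x) ∩ Γ(y) form a perfect matching, in which
    -- w is matched to z.
    partner : ∀ {x y z} → d x y ≡ 3 → d x z ≡ 1 → d z y ≡ 2 → ∃ λ w → d z w ≡ 1 × d w y ≡ 1 × d x w ≡ 2
    partner {x} {y} {z} xy xz zy with ∃-prev zy
    ... | w , zw , wy = w , zw , wy , no-triangle xz zw (d≢ y xy wy (λ ()))

    partner-dist : ∀ {x z w} → d x z ≡ 1 → d x w ≡ 2 → d z w ≢ 1 → d z w ≡ 3
    partner-dist {x} {z} {w} xz xw ne with neighbour-distance w xz
    ... | inj₁ e = contradiction (ℕₚ.suc-injective (trans e xw)) ne
    ... | inj₂ e = trans e (trans (cong nxt xw) nxt-2)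

    far-neighbour : ∀ {y w v} → d w y ≡ 1 → d v y ≡ 3 → d w v ≡ 2 ⊎ d w v ≡ nxt 3
    far-neighbour {y} {w} {v} wy vy with neighbour-distance v (d-flip wy)
    ... | inj₁ e = inj₁ (ℕₚ.suc-injective (trans e (d-flip vy)))
    ... | inj₂ e = inj₂ (trans e (cong nxt (d-flip vy)))

    3≤nxt3 : 3 ≤ nxt 3
    3≤nxt3 = i≤nxt 3≤D

    ∃-third-neighbour : ∀ {x w} z → d x z ≡ 1 → d z w ≡ 1 → x ≢ w → ∃ λ v → d z v ≡ 1 × v ≢ x × v ≢ w
    ∃-third-neighbour {x} {w} z xz zw x≢w = v , ≡ᵇ-true⁻ (proj₁ v₂) , proj₂ v₂ , proj₂ v₁
      where
      N : X → Bool
      N v = d z v ≡ᵇ 1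
      N∖x : suc (# (N ∖ x)) ≡ k
      N∖x = trans (sym (#-∖ N (≡ᵇ-true⁺ (d-flip xz)))) (#neighbours z)
      N∖x∖w : suc (suc (# (N ∖ x ∖ w))) ≡ k
      N∖x∖w = trans (cong suc (sym (#-∖ (N ∖ x) (∖⁺ N (≡ᵇ-true⁺ zw) (λ e → x≢w (sym e)))))) N∖x
      some : ∃ λ v → (N ∖ x ∖ w) v ≡ true
      some = #≥1⇒∃ (N ∖ x ∖ w) (ℕ.s≤s⁻¹ (ℕ.s≤s⁻¹ (subst (3 ≤_) (sym N∖x∖w) 3≤k)))
      v = proj₁ some
      v₁ = ∖⁻ (N ∖ x) (proj₂ some)
      v₂ = ∖⁻ N (proj₁ v₁)

    -- x and v are two neighbours, both at distance 3 from y, of a vertex outside Γ₂(y). That vertex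
    -- is their only common neighbour, so v is adjacent to nothing in Γ(x) ∩ Γ₂(y).
    ∃-detached : suc (suc c₃) ≤ k → ∃ λ x → ∃ λ y → ∃ λ v →
      d x y ≡ 3 × d x v ≡ 2 × d v y ≡ 3 × (∀ z → d x z ≡ 1 → d z y ≡ 2 → d z v ≡ 3)
    ∃-detached h = result (two-neighbours (≤D-cases 3≤D))
      where
      two-neighbours : 3 < D ⊎ 3 ≡ D → ∃ λ z → ∃ λ y → ∃ λ x → ∃ λ v →
        d z y ≢ 2 × d z x ≡ 1 × d x y ≡ 3 × d z v ≡ 1 × d v y ≡ 3 × x ≢ v
      -- For D = 3, z itself is at distance 3 from y, and so are its k - c₃ ≥ 2 neighbours outside
      -- Γ₂(y).
      two-neighbours (inj₂ 3≡D) with ∃-at-distance 3 3≤D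
      ... | z , y , zy with #≥2⇒∃₂ (λ x → (d z x ≡ᵇ 1) ∧ not (d y x ≡ᵇ 2))
          (ℕₚ.+-cancelˡ-≤ c₃ 2 _ (ℕₚ.≤-trans (ℕₚ.≤-reflexive (ℕₚ.+-comm c₃ 2)) (ℕₚ.≤-trans h (ℕₚ.≤-reflexive
            (trans (sym (#neighbours z)) (trans (#-split (λ z′ → d z z′ ≡ᵇ 1) (λ z′ → d y z′ ≡ᵇ 2))
              (cong (_+ _) (#P zy))))))))
      ...   | x , v , hx , hv , x≢v = z , y , x , v , (λ e → contradiction (trans (sym zy) e) (λ ())) ,
              proj₁ (far x hx) , proj₂ (far x hx) , proj₁ (far v hv) , proj₂ (far v hv) , x≢v
        where
        far : ∀ x → (d z x ≡ᵇ 1) ∧ not (d y x ≡ᵇ 2) ≡ true → d z x ≡ 1 × d x y ≡ 3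
        far x hx with ∧-true⁻ {d z x ≡ᵇ 1} hx
        ... | zx , ne with neighbour-distance y (≡ᵇ-true⁻ {d z x} zx)
        ...   | inj₁ e = contradiction (trans (sym ne) (cong not (≡ᵇ-true⁺ (d-flip (ℕₚ.suc-injective (trans e zy)))))) true≢false
        ...   | inj₂ e = ≡ᵇ-true⁻ {d z x} zx , trans e (trans (cong nxt (trans zy 3≡D)) (trans nxt-D (sym 3≡D)))
      -- For D > 3, z is at distance 4 from y, and the at least two neighbours of z on geodesics to
      -- a vertex y′ between them are at distance 3 from y.
      two-neighbours (inj₁ 3<D) with ∃-at-distance 4 3<D
      ... | y , z , yz with d-suc⇒∃ (d-flip yz)
      ...   | y′ , zy′ , y′y , _ with #≥2⇒∃₂ (sphere² z y′ 1 2) (2≤c₃ zy′)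
      ...     | x , v , hx , hv , x≢v = z , y , x , v , (λ e → contradiction (trans (sym (d-flip yz)) e) (λ ())) ,
              proj₁ (near x hx) , proj₂ (near x hx) , proj₁ (near v hv) , proj₂ (near v hv) , x≢v
        where
        near : ∀ x → sphere² z y′ 1 2 x ≡ true → d z x ≡ 1 × d x y ≡ 3
        near x hx with sphere²⁻ {z} {y′} {1} {2} hx
        ... | zx , xy′ = zx , ℕₚ.≤-antisym
          (ℕₚ.≤-trans (d-triangle x y′ y) (ℕₚ.≤-reflexive (cong₂ ℕ._+_ xy′ y′y)))
          (ℕ.s≤s⁻¹ (ℕₚ.≤-trans (ℕₚ.≤-reflexive (sym (d-flip yz))) (d-adj-≤ y (d-flip zx))))
      result : _ → ∃ λ x → ∃ λ y → ∃ λ v →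
        d x y ≡ 3 × d x v ≡ 2 × d v y ≡ 3 × (∀ z → d x z ≡ 1 → d z y ≡ 2 → d z v ≡ 3)
      result (z , y , x , v , zy , zx , xy , zv , vy , x≢v) = x , y , v , xy , xv , vy , λ z′ xz′ z′y →
        partner-dist xz′ xv (λ z′v → zy (trans (cong (λ p → d p y)
          (common-neighbour-unique xv (d-flip zx) zv xz′ z′v)) z′y))
        where
        xv : d x v ≡ 2
        xv = no-triangle (d-flip zx) zv x≢v

    -- Edges between consecutive spheres are counted from both sides, with b₁ = b₂ = k - 1 and c₂ =
    -- 1; l is the size of a sphere of radius 3. The divisibility by c₃ is what decides the case D =
    -- 3.
    sphere₃-count : ∃ λ l → c₃ * l ≡ k * ((k ∸ 1) * (k ∸ 1))
    sphere₃-count = # (S 3) , (begin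
      c₃ * # (S 3)                     ≡⟨ ℕₚ.*-comm c₃ _ ⟩
      # (S 3) * c₃                     ≡⟨ double-count (S 2) (S 3) _~_ (k ∸ 1) c₃ (outer 1 (s≤s (s≤s z≤n)) unique₂) inner₃ ⟨
      # (S 2) * (k ∸ 1)              ≡⟨ cong (_* (k ∸ 1)) (ℕₚ.*-identityʳ (# (S 2))) ⟨
      # (S 2) * 1 * (k ∸ 1)        ≡⟨ cong (_* (k ∸ 1)) (double-count (S 1) (S 2) _~_ (k ∸ 1) 1 (outer 0 (s≤s z≤n) unique₁) inner₂) ⟨
      # (S 1) * (k ∸ 1) * (k ∸ 1)  ≡⟨ cong (λ j → j * (k ∸ 1) * (k ∸ 1)) (#neighbours x₁) ⟩
      k * (k ∸ 1) * (k ∸ 1)      ≡⟨ ℕₚ.*-assoc k _ _ ⟩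
      k * ((k ∸ 1) * (k ∸ 1)) ∎)
      where
      open ≡-Reasoning
      x₁ : X
      x₁ = proj₁ (∃-at-distance 0 z≤n)
      S : ℕ → X → Bool
      S i y = d x₁ y ≡ᵇ i
      _~_ : X → X → Bool
      y ~ z = d y z ≡ᵇ 1
      unique₁ : ∀ {y z w} → d y x₁ ≡ 1 → d y z ≡ 1 → d z x₁ ≡ 0 → d y w ≡ 1 → d w x₁ ≡ 0 → z ≡ w
      unique₁ _ _ zx _ wx = trans (d≡0⇒≡ zx) (sym (d≡0⇒≡ wx))
      unique₂ : ∀ {y z w} → d y x₁ ≡ 2 → d y z ≡ 1 → d z x₁ ≡ 1 → d y w ≡ 1 → d w x₁ ≡ 1 → z ≡ w
      unique₂ = common-neighbour-unique
      outer : ∀ i → suc i ≤ 2 → (∀ {y z w} → d y x₁ ≡ suc i → d y z ≡ 1 → d z x₁ ≡ i → d y w ≡ 1 → d w x₁ ≡ i → z ≡ w) →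
        ∀ y → S (suc i) y ≡ true → # (λ z → S (suc (suc i)) z ∧ (y ~ z)) ≡ k ∸ 1
      outer i le unique y hy with d-flip (≡ᵇ-true⁻ {d x₁ y} hy)
      ... | yx with ∃-prev yx
      ...   | w , yw , wx = cong ℕ.pred (trans (ℕₚ.+-comm 1 _) (trans
          (cong₂ ℕ._+_ (#-cong (λ z → ∧-comm (S (suc (suc i)) z) (y ~ z)))
            (sym (#-only (λ z → (y ~ z) ∧ not (S (suc (suc i)) z)) w
              (∧-true⁺ (≡ᵇ-true⁺ yw) (cong not (≡ᵇ-false⁺ (λ e → i≢i+2 (trans (sym wx) (d-flip e))))))
              only)))
          (trans (sym (#-split (y ~_) (S (suc (suc i))))) (#neighbours y))))
        where
        i≢i+2 : i ≢ suc (suc i)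
        i≢i+2 ()
        only : ∀ z → (y ~ z) ∧ not (S (suc (suc i)) z) ≡ true → z ≡ w
        only z hz with ∧-true⁻ {y ~ z} hz
        ... | yz , ne with neighbour-distance x₁ (≡ᵇ-true⁻ {d y z} yz)
        ...   | inj₁ e = unique yx (≡ᵇ-true⁻ {d y z} yz) (ℕₚ.suc-injective (trans e yx)) yw wx
        ...   | inj₂ e = contradiction (trans (sym ne) (cong not (≡ᵇ-true⁺ (d-flip
          (trans e (trans (cong nxt yx) (nxt-< (ℕₚ.≤-trans (s≤s le) 3≤D)))))))) true≢false
      inner₂ : ∀ z → S 2 z ≡ true → # (λ y → S 1 y ∧ (y ~ z)) ≡ 1
      inner₂ z hz with ≡ᵇ-true⁻ {d x₁ z} hz
      ... | xz with ∃-prev xz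
      ...   | w , xw , wz = #-only (λ y → S 1 y ∧ (y ~ z)) w (∧-true⁺ (≡ᵇ-true⁺ xw) (≡ᵇ-true⁺ wz))
        (λ y hy → common-neighbour-unique xz (≡ᵇ-true⁻ {d x₁ y} (proj₁ (∧-true⁻ {S 1 y} hy))) (≡ᵇ-true⁻ {d y z} (proj₂ (∧-true⁻ {S 1 y} hy))) xw wz)
      inner₃ : ∀ z → S 3 z ≡ true → # (λ y → S 2 y ∧ (y ~ z)) ≡ c₃
      inner₃ z hz = trans (#-cong (λ y → cong (λ e → S 2 y ∧ (e ≡ᵇ 1)) (d-sym y z))) (#Q (≡ᵇ-true⁻ {d x₁ z} hz))

-- Balanced set and eigenvalue equations at chosen vertices.

module DistanceEquations where
  open Summation
  open FieldTools
  open GraphMetric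
  open Counting
  open AlmostBipartite
  open BoseMesnerAlgebra
  open BalancedSequenceConstruction
  open LocalCounting
  open import Data.Bool using (Bool; true; false; _∧_; if_then_else_)
  open import Data.Nat as ℕ using (ℕ; zero; suc; _≤_; _≡ᵇ_; z≤n; s≤s)
  import Data.Nat.Properties as ℕₚ
  open import Data.Integer as ℤ using (+_)
  open import Data.Fin using (_≟_)
  open import Data.Product using (_×_; _,_; proj₁; proj₂; ∃)
  open import Data.Sum using (inj₁; inj₂)
  open import Relation.Nullary using (does; contradiction)
  open import Relation.Nullary.Decidable using (dec-true)
  open import Relation.Binary.PropositionalEquality as ≡ using (_≡_; _≢_)
  open import Tactic.RingSolver.Core.Expression using (_⊕_)

  module Equations {c ℓ} (F : CharZeroField c ℓ) (G : Graph) (conn : Connected G) (D k : ℕ)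
    (dr : DistanceRegular G D) (ab : AlmostBipartite G D) (3≤D : 3 ≤ D) (val : Valency G k) (girth : Girth G 6)
    (3≤k : 3 ≤ k) (B : BalancedSequences.BalancedSequence F G conn D k dr ab 3≤D val girth) where

    open LocalCounts G conn D k dr ab 3≤D val girth 3≤k
    open Field F
    open BoseMesner F G conn D k dr ab 3≤D val girth using (ι-#)
    open BalancedSequences F G conn D k dr ab 3≤D val girth using (module BalancedSequence; if-*)
    open BalancedSequence B

    sumIf-one : ∀ (P : X → Bool) → sumIf P (λ _ → 1#) ≈ ι (# P)
    sumIf-one P = sym (ι-# P)

    sumIf-const : ∀ (P : X → Bool) {f a} → (∀ z → P z ≡ true → f z ≈ a) → sumIf P f ≈ ι (# P) * a
    sumIf-const P {f} {a} h = begin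
      sumIf P f                                     ≈⟨ sumIf-cong P h ⟩
      sumIf P (λ _ → a)                             ≈⟨ sumFin-cong (λ z → sym (if-* (P z) a)) ⟩
      sumFin (λ z → (if P z then 1# else 0#) * a)   ≈⟨ *-distribʳ-sumFin a _ ⟨
      sumIf P (λ _ → 1#) * a                        ≈⟨ *-congʳ (sumIf-one P) ⟩
      ι (# P) * a ∎

    sumIf-two-valued : ∀ (P R : X → Bool) {f a b} → (∀ z → P z ≡ true → R z ≡ true → f z ≈ a) →
      (∀ z → P z ≡ true → R z ≡ false → f z ≈ b) →
      sumIf P f ≈ ι (# P) * b + ι (# (λ z → P z ∧ R z)) * (a + - b)
    sumIf-two-valued P R {f} {a} {b} hₐ hᵇ = begin
      sumIf P f
        ≈⟨ sumFin-cong (λ z → split (P z) (R z) (hₐ z) (hᵇ z)) ⟩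
      sumFin (λ z → (if P z then b else 0#) + (if P z ∧ R z then a + - b else 0#))
        ≈⟨ sumFin-+ _ _ ⟩
      sumIf P (λ _ → b) + sumIf (λ z → P z ∧ R z) (λ _ → a + - b)
        ≈⟨ +-cong (sumIf-const P (λ _ _ → refl)) (sumIf-const (λ z → P z ∧ R z) (λ _ _ → refl)) ⟩
      ι (# P) * b + ι (# (λ z → P z ∧ R z)) * (a + - b) ∎
      where
      split : ∀ p r {e} → (p ≡ true → r ≡ true → e ≈ a) → (p ≡ true → r ≡ false → e ≈ b) →
        (if p then e else 0#) ≈ (if p then b else 0#) + (if p ∧ r then a + - b else 0#)
      split true  true  h _ = trans (h ≡.refl ≡.refl) (solve 2 (λ a b → a ⊜ b ⊕ (a :- b)) refl a b)
      split true  false _ h = trans (h ≡.refl ≡.refl) (sym (+-identityʳ b))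
      split false r     _ _ = sym (+-identityˡ 0#)

    sumIf-exceptional : ∀ (P R : X → Bool) {f a b} w → P w ≡ true → R w ≡ true →
      (∀ z → P z ≡ true → R z ≡ true → z ≡ w) → f w ≈ a →
      (∀ z → P z ≡ true → R z ≡ false → f z ≈ b) →
      sumIf P f ≈ ι (# P) * b + (a + - b)
    sumIf-exceptional P R {f} {a} {b} w Pw Rw only fw rest = begin
      sumIf P f
        ≈⟨ sumIf-two-valued P R (λ z p r → trans (reflexive (≡.cong f (only z p r))) fw) rest ⟩
      ι (# P) * b + ι (# (λ z → P z ∧ R z)) * (a + - b)
        ≡⟨ ≡.cong (λ m → ι (# P) * b + ι m * (a + - b)) (#-only (λ z → P z ∧ R z) w (∧-true⁺ Pw Rw)
             (λ z h → only z (proj₁ (∧-true⁻ {P z} h)) (proj₂ (∧-true⁻ {P z} h)))) ⟩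
      ι (# P) * b + ι 1 * (a + - b)
        ≈⟨ +-congˡ (trans (*-congʳ ι-1) (*-identityˡ _)) ⟩
      ι (# P) * b + (a + - b) ∎

    C K : Carrier
    C = ι c₃
    K = ι k

    u-at : ∀ {x y i} → d x y ≡ i → u (d x y) ≈ u i
    u-at e = reflexive (≡.cong u e)

    balanced-eval : ∀ {x y v S₁ S₂ i j} → d x y ≡ 3 → d x v ≡ i → d y v ≡ j →
      sumIf (sphere² x y 1 2) (λ z → u (d z v)) ≈ S₁ → sumIf (sphere² x y 2 1) (λ z → u (d z v)) ≈ S₂ →
      S₁ + - S₂ ≈ γ * (u i + - u j)
    balanced-eval {x} {y} {v} xy xv yv h₁ h₂ = trans (+-cong (sym h₁) (-‿cong (sym h₂)))
      (trans (balanced x y v xy) (*-congˡ (+-cong (u-at xv) (-‿cong (u-at yv)))))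

    module _ {x y v : X} (xy : d x y ≡ 3) where
      P-const : ∀ {i} → (∀ z → d x z ≡ 1 → d z y ≡ 2 → d z v ≡ i) →
        sumIf (sphere² x y 1 2) (λ z → u (d z v)) ≈ C * u i
      P-const h = trans (sumIf-const (sphere² x y 1 2) (λ z p → u-at (h z (proj₁ (sphere²⁻ {x} {y} {1} {2} p)) (proj₂ (sphere²⁻ {x} {y} {1} {2} p)))))
        (*-congʳ (reflexive (≡.cong ι (#P xy))))

      Q-const : ∀ {i} → (∀ w → d x w ≡ 2 → d w y ≡ 1 → d w v ≡ i) →
        sumIf (sphere² x y 2 1) (λ z → u (d z v)) ≈ C * u i
      Q-const h = trans (sumIf-const (sphere² x y 2 1) (λ z p → u-at (h z (proj₁ (sphere²⁻ {x} {y} {2} {1} p)) (proj₂ (sphere²⁻ {x} {y} {2} {1} p)))))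
        (*-congʳ (reflexive (≡.cong ι (#Q xy))))

      P-exceptional : ∀ {i j} z → d x z ≡ 1 → d z y ≡ 2 → d z v ≡ i →
        (∀ z′ → d x z′ ≡ 1 → d z′ y ≡ 2 → z′ ≢ z → d z′ v ≡ j) →
        sumIf (sphere² x y 1 2) (λ z → u (d z v)) ≈ C * u j + (u i + - u j)
      P-exceptional z xz zy zv h = trans
        (sumIf-exceptional (sphere² x y 1 2) (λ z′ → does (z′ ≟ z)) z (sphere²⁺ xz zy) (dec-true (z ≟ z) ≡.refl)
          (λ z′ _ e → does-≟⁻ e) (u-at zv)
          (λ z′ p e → u-at (h z′ (proj₁ (sphere²⁻ {x} {y} {1} {2} p)) (proj₂ (sphere²⁻ {x} {y} {1} {2} p))
            (λ z′≡z → true≢false (≡.trans (≡.sym (dec-true (z′ ≟ z) z′≡z)) e)))))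
        (+-congʳ (*-congʳ (reflexive (≡.cong ι (#P xy)))))

      -- When v is at distance 3 from y, the other vertices of Γ₂(x) ∩ Γ(y) are at distance `nxt 3`
      -- from v, so the sum over that set depends on this cardinality alone. φ is a difference of
      -- two such cardinalities.
      Q-split : ℕ
      Q-split = # (λ w → sphere² x y 2 1 w ∧ (d w v ≡ᵇ 2))

      Q-two-valued : d v y ≡ 3 →
        sumIf (sphere² x y 2 1) (λ z → u (d z v)) ≈ C * u (nxt 3) + ι Q-split * (u 2 + - u (nxt 3))
      Q-two-valued vy = trans
        (sumIf-two-valued (sphere² x y 2 1) (λ w → d w v ≡ᵇ 2) (λ w _ e → u-at (≡ᵇ-true⁻ e))
          (λ w p e → u-at (far w (proj₂ (sphere²⁻ {x} {y} {2} {1} p)) e)))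
        (+-congʳ (*-congʳ (reflexive (≡.cong ι (#Q xy)))))
        where
        far : ∀ w → d w y ≡ 1 → (d w v ≡ᵇ 2) ≡ false → d w v ≡ nxt 3
        far w wy e with far-neighbour wy vy
        ... | inj₁ wv = contradiction (≡.trans (≡.sym (≡ᵇ-true⁺ wv)) e) true≢false
        ... | inj₂ wv = wv

    -- The path x, z₀, w₀, y has distances i, i + 1, i + 2, `nxt (i + 2)` from v. Since y is at
    -- least i + 2 away from v, every geodesic from x to y shows the same distances, and both sums
    -- are constant.
    recurrence : ∀ i → suc (suc i) ≤ D → C * u (suc i) + - (C * u (suc (suc i))) ≈ γ * (u i + - u (nxt (suc (suc i))))
    recurrence i i+2≤D with ∃-at-distance (suc (suc i)) i+2≤D
    ... | w₀ , v , w₀v with ∃-nxt w₀ v | ∃-prev w₀v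
    ...   | y , w₀y , yv | z₀ , w₀z₀ , z₀v with ∃-prev z₀v
    ...     | x , z₀x , xv = balanced-eval xy xv yv′ (P-const xy onP) (Q-const xy onQ)
      where
      yv′ : d y v ≡ nxt (suc (suc i))
      yv′ = ≡.trans yv (≡.cong nxt w₀v)
      i+2≤yv : suc (suc i) ≤ d y v
      i+2≤yv = ≡.subst (suc (suc i) ≤_) (≡.sym yv′) (i≤nxt i+2≤D)
      xy : d x y ≡ 3
      xy = geodesic₃ (d-flip z₀x) (d-flip w₀z₀) w₀y
        (d≢ v xv w₀v (λ ()))
        (λ { ≡.refl → ℕₚ.<⇒≱ {suc i} ℕₚ.≤-refl (≡.subst (suc (suc i) ≤_) z₀v i+2≤yv) })
      onP : ∀ z → d x z ≡ 1 → d z y ≡ 2 → d z v ≡ suc i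
      onP z xz zy with neighbour-distance v xz
      ... | inj₂ e = ≡.trans e (≡.trans (≡.cong nxt xv) (nxt-< (ℕₚ.<-trans (ℕₚ.n<1+n i) i+2≤D)))
      ... | inj₁ e = contradiction
        (ℕₚ.≤-trans i+2≤yv (ℕₚ.≤-trans (d-triangle y z v)
          (ℕₚ.≤-reflexive (≡.trans (≡.cong (ℕ._+ d z v) (d-flip zy)) (≡.cong suc (≡.trans e xv))))))
        (ℕₚ.<⇒≱ {suc i} ℕₚ.≤-refl)
      onQ : ∀ w → d x w ≡ 2 → d w y ≡ 1 → d w v ≡ suc (suc i)
      onQ w xw wy with ∃-prev xw
      ... | z , xz , zw with neighbour-distance v zw
      ...   | inj₂ e = ≡.trans e (≡.trans (≡.cong nxt (onP z xz zy)) (nxt-< i+2≤D))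
        where
        zy : d z y ≡ 2
        zy = no-triangle zw wy (λ { ≡.refl → contradiction (≡.trans (≡.sym xy) xz) (λ ()) })
      ...   | inj₁ e = contradiction (ℕₚ.≤-trans i+2≤yv (d-adj-≤ v wy))
        (ℕₚ.<⇒≱ (s≤s (ℕₚ.≤-reflexive (≡.trans e (onP z xz zy)))))
        where
        zy : d z y ≡ 2
        zy = no-triangle zw wy (λ { ≡.refl → contradiction (≡.trans (≡.sym xy) xz) (λ ()) })

    -- Here v is a vertex z of Γ(x) ∩ Γ₂(y). Each sum has one exceptional term, at z itself and at
    -- its partner.
    eq-S : (C * u 2 + (u 0 + - u 2)) + - (C * u 3 + (u 1 + - u 3)) ≈ γ * (u 1 + - u 2)
    eq-S with ∃-at-distance 3 3≤D
    ... | x , y , xy with ∃-prev xy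
    ...   | z , xz , zy with partner xy xz zy
    ...     | w , zw , wy , xw = balanced-eval xy xz (d-flip zy)
      (P-exceptional xy z xz zy (d-refl z) (λ z′ xz′ _ z′≢z → no-triangle (d-flip xz′) xz z′≢z))
      (trans (sumIf-exceptional (sphere² x y 2 1) (λ w′ → d z w′ ≡ᵇ 1) w (sphere²⁺ xw wy) (≡ᵇ-true⁺ zw)
        (λ w′ p e → common-neighbour-unique zy (≡ᵇ-true⁻ e) (proj₂ (sphere²⁻ {x} {y} {2} {1} p)) zw wy)
        (u-at (d-flip zw))
        (λ w′ p e → u-at (d-flip (partner-dist xz (proj₁ (sphere²⁻ {x} {y} {2} {1} p))
          (λ zw′ → true≢false (≡.trans (≡.sym (≡ᵇ-true⁺ zw′)) e))))))
        (+-congʳ (*-congʳ (reflexive (≡.cong ι (#Q xy))))))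

    -- v is a third neighbour of some z in Γ(x) ∩ Γ₂(y), besides x and the partner w of z; it exists
    -- because k ≥ 3. By c₂ = 1 it is adjacent to no other vertex of that set, and w accounts for 1
    -- ≤ e.
    eq-attached : ∃ λ e → 1 ≤ e × (C * u 3 + (u 1 + - u 3)) + - (C * u (nxt 3) + ι e * (u 2 + - u (nxt 3))) ≈ γ * (u 2 + - u 3)
    eq-attached with ∃-at-distance 3 3≤D
    ... | x , y , xy with ∃-prev xy
    ...   | z , xz , zy with partner xy xz zy
    ...     | w , zw , wy , xw with ∃-third-neighbour z xz zw (d≢ y xy wy (λ ()))
    ...       | v , zv , v≢x , v≢w = Q-split {x} {y} {v} xy ,
      #≥1 (λ w → sphere² x y 2 1 w ∧ (d w v ≡ᵇ 2)) (∧-true⁺ (sphere²⁺ xw wy) (≡ᵇ-true⁺ (no-triangle (d-flip zw) zv (λ e → v≢w (≡.sym e))))) ,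
      balanced-eval xy xv (d-flip vy)
        (P-exceptional xy z xz zy zv (λ z′ xz′ _ z′≢z → partner-dist xz′ xv
          (λ z′v → z′≢z (common-neighbour-unique xv xz′ z′v xz zv))))
        (Q-two-valued xy vy)
      where
      xv : d x v ≡ 2
      xv = no-triangle xz zv (λ e → v≢x (≡.sym e))
      vy : d v y ≡ 3
      vy with neighbour-distance y zv
      ... | inj₁ e = contradiction (common-neighbour-unique zy zv (ℕₚ.suc-injective (≡.trans e zy)) zw wy) v≢w
      ... | inj₂ e = ≡.trans e (≡.trans (≡.cong nxt zy) nxt-2)

    eq-detached : suc (suc c₃) ≤ k → ∃ λ e → C * u 3 + - (C * u (nxt 3) + ι e * (u 2 + - u (nxt 3))) ≈ γ * (u 2 + - u 3)
    eq-detached h with ∃-detached h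
    ... | x , y , v , xy , xv , vy , onP = Q-split {x} {y} {v} xy ,
      balanced-eval xy xv (d-flip vy) (P-const xy onP) (Q-two-valued xy vy)

    #N : ∀ x → ι (# (λ z → d x z ≡ᵇ 1)) ≈ K
    #N x = reflexive (≡.cong ι (#neighbours x))

    eq-eigen₀ : K * u 1 ≈ t * u 0
    eq-eigen₀ with ∃-at-distance 0 z≤n
    ... | x , v , xv = trans (sym (trans (sumIf-const (λ z → d x z ≡ᵇ 1)
        (λ z e → u-at (≡.trans (≡.cong (d z) (≡.sym (d≡0⇒≡ xv))) (d-flip (≡ᵇ-true⁻ e))))) (*-congʳ (#N x))))
      (trans (eigen x v) (*-congˡ (u-at xv)))

    -- The distances 1 and 2 are those where exactly one neighbour is closer and all others are one
    -- step farther.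
    eq-eigen : ∀ i → suc (suc i) ≤ 3 → K * u (suc (suc i)) + (u i + - u (suc (suc i))) ≈ t * u (suc i)
    eq-eigen i le with ∃-at-distance (suc i) (ℕₚ.≤-trans (ℕₚ.n≤1+n (suc i)) (ℕₚ.≤-trans le 3≤D))
    ... | x , v , xv with ∃-prev xv
    ...   | w , xw , wv = trans (sym (trans
        (sumIf-exceptional (λ z → d x z ≡ᵇ 1) (λ z → d z v ≡ᵇ i) w (≡ᵇ-true⁺ xw) (≡ᵇ-true⁺ wv)
          (λ z p r → unique i le xv z (≡ᵇ-true⁻ p) (≡ᵇ-true⁻ r) xw wv) (u-at wv)
          (λ z p r → u-at (far z (≡ᵇ-true⁻ p) (λ e → true≢false (≡.trans (≡.sym (≡ᵇ-true⁺ e)) r)))))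
        (+-congʳ (*-congʳ (#N x)))))
      (trans (eigen x v) (*-congˡ (u-at xv)))
      where
      unique : ∀ i → suc (suc i) ≤ 3 → d x v ≡ suc i → ∀ z {w} → d x z ≡ 1 → d z v ≡ i → d x w ≡ 1 → d w v ≡ i → z ≡ w
      unique zero _ _ z xz zv xw wv = ≡.trans (d≡0⇒≡ zv) (≡.sym (d≡0⇒≡ wv))
      unique (suc zero) _ xv z xz zv xw wv = common-neighbour-unique xv xz zv xw wv
      unique (suc (suc i)) (s≤s (s≤s (s≤s ()))) _ _ _ _ _ _
      far : ∀ z → d x z ≡ 1 → d z v ≢ i → d z v ≡ suc (suc i)
      far z xz ne with neighbour-distance v xz
      ... | inj₁ e = contradiction (ℕₚ.suc-injective (≡.trans e xv)) ne
      ... | inj₂ e = ≡.trans e (≡.trans (≡.cong nxt xv) (nxt-< (ℕₚ.≤-trans le 3≤D)))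

-- Elimination of the unknown values, leaving k, c₃ and φ.

module EliminationOfUnknowns where
  open Summation
  open FieldTools
  open GraphMetric
  open AlmostBipartite
  open BalancedSequenceConstruction
  open LocalCounting
  open DistanceEquations
  open import Data.Bool using (Bool; true; false; if_then_else_)
  open import Data.Nat as ℕ using (ℕ; suc; _≤_; _<_; s≤s)
  import Data.Nat.Properties as ℕₚ
  open import Data.Integer as ℤ using (+_)
  open import Data.Product using (_×_; _,_; proj₁; proj₂; ∃)
  open import Relation.Nullary using (¬_; contradiction)
  open import Relation.Binary.PropositionalEquality as ≡ using (_≡_; _≢_)
  open import Tactic.RingSolver.Core.Expression using (Κ; _⊕_; _⊗_; ⊝_)

  module NormalisedSequence {c ℓ} (F : CharZeroField c ℓ) (G : Graph) (conn : Connected G) (D k : ℕ)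
    (dr : DistanceRegular G D) (ab : AlmostBipartite G D) (3≤D : 3 ≤ D) (val : Valency G k) (girth : Girth G 6) where

    open AlmostBipartiteGraph G conn D k dr ab 3≤D val girth
    open Field F
    open BalancedSequences F G conn D k dr ab 3≤D val girth
    open BalancedSequence

    -- The scale of u is free and u₁ ≠ u₂; fixing this difference removes one unknown.
    normalise : BalancedSequence → ∃ λ (B : BalancedSequence) → u B 1 + - u B 2 ≈ 1#
    normalise B = record
      { u = λ i → u B i * w ; t = t B ; γ = γ B
      ; distinct = λ i≤D j≤D e → distinct B i≤D j≤D (*-cancelˡ-≉0 w≉0 (trans (*-comm _ _) (trans e (*-comm _ _))))
      ; eigen = λ x v → trans (sumIf-*ʳ _ _) (trans (*-congʳ (eigen B x v)) (*-assoc _ _ _))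
      ; balanced = λ x y v e → trans (+-cong (sumIf-*ʳ _ _) (-‿cong (sumIf-*ʳ _ _)))
          (trans (solve 3 (λ p q r → p ⊗ r :- q ⊗ r ⊜ (p :- q) ⊗ r) refl _ _ _)
            (trans (*-congʳ (balanced B x y v e))
              (solve 4 (λ m p q r → m ⊗ (p :- q) ⊗ r ⊜ m ⊗ (p ⊗ r :- q ⊗ r)) refl _ _ _ _)))
      } , trans (solve 3 (λ p q r → p ⊗ r :- q ⊗ r ⊜ (p :- q) ⊗ r) refl _ _ _) (proj₂ inverse)
      where
      u₁≉u₂ : ¬ u B 1 + - u B 2 ≈ 0#
      u₁≉u₂ e = contradiction (distinct B (ℕₚ.<⇒≤ 1<D) (ℕₚ.<⇒≤ 3≤D) (x∙y⁻¹≈ε⇒x≈y _ _ e)) (λ ())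
      inverse = inv _ u₁≉u₂
      w = proj₁ inverse
      w≉0 : ¬ w ≈ 0#
      w≉0 e = 1≉0 (trans (sym (proj₂ inverse)) (trans (*-congˡ e) (zeroʳ _)))
      sumIf-*ʳ : ∀ (P : X → Bool) (f : X → Carrier) → sumIf P (λ z → f z * w) ≈ sumIf P f * w
      sumIf-*ʳ P f = trans (sumFin-cong (λ z → pointwise (P z) (f z))) (sym (*-distribʳ-sumFin w _))
        where
        pointwise : ∀ p a → (if p then a * w else 0#) ≈ (if p then a else 0#) * w
        pointwise true  a = refl
        pointwise false a = sym (zeroˡ w)

  module Elimination {c ℓ} (F : CharZeroField c ℓ) (G : Graph) (conn : Connected G) (D k : ℕ)
    (dr : DistanceRegular G D) (ab : AlmostBipartite G D) (3≤D : 3 ≤ D) (val : Valency G k) (girth : Girth G 6)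
    (3≤k : 3 ≤ k) (B : BalancedSequences.BalancedSequence F G conn D k dr ab 3≤D val girth) where

    open LocalCounts G conn D k dr ab 3≤D val girth 3≤k
    open Field F
    open Equations F G conn D k dr ab 3≤D val girth 3≤k B
    open BalancedSequences F G conn D k dr ab 3≤D val girth using (module BalancedSequence)
    open BalancedSequence B

    -- The value one step beyond distance 3, which is u 3 again when D = 3.
    u₄ : Carrier
    u₄ = u (nxt 3)

    -- With u₁ - u₂ = 1, the differences among u₀, ..., u₄ are polynomials in b and x: u₁ - u₃ = 1 +
    -- x, u₁ - u₄ = bx, and N will be u₄ - u₂.
    b x N : Carrier
    b = u 0 + - u 3
    x = u 2 + - u 3
    N = 1# + - (b * x)

    module _ (norm : u 1 + - u 2 ≈ 1#) {M h : ℕ} (k≡ : k ≡ suc (suc M)) (c₃≡ : c₃ ≡ suc (suc h)) where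
      -- m = k - 2 and e = c₃ - 1, without truncated subtraction.
      m e : Carrier
      m = ι M
      e = ι (suc h)

      K≈ : K ≈ 1# + (1# + m)
      K≈ = reflexive (≡.cong ι k≡)

      C≈ : C ≈ 1# + e
      C≈ = reflexive (≡.cong ι c₃≡)

      C≉0 : ¬ C ≈ 0#
      C≉0 C≈0 = char0 (suc h) (trans (sym (reflexive (≡.cong ι c₃≡))) C≈0)

      ≉-distinct : ∀ {i j} → i ≤ D → j ≤ D → i ≢ j → ¬ u i + - u j ≈ 0#
      ≉-distinct i≤D j≤D i≢j e = i≢j (distinct i≤D j≤D (x∙y⁻¹≈ε⇒x≈y _ _ e))

      C≈γb : C ≈ γ * b
      C≈γb = by-linear₂ 1# (- C) recurrence₀ norm
        (solve 6 (λ c g u₀ u₁ u₂ u₃ → c ⊜ g ⊗ (u₀ :- u₃) ⊕ :1 ⊗ (c ⊗ u₁ :- c ⊗ u₂ :- g ⊗ (u₀ :- u₃)) ⊕ (⊝ c) ⊗ (u₁ :- u₂ :- :1))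
          refl C γ (u 0) (u 1) (u 2) (u 3))
        where
        recurrence₀ : C * u 1 + - (C * u 2) ≈ γ * (u 0 + - u 3)
        recurrence₀ = trans (recurrence 0 (ℕₚ.<⇒≤ 3≤D)) (*-congˡ (+-congˡ (-‿cong (reflexive (≡.cong u nxt-2)))))

      γ≉0 : ¬ γ ≈ 0#
      γ≉0 γ≈0 = C≉0 (trans C≈γb (trans (*-congʳ γ≈0) (zeroˡ _)))

      u₁-u₄ : u 1 + - u₄ ≈ b * x
      u₁-u₄ = *-cancelˡ-≉0 γ≉0 (by-linear₂ (- 1#) x (recurrence 1 3≤D) C≈γb
        (solve 7 (λ c g b u₁ u₂ u₃ u₄ → g ⊗ (u₁ :- u₄) ⊜ g ⊗ (b ⊗ (u₂ :- u₃)) ⊕ (⊝ :1) ⊗ (c ⊗ u₂ :- c ⊗ u₃ :- g ⊗ (u₁ :- u₄)) ⊕ (u₂ :- u₃) ⊗ (c :- g ⊗ b))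
          refl C γ b (u 1) (u 2) (u 3) u₄))

      γ≈ : γ ≈ C * x + b + - 1# + - (x + x)
      γ≈ = by-linear₂ (- 1#) (- (1# + γ)) eq-S norm
        (solve 6 (λ c g u₀ u₁ u₂ u₃ → g ⊜ c ⊗ (u₂ :- u₃) ⊕ (u₀ :- u₃) :- :1 :- ((u₂ :- u₃) ⊕ (u₂ :- u₃))
            ⊕ (⊝ :1) ⊗ ((c ⊗ u₂ ⊕ (u₀ :- u₂)) :- (c ⊗ u₃ ⊕ (u₁ :- u₃)) :- g ⊗ (u₁ :- u₂))
            ⊕ (⊝ (:1 ⊕ g)) ⊗ (u₁ :- u₂ :- :1))
          refl C γ (u 0) (u 1) (u 2) (u 3))

      t≈ : t ≈ K * x + b + - (x + x) + - 1#
      t≈ = by-linear₃ (- 1#) 1# (- (1# + t)) (eq-eigen 0 (ℕₚ.n≤1+n 2)) (eq-eigen 1 ℕₚ.≤-refl) norm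
        (solve 6 (λ k t u₀ u₁ u₂ u₃ → t ⊜ k ⊗ (u₂ :- u₃) ⊕ (u₀ :- u₃) :- ((u₂ :- u₃) ⊕ (u₂ :- u₃)) :- :1
            ⊕ (⊝ :1) ⊗ (k ⊗ u₂ ⊕ (u₀ :- u₂) :- t ⊗ u₁)
            ⊕ :1 ⊗ (k ⊗ u₃ ⊕ (u₁ :- u₃) :- t ⊗ u₂)
            ⊕ (⊝ (:1 ⊕ t)) ⊗ (u₁ :- u₂ :- :1))
          refl K t (u 0) (u 1) (u 2) (u 3))

      K-b+x : K + - (b + - x) ≈ t * (b + - x + - 1#)
      K-b+x = by-linear₃ 1# (- 1#) (- (K + t)) eq-eigen₀ (eq-eigen 0 (ℕₚ.n≤1+n 2)) norm
        (solve 6 (λ k t u₀ u₁ u₂ u₃ → k :- ((u₀ :- u₃) :- (u₂ :- u₃)) ⊜ t ⊗ ((u₀ :- u₃) :- (u₂ :- u₃) :- :1)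
            ⊕ :1 ⊗ (k ⊗ u₁ :- t ⊗ u₀)
            ⊕ (⊝ :1) ⊗ (k ⊗ u₂ ⊕ (u₀ :- u₂) :- t ⊗ u₁)
            ⊕ (⊝ (k ⊕ t)) ⊗ (u₁ :- u₂ :- :1))
          refl K t (u 0) (u 1) (u 2) (u 3))

      -- Eliminates γ between C = γb and the value of γ given by `eq-S`.
      eN : e * N ≈ b * b + - b + - (b * x) + - 1#
      eN = by-linear₃ (- N) 1# b C≈ C≈γb γ≈
        (solve 5 (λ c e g b x → e ⊗ (:1 :- b ⊗ x) ⊜ b ⊗ b :- b :- b ⊗ x :- :1
            ⊕ (⊝ (:1 :- b ⊗ x)) ⊗ (c :- (:1 ⊕ e)) ⊕ :1 ⊗ (c :- g ⊗ b) ⊕ b ⊗ (g :- (c ⊗ x ⊕ b :- :1 :- (x ⊕ x))))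
          refl C e γ b x)

      -- Eliminates t from the eigenvalue equations; `eN` absorbs the resulting quadratic in b.
      mN : m * (N + x * (1# + x)) ≈ e * N
      mN = by-linear₄ (- (1# + - (x * (b + - x + - 1#)))) 1# (b + - x + - 1#) (- 1#) K≈ K-b+x t≈ eN
        (solve 6 (λ k m t e b x → m ⊗ (:1 :- b ⊗ x ⊕ x ⊗ (:1 ⊕ x)) ⊜ e ⊗ (:1 :- b ⊗ x)
            ⊕ (⊝ (:1 :- x ⊗ (b :- x :- :1))) ⊗ (k :- (:1 ⊕ (:1 ⊕ m)))
            ⊕ :1 ⊗ (k :- (b :- x) :- t ⊗ (b :- x :- :1))
            ⊕ (b :- x :- :1) ⊗ (t :- (k ⊗ x ⊕ b :- (x ⊕ x) :- :1))
            ⊕ (⊝ :1) ⊗ (e ⊗ (:1 :- b ⊗ x) :- (b ⊗ b :- b :- b ⊗ x :- :1)))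
          refl K m t e b x)

      x≉0 : ¬ x ≈ 0#
      x≉0 = ≉-distinct (ℕₚ.<⇒≤ 3≤D) 3≤D (λ ())

      1+x≉0 : ¬ 1# + x ≈ 0#
      1+x≉0 h = ≉-distinct (ℕₚ.<⇒≤ 1<D) 3≤D (λ ()) (by-linear₂ 1# 1# norm h
        (solve 3 (λ u₁ u₂ u₃ → u₁ :- u₃ ⊜ Κ (+ 0) ⊕ :1 ⊗ (u₁ :- u₂ :- :1) ⊕ :1 ⊗ (:1 ⊕ (u₂ :- u₃) :- Κ (+ 0))) refl (u 1) (u 2) (u 3)))

      u₂-u₄ : u 2 + - u₄ ≈ - N
      u₂-u₄ = by-linear₂ 1# (- 1#) u₁-u₄ norm
        (solve 5 (λ b x u₁ u₂ u₄ → u₂ :- u₄ ⊜ ⊝ (:1 :- b ⊗ x) ⊕ :1 ⊗ (u₁ :- u₄ :- b ⊗ x) ⊕ (⊝ :1) ⊗ (u₁ :- u₂ :- :1)) refl b x (u 1) (u 2) u₄)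

      N≉0 : ¬ N ≈ 0#
      N≉0 N≈0 = ≉-distinct (ℕₚ.<⇒≤ 3≤D) (nxt≤D 3≤D) (λ e → ℕₚ.<⇒≱ {2} ℕₚ.≤-refl (≡.subst (3 ≤_) (≡.sym e) 3≤nxt3))
        (trans u₂-u₄ (trans (-‿cong N≈0) -0#≈0#))

      M≢0 : M ≢ 0
      M≢0 e = ℕₚ.<⇒≱ {2} ℕₚ.≤-refl (≡.subst (3 ≤_) (≡.trans k≡ (≡.cong (λ j → suc (suc j)) e)) 3≤k)

      -- If c₃ = k - 1, then e = m and `mN` reduces to mx(1 + x) = 0, although u₂ ≠ u₃ and u₁ ≠ u₃.
      -- This secures the detached configuration.
      suc-h≢M : suc h ≢ M
      suc-h≢M h≡M = *-≉0 (ι≉0 M≢0) (*-≉0 x≉0 1+x≉0) (by-linear₂ 1# N mN e≈m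
        (solve 4 (λ m e n x → m ⊗ (x ⊗ (:1 ⊕ x)) ⊜ Κ (+ 0) ⊕ :1 ⊗ (m ⊗ (n ⊕ x ⊗ (:1 ⊕ x)) :- e ⊗ n) ⊕ n ⊗ (e :- m)) refl m e N x))
        where
        e≈m : e ≈ m
        e≈m = reflexive (≡.cong ι h≡M)

      suc-h<M : suc h < M
      suc-h<M = ℕₚ.≤∧≢⇒< (ℕ.s≤s⁻¹ (ℕ.s≤s⁻¹ (≡.subst₂ ℕ._<_ c₃≡ k≡ c₃<k))) suc-h≢M

      Attached : ℕ → Set ℓ
      Attached j = (C * u 3 + (u 1 + - u 3)) + - (C * u₄ + ι j * (u 2 + - u₄)) ≈ γ * (u 2 + - u 3)

      attached : ∃ λ g → Attached (suc g)
      attached = shift eq-attached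
        where
        shift : (∃ λ j → 1 ≤ j × Attached j) → ∃ λ g → Attached (suc g)
        shift (suc g , _ , eq) = g , eq

      Detached : ℕ → Set ℓ
      Detached j = C * u 3 + - (C * u₄ + ι j * (u 2 + - u₄)) ≈ γ * (u 2 + - u 3)

      detached : ∃ Detached
      detached = eq-detached (≡.subst₂ (λ p q → suc (suc p) ≤ q) (≡.sym c₃≡) (≡.sym k≡) (s≤s (s≤s suc-h<M)))

      module Counted (g g′ : ℕ) (attached-eq : Attached (suc g)) (detached-eq : Detached g′) where
        -- φ = (u 1 − u 3) / (u₄ − u 2), an integer.
        φ : Carrier
        φ = ι g′ + - ι (suc g)

        -- In the difference of the attached and the detached equation only u₁ - u₃ = 1 + x and a
        -- multiple of u₂ - u₄ = -N survive.
        φN : φ * N ≈ 1# + x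
        φN = by-linear₄ (- 1#) 1# (1# + - φ) φ attached-eq detached-eq norm u₁-u₄
          (solve 9 (λ e e′ c g b u₁ u₂ u₃ u₄ → (e′ :- e) ⊗ (:1 :- b ⊗ (u₂ :- u₃)) ⊜ :1 ⊕ (u₂ :- u₃)
            ⊕ (⊝ :1) ⊗ (c ⊗ u₃ ⊕ (u₁ :- u₃) :- (c ⊗ u₄ ⊕ e ⊗ (u₂ :- u₄)) :- g ⊗ (u₂ :- u₃))
            ⊕ :1 ⊗ (c ⊗ u₃ :- (c ⊗ u₄ ⊕ e′ ⊗ (u₂ :- u₄)) :- g ⊗ (u₂ :- u₃))
            ⊕ (:1 :- (e′ :- e)) ⊗ (u₁ :- u₂ :- :1)
            ⊕ (e′ :- e) ⊗ (u₁ :- u₄ :- b ⊗ (u₂ :- u₃)))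
            refl (ι (suc g)) (ι g′) C γ b (u 1) (u 2) (u 3) u₄)

        gN : ι (suc g) * N ≈ γ * x + - 1# + N + e * (N + x)
        gN = by-linear₄ 1# (N + x) (ι (suc g) + - C) (C + - ι (suc g) + - 1#) attached-eq C≈ u₁-u₄ norm
          (solve 9 (λ e e′ c g b u₁ u₂ u₃ u₄ → e′ ⊗ (:1 :- b ⊗ (u₂ :- u₃)) ⊜ g ⊗ (u₂ :- u₃) :- :1 ⊕ (:1 :- b ⊗ (u₂ :- u₃)) ⊕ e ⊗ (:1 :- b ⊗ (u₂ :- u₃) ⊕ (u₂ :- u₃))
            ⊕ :1 ⊗ (c ⊗ u₃ ⊕ (u₁ :- u₃) :- (c ⊗ u₄ ⊕ e′ ⊗ (u₂ :- u₄)) :- g ⊗ (u₂ :- u₃))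
            ⊕ (:1 :- b ⊗ (u₂ :- u₃) ⊕ (u₂ :- u₃)) ⊗ (c :- (:1 ⊕ e))
            ⊕ (e′ :- c) ⊗ (u₁ :- u₄ :- b ⊗ (u₂ :- u₃))
            ⊕ (c :- e′ :- :1) ⊗ (u₁ :- u₂ :- :1))
            refl e (ι (suc g)) C γ b (u 1) (u 2) (u 3) u₄)

        -- Once γ and C are replaced in `gN`, `mN` removes x and N can be cancelled. What is left is
        -- free of b and x and therefore holds between natural numbers.
        mg : M ℕ.* g ≡ suc h ℕ.* h
        mg = ι-injective _ _ (trans (ι-* M g) (trans (*-cancelˡ-≉0 N≉0 (by-linear₄ m (m * x) (m * (x * x)) (e + - 1#) gN γ≈ C≈ mN
          (solve 7 (λ m h g c y b x → (:1 :- b ⊗ x) ⊗ (m ⊗ g) ⊜ (:1 :- b ⊗ x) ⊗ ((:1 ⊕ h) ⊗ h)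
            ⊕ m ⊗ ((:1 ⊕ g) ⊗ (:1 :- b ⊗ x) :- (y ⊗ x :- :1 ⊕ (:1 :- b ⊗ x) ⊕ (:1 ⊕ h) ⊗ (:1 :- b ⊗ x ⊕ x)))
            ⊕ (m ⊗ x) ⊗ (y :- (c ⊗ x ⊕ b :- :1 :- (x ⊕ x)))
            ⊕ (m ⊗ (x ⊗ x)) ⊗ (c :- (:1 ⊕ (:1 ⊕ h)))
            ⊕ (:1 ⊕ h :- :1) ⊗ (m ⊗ (:1 :- b ⊗ x ⊕ x ⊗ (:1 ⊕ x)) :- (:1 ⊕ h) ⊗ (:1 :- b ⊗ x)))
            refl m (ι h) (ι g) C γ b x))) (sym (ι-* (suc h) h))))

        -- This is `mN` divided by N, since `φN` replaces x(1 + x) by φxN.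
        m[1+φx] : m * (1# + φ * x) ≈ e
        m[1+φx] = *-cancelˡ-≉0 N≉0 (by-linear₂ 1# (m * x) mN φN
          (solve 5 (λ m e p n x → n ⊗ (m ⊗ (:1 ⊕ p ⊗ x)) ⊜ n ⊗ e ⊕ :1 ⊗ (m ⊗ (n ⊕ x ⊗ (:1 ⊕ x)) :- e ⊗ n) ⊕ m ⊗ x ⊗ (p ⊗ n :- (:1 ⊕ x)))
            refl m e φ N x))

        r : Carrier
        r = m + - e

        -- `φN` times mφ, in which mφx equals e - m = -r.
        φbr : φ * b * r ≈ m * φ + - r + - (m * φ * φ)
        φbr = by-linear₂ (m * φ) (φ * b + 1#) φN m[1+φx]
          (solve 5 (λ m e p b x → p ⊗ b ⊗ (m :- e) ⊜ m ⊗ p :- (m :- e) :- m ⊗ p ⊗ p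
            ⊕ m ⊗ p ⊗ (p ⊗ (:1 :- b ⊗ x) :- (:1 ⊕ x)) ⊕ (p ⊗ b ⊕ :1) ⊗ (m ⊗ (:1 ⊕ p ⊗ x) :- e))
            refl m e φ b x)

        -- `eN` times φ, with e = 1 + h: the summand 1 completes the quadratic to (b - 2)(b + 1),
        -- and φN = 1 + x remains as the factor of h.
        φ[b-2][b+1] : φ * (b * b + - b + - (1# + 1#)) ≈ ι h * (1# + x)
        φ[b-2][b+1] = by-linear₂ (ι h) (- φ) φN eN
          (solve 4 (λ h p b x → p ⊗ (b ⊗ b :- b :- (:1 ⊕ :1)) ⊜ h ⊗ (:1 ⊕ x)
            ⊕ h ⊗ (p ⊗ (:1 :- b ⊗ x) :- (:1 ⊕ x)) ⊕ (⊝ p) ⊗ ((:1 ⊕ h) ⊗ (:1 :- b ⊗ x) :- (b ⊗ b :- b :- b ⊗ x :- :1)))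
            refl (ι h) φ b x)

-- Divisibility and growth arguments against φ ≥ 2.

module Arithmetic where
  open import Data.Nat as ℕ using (ℕ; zero; suc; _≤_; _<_; z≤n; s≤s; _+_; _*_; NonZero)
  import Data.Nat.Properties as ℕₚ
  open import Data.Nat.Divisibility using (_∣_; ∣m+n∣m⇒∣n; ∣m∣n⇒∣m+n; ∣⇒≤; ∣n⇒∣m*n; ∣m⇒∣m*n; n∣m*n; m∣m*n; ∣-refl)
  open import Data.Nat.DivMod using (_/_; m/n*n≡m)
  open import Data.Nat.GCD using (gcd; gcd[m,n]∣m; gcd[m,n]∣n; gcd[m,n]≢0)
  open import Data.Nat.Coprimality as Coprimality using (Coprime; coprime-divisor; coprime-/gcd)
  open import Data.Nat.Tactic.RingSolver using (solve-∀)
  open import Data.Product using (_×_; _,_; proj₁; proj₂)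
  open import Data.Sum using (_⊎_; inj₁; inj₂)
  open import Data.Empty using (⊥)
  open import Relation.Binary.PropositionalEquality using (_≡_; refl; sym; trans; cong; cong₂; subst; subst₂; module ≡-Reasoning)

  -- P/R is a root of the monic t² + bt - c. In lowest terms the denominator divides p² and is
  -- coprime to p, so it is 1.
  rational-root : ∀ P R b c .{{_ : NonZero R}} → P * P + b * (P * R) ≡ c * (R * R) → R ∣ P
  rational-root P R b c h = subst (_∣ P) (sym R≡e) (gcd[m,n]∣m P R)
    where
    open ≡-Reasoning
    e = gcd P R
    instance
      e≢0 : NonZero e
      e≢0 = ℕ.≢-nonZero (gcd[m,n]≢0 P R (inj₂ (ℕ.≢-nonZero⁻¹ R)))
    p = P / e
    r = R / e
    pe : p * e ≡ P
    pe = m/n*n≡m (gcd[m,n]∣m P R)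
    re : r * e ≡ R
    re = m/n*n≡m (gcd[m,n]∣n P R)
    reduced : b * (p * r) + p * p ≡ c * (r * r)
    reduced = ℕₚ.*-cancelʳ-≡ _ _ e (ℕₚ.*-cancelʳ-≡ _ _ e (begin
      (b * (p * r) + p * p) * e * e                        ≡⟨ expand b p r e ⟩
      p * e * (p * e) + b * (p * e * (r * e))              ≡⟨ cong₂ (λ P R → P * P + b * (P * R)) pe re ⟩
      P * P + b * (P * R)                                  ≡⟨ h ⟩
      c * (R * R)                                          ≡⟨ cong (λ R → c * (R * R)) re ⟨
      c * (r * e * (r * e))                                ≡⟨ expand′ c r e ⟩
      c * (r * r) * e * e ∎))
      where
      expand : ∀ b p r e → (b * (p * r) + p * p) * e * e ≡ p * e * (p * e) + b * (p * e * (r * e))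
      expand = solve-∀
      expand′ : ∀ c r e → c * (r * e * (r * e)) ≡ c * (r * r) * e * e
      expand′ = solve-∀
    r∣pp : r ∣ p * p
    r∣pp = ∣m+n∣m⇒∣n (subst (r ∣_) (sym reduced) (∣n⇒∣m*n c (m∣m*n r))) (∣n⇒∣m*n b (n∣m*n p))
    coprime : Coprime p r
    coprime = coprime-/gcd P R
    r≡1 : r ≡ 1
    r≡1 = coprime (coprime-divisor (Coprimality.sym coprime) r∣pp , ∣-refl)
    R≡e : R ≡ e
    R≡e = trans (sym re) (trans (cong (_* e) r≡1) (ℕₚ.*-identityˡ e))

  -- W n / (q ^ n) is a Chebyshev-like sequence; the second component is W (suc n) ∸ q * W n.
  module Continuant (q a : ℕ) where
    WΔ : ℕ → ℕ × ℕ
    WΔ zero    = 0 , 1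
    WΔ (suc n) = let (w , δ) = WΔ n in q * w + δ , a * q * w + (q + a) * δ

    W : ℕ → ℕ
    W n = proj₁ (WΔ n)

    W-recurrence : ∀ n → W (suc (suc n)) + q * q * W n ≡ (q + q + a) * W (suc n)
    W-recurrence n = identity q a (proj₁ (WΔ n)) (proj₂ (WΔ n))
      where
      identity : ∀ q a w δ → q * (q * w + δ) + (a * q * w + (q + a) * δ) + q * q * w ≡ (q + q + a) * (q * w + δ)
      identity = solve-∀

    module _ (q≥1 : 1 ≤ q) where
      -- Carrying the difference along with W makes positivity visible without subtraction.
      δ>0 : ∀ n → 1 ≤ proj₂ (WΔ n)
      δ>0 zero    = s≤s z≤n
      δ>0 (suc n) = ℕₚ.≤-trans (ℕₚ.*-mono-≤ (ℕₚ.≤-trans q≥1 (ℕₚ.m≤m+n q a)) (δ>0 n)) (ℕₚ.m≤n+m _ (a * q * W n))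

      W>0 : ∀ n → 1 ≤ W (suc n)
      W>0 n = ℕₚ.≤-trans (δ>0 n) (ℕₚ.m≤n+m _ (q * W n))

  -- With q = j + σ, F = 1 + q and β = 2F + q² + j this reads σβ < qF². In terms of j - 1 and σ the
  -- gap is 1 plus a polynomial with natural coefficients.
  excess : ∀ j σ → 1 ≤ j → σ * ((1 + (j + σ)) + (1 + (j + σ)) + ((j + σ) * (j + σ) + j)) < (j + σ) * ((1 + (j + σ)) * (1 + (j + σ)))
  excess j σ 1≤j = gap (σ * ((1 + A) + (1 + A) + (A * A + j))) (A * ((1 + A) * (1 + A))) _ (identity′ (j ℕ.∸ 1) j A (sym (ℕₚ.m+[n∸m]≡n 1≤j)) refl)
    where
    A : ℕ
    A = j + σ
    gap : ∀ l m r → m ≡ 1 + (r + l) → l < m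
    gap l m r e = subst (l <_) (sym e) (s≤s (ℕₚ.m≤n+m l r))
    identity : ∀ i σ → (1 + i + σ) * ((1 + (1 + i + σ)) * (1 + (1 + i + σ))) ≡
      1 + ((i * i * i + 5 * i * i + 8 * i + 3 + (2 + i) * (2 * i + 1) * σ + (1 + i) * σ * σ)
        + σ * ((1 + (1 + i + σ)) + (1 + (1 + i + σ)) + ((1 + i + σ) * (1 + i + σ) + (1 + i))))
    identity = solve-∀
    identity′ : ∀ i j A → j ≡ 1 + i → A ≡ j + σ → A * ((1 + A) * (1 + A)) ≡
      1 + ((i * i * i + 5 * i * i + 8 * i + 3 + (2 + i) * (2 * i + 1) * σ + j * σ * σ)
        + σ * ((1 + A) + (1 + A) + (A * A + j)))
    identity′ i _ _ refl refl = identity i σ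

  -- In the application F = φ, q = φ - 1, s = c₃ - 1, h = c₃ - 2, R = k - c₃ - 1 and M = k - 2.
  module _ {F q h s R M g : ℕ} (F≡ : F ≡ 1 + q) (q≥1 : 1 ≤ q) (s≡ : s ≡ 1 + h) (M≡ : M ≡ R + s) (R≥1 : 1 ≤ R)
    (Mg : M * g ≡ s * h) (key : M * (q * (F * q * s + (F * F + F + 1) * R)) ≡ h * R * R) where
    private
      instance
        R≢0 : NonZero R
        R≢0 = ℕ.>-nonZero R≥1
        M≢0 : NonZero M
        M≢0 = ℕ.>-nonZero (ℕₚ.≤-trans R≥1 (subst (R ≤_) (sym M≡) (ℕₚ.m≤m+n R s)))
        F≢0 : NonZero F
        F≢0 = subst NonZero (sym F≡) _
        s≢0 : NonZero s
        s≢0 = subst NonZero (sym s≡) _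

    -- After multiplication by s, `Mg` replaces sh by Mg, and M cancels.
    reduced-key : q * s * (F * q * s + (F * F + F + 1) * R) ≡ g * R * R
    reduced-key = ℕₚ.*-cancelˡ-≡ (q * s * (F * q * s + (F * F + F + 1) * R)) (g * R * R) M (begin
      M * (q * s * (F * q * s + (F * F + F + 1) * R))    ≡⟨ swap M q s (F * q * s + (F * F + F + 1) * R) ⟩
      s * (M * (q * (F * q * s + (F * F + F + 1) * R)))  ≡⟨ cong (s *_) key ⟩
      s * (h * R * R)        ≡⟨ assoc s h R ⟩
      s * h * R * R          ≡⟨ cong (λ z → z * R * R) Mg ⟨
      M * g * R * R          ≡⟨ assoc M g R ⟨
      M * (g * R * R) ∎)
      where
      open ≡-Reasoning
      swap : ∀ M p s z → M * (p * s * z) ≡ s * (M * (p * z))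
      swap = solve-∀
      assoc : ∀ a b c → a * (b * c * c) ≡ a * b * c * c
      assoc = solve-∀

    -- `reduced-key` times F makes Fqs/R a root of t² + (F² + F + 1)t - Fg.
    R∣Fqs : R ∣ F * q * s
    R∣Fqs = rational-root (F * q * s) R (F * F + F + 1) (F * g) (begin
      F * q * s * (F * q * s) + (F * F + F + 1) * (F * q * s * R)  ≡⟨ factor F q s (F * F + F + 1) R ⟩
      F * (q * s * (F * q * s + (F * F + F + 1) * R))  ≡⟨ cong (F *_) reduced-key ⟩
      F * (g * R * R)      ≡⟨ assoc F g R ⟩
      F * g * (R * R) ∎)
      where
      open ≡-Reasoning
      factor : ∀ F q s b R → F * q * s * (F * q * s) + b * (F * q * s * R) ≡ F * (q * s * (F * q * s + b * R))
      factor = solve-∀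
      assoc : ∀ F g R → F * (g * R * R) ≡ F * g * (R * R)
      assoc = solve-∀

    quotient : ℕ
    quotient = _∣_.quotient R∣Fqs

    Fqs≡ : F * q * s ≡ quotient * R
    Fqs≡ = _∣_.equality R∣Fqs

    quotient≥1 : 1 ≤ quotient
    quotient≥1 = ℕₚ.n≢0⇒n>0 (λ e → ℕ.≢-nonZero⁻¹ (F * q * s) {{ℕₚ.m*n≢0 (F * q) s {{ℕₚ.m*n≢0 F q {{F≢0}} {{ℕ.>-nonZero q≥1}}}}}} (trans Fqs≡ (cong (_* R) e)))

    -- Modulo c = 1 + s, which is c₃, the number m = 1 + M is -F, because (1 + F)c = m + F. Then (1
    -- + m)m² is -F²q, so c divides F²q. But c = 2 + h with h = (1 + F)q(2 + F), which exceeds F²q.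
    diameter-3-impossible : R ≡ F * s → ∀ l → (1 + s) * l ≡ (2 + M) * ((1 + M) * (1 + M)) → ⊥
    diameter-3-impossible R≡ l eq = ℕₚ.<⇒≱ small (∣⇒≤ {{ℕₚ.m*n≢0 (F * F) q {{ℕₚ.m*n≢0 F F}} {{ℕ.>-nonZero q≥1}}}} c∣F²q)
      where
      open ≡-Reasoning
      M≡′ : M ≡ (1 + F) * s
      M≡′ = trans M≡ (trans (cong (_+ s) R≡) (ℕₚ.+-comm (F * s) s))
      g≡ : g ≡ q * (2 + F)
      g≡ = ℕₚ.*-cancelʳ-≡ g (q * (2 + F)) (F * F * s * s) {{ℕₚ.m*n≢0 (F * F * s) s {{ℕₚ.m*n≢0 (F * F) s {{ℕₚ.m*n≢0 F F}}}}}} (begin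
        g * (F * F * s * s)      ≡⟨ e₁ g F s ⟩
        g * (F * s) * (F * s)    ≡⟨ cong (λ z → g * z * z) R≡ ⟨
        g * R * R                ≡⟨ reduced-key ⟨
        q * s * (F * q * s + (F * F + F + 1) * R)        ≡⟨ cong (λ z → q * s * (F * q * s + (F * F + F + 1) * z)) R≡ ⟩
        q * s * (F * q * s + (F * F + F + 1) * (F * s))  ≡⟨ e₂ F q s F≡ ⟩
        q * (2 + F) * (F * F * s * s) ∎)
        where
        e₁ : ∀ g F s → g * (F * F * s * s) ≡ g * (F * s) * (F * s)
        e₁ = solve-∀
        e₂′ : ∀ q s → q * s * ((1 + q) * q * s + ((1 + q) * (1 + q) + (1 + q) + 1) * ((1 + q) * s)) ≡ q * (2 + (1 + q)) * ((1 + q) * (1 + q) * s * s)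
        e₂′ = solve-∀
        e₂ : ∀ F q s → F ≡ 1 + q → q * s * (F * q * s + (F * F + F + 1) * (F * s)) ≡ q * (2 + F) * (F * F * s * s)
        e₂ _ q s refl = e₂′ q s
      h≡ : h ≡ (1 + F) * (q * (2 + F))
      h≡ = ℕₚ.*-cancelˡ-≡ h ((1 + F) * (q * (2 + F))) s (begin
        s * h                      ≡⟨ Mg ⟨
        M * g                      ≡⟨ cong₂ _*_ M≡′ g≡ ⟩
        (1 + F) * s * (q * (2 + F))    ≡⟨ e₃ (1 + F) s (q * (2 + F)) ⟩
        s * ((1 + F) * (q * (2 + F))) ∎)
        where
        e₃ : ∀ a s b → a * s * b ≡ s * (a * b)
        e₃ = solve-∀
      m c : ℕ
      m = 1 + M
      c = 1 + s
      X≡ : (1 + F) * c ≡ m + F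
      X≡ = trans (e₄ F s) (cong (λ z → 1 + z + F) (sym M≡′))
        where
        e₄ : ∀ F s → (1 + F) * (1 + s) ≡ 1 + (1 + F) * s + F
        e₄ = solve-∀
      c∣X : c ∣ m + F
      c∣X = subst (c ∣_) X≡ (n∣m*n (1 + F))
      c∣F²q : c ∣ F * F * q
      c∣F²q = ∣m+n∣m⇒∣n (subst (c ∣_) (e₅ m F q F≡) (∣m⇒∣m*n (m * m + F * F + m) c∣X))
        (∣m∣n⇒∣m+n (subst (c ∣_) eq (m∣m*n l)) (∣m⇒∣m*n (m * F + F) c∣X))
        where
        e₅′ : ∀ m q → (m + (1 + q)) * (m * m + (1 + q) * (1 + q) + m) ≡
          (1 + m) * (m * m) + (m + (1 + q)) * (m * (1 + q) + (1 + q)) + (1 + q) * (1 + q) * q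
        e₅′ = solve-∀
        e₅ : ∀ m F q → F ≡ 1 + q → (m + F) * (m * m + F * F + m) ≡ (1 + m) * (m * m) + (m + F) * (m * F + F) + F * F * q
        e₅ m _ q refl = e₅′ m q
      small : F * F * q < c
      small = subst (λ z → F * F * q < 1 + z) (sym (trans s≡ (cong suc (trans h≡ (e₆ F q)))))
        (ℕₚ.m≤n⇒m≤1+n (s≤s (ℕₚ.m≤m+n (F * F * q) ((3 * F + 2) * q))))
        where
        e₆ : ∀ F q → (1 + F) * (q * (2 + F)) ≡ F * F * q + (3 * F + 2) * q
        e₆ = solve-∀

    open Continuant F (q * q + quotient)

    -- F + F + (q * q + j) = F² + 1 + j is - F times the coefficient of the three-term recurrence.
    larger-diameter-impossible : ∀ n → W (3 + n) * R ≡ F * F * M * W (2 + n) → ⊥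
    larger-diameter-impossible n eq = contradict (ℕₚ.≤-total q j)
      where
      open ≡-Reasoning
      j β : ℕ
      j = quotient
      β = F + F + (q * q + j)
      impossible : ∀ a₂ a₁ a₀ a₋ → a₂ + F * F * a₀ ≡ β * a₁ → a₁ + F * F * a₋ ≡ β * a₀ → 1 ≤ a₀ →
        a₂ * R ≡ F * F * M * a₁ → q ≤ j ⊎ j ≤ q → ⊥
      impossible a₂ a₁ a₀ a₋ rec₁ rec₀ a₀>0 eq = go
        where
        -- `rec₁` and `eq` eliminate a₂; with M = R + s and Fqs = jR every term is a multiple of R,
        -- which cancels.
        balance : q * a₁ ≡ j * a₁ + q * (F * F) * a₀
        balance = ℕₚ.+-cancelˡ-≡ (q * (F * F) * a₁ + q * j * a₁) _ _ (ℕₚ.*-cancelˡ-≡ _ _ R (begin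
          R * (q * (F * F) * a₁ + q * j * a₁ + q * a₁)
            ≡⟨ e₁ R F q j a₁ F≡ ⟩
          q * R * (β * a₁)
            ≡⟨ cong (q * R *_) rec₁ ⟨
          q * R * (a₂ + F * F * a₀)
            ≡⟨ e₂ q R a₂ (F * F * a₀) ⟩
          q * (a₂ * R) + q * R * (F * F * a₀)
            ≡⟨ cong (λ z → q * z + q * R * (F * F * a₀)) (trans eq (cong (λ M → F * F * M * a₁) M≡)) ⟩
          q * (F * F * (R + s) * a₁) + q * R * (F * F * a₀)
            ≡⟨ e₃ q F R s a₁ a₀ ⟩
          R * (q * (F * F) * a₁ + q * (F * F) * a₀) + F * (F * q * s) * a₁
            ≡⟨ cong (λ z → R * (q * (F * F) * a₁ + q * (F * F) * a₀) + F * z * a₁) Fqs≡ ⟩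
          R * (q * (F * F) * a₁ + q * (F * F) * a₀) + F * (j * R) * a₁
            ≡⟨ e₄ F q R j a₁ a₀ F≡ ⟩
          R * (q * (F * F) * a₁ + q * j * a₁ + (j * a₁ + q * (F * F) * a₀)) ∎))
          where
          e₁′ : ∀ R q j a → R * (q * ((1 + q) * (1 + q)) * a + q * j * a + q * a) ≡ q * R * ((1 + q + (1 + q) + (q * q + j)) * a)
          e₁′ = solve-∀
          e₁ : ∀ R F q j a → F ≡ 1 + q → R * (q * (F * F) * a + q * j * a + q * a) ≡ q * R * ((F + F + (q * q + j)) * a)
          e₁ R _ q j a refl = e₁′ R q j a
          e₂ : ∀ p R a b → p * R * (a + b) ≡ p * (a * R) + p * R * b
          e₂ = solve-∀
          e₃ : ∀ p F R s a b → p * (F * F * (R + s) * a) + p * R * (F * F * b) ≡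
            R * (p * (F * F) * a + p * (F * F) * b) + F * (F * p * s) * a
          e₃ = solve-∀
          e₄′ : ∀ q R j a b → R * (q * ((1 + q) * (1 + q)) * a + q * ((1 + q) * (1 + q)) * b) + (1 + q) * (j * R) * a ≡
            R * (q * ((1 + q) * (1 + q)) * a + q * j * a + (j * a + q * ((1 + q) * (1 + q)) * b))
          e₄′ = solve-∀
          e₄ : ∀ F q R j a b → F ≡ 1 + q → R * (q * (F * F) * a + q * (F * F) * b) + F * (j * R) * a ≡
            R * (q * (F * F) * a + q * j * a + (j * a + q * (F * F) * b))
          e₄ _ q R j a b refl = e₄′ q R j a b
        a₁≤ : a₁ ≤ β * a₀
        a₁≤ = subst (a₁ ≤_) rec₀ (ℕₚ.m≤m+n a₁ _)
        excess>0 : 1 ≤ q * (F * F) * a₀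
        excess>0 = ℕₚ.*-mono-≤ (ℕₚ.*-mono-≤ q≥1 (ℕₚ.*-mono-≤ F≥1 F≥1)) a₀>0
          where
          F≥1 : 1 ≤ F
          F≥1 = ℕ.>-nonZero⁻¹ F
        -- If q ≤ j, the right side of `balance` is the larger one. Otherwise σ = q - j satisfies
        -- σa₁ = qF²a₀, while a₁ ≤ βa₀ and `excess` make the left side smaller.
        go : q ≤ j ⊎ j ≤ q → ⊥
        go (inj₁ le) = ℕₚ.<⇒≢ (ℕₚ.≤-trans (s≤s (ℕₚ.*-monoˡ-≤ a₁ le))
          (ℕₚ.≤-trans (ℕₚ.≤-reflexive (ℕₚ.+-comm 1 (j * a₁))) (ℕₚ.+-monoʳ-≤ (j * a₁) excess>0))) balance
        go (inj₂ le) = ℕₚ.<⇒≱ strict bound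
          where
          σ = q ℕ.∸ j
          jσ : j + σ ≡ q
          jσ = ℕₚ.m+[n∸m]≡n le
          σa₁ : σ * a₁ ≡ q * (F * F) * a₀
          σa₁ = ℕₚ.+-cancelˡ-≡ (j * a₁) _ _ (trans (sym (ℕₚ.*-distribʳ-+ a₁ j σ)) (trans (cong (_* a₁) jσ) balance))
          bound : q * (F * F) * a₀ ≤ σ * β * a₀
          bound = subst₂ _≤_ σa₁ (sym (ℕₚ.*-assoc σ β a₀)) (ℕₚ.*-monoʳ-≤ σ a₁≤)
          F≡′ : F ≡ 1 + (j + σ)
          F≡′ = trans F≡ (cong suc (sym jσ))
          strict : σ * β * a₀ < q * (F * F) * a₀
          strict = ℕₚ.*-monoˡ-< a₀ {{ℕ.>-nonZero a₀>0}} (subst₂ _<_ (cong (σ *_) (sym β≡)) (sym qF≡) (excess j σ quotient≥1))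
            where
            β≡ : β ≡ (1 + (j + σ)) + (1 + (j + σ)) + ((j + σ) * (j + σ) + j)
            β≡ = cong₂ (λ F q → F + F + (q * q + j)) F≡′ (sym jσ)
            qF≡ : q * (F * F) ≡ (j + σ) * ((1 + (j + σ)) * (1 + (j + σ)))
            qF≡ = cong₂ (λ q F → q * (F * F)) (sym jσ) F≡′
      contradict : q ≤ j ⊎ j ≤ q → ⊥
      contradict = impossible (W (3 + n)) (W (2 + n)) (W (1 + n)) (W n) (W-recurrence (suc n)) (W-recurrence n)
        (W>0 (ℕ.>-nonZero⁻¹ F) n) eq

-- Exclusion of all values of φ except 1.

module ParameterRigidity where
  open Summation
  open FieldTools
  open AlmostBipartite
  open BalancedSequenceConstruction
  open LocalCounting
  open DistanceEquations
  open EliminationOfUnknowns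
  open Arithmetic
  open import Data.Nat as ℕ using (ℕ; zero; suc; _≤_; _<_; z≤n; s≤s)
  import Data.Nat.Properties as ℕₚ
  open import Data.Integer as ℤ using (+_)
  open import Data.Fin using (Fin)
  import Data.Fin as Fin
  open import Data.Product using (proj₁; proj₂)
  open import Data.Vec as Vec using ([]; _∷_)
  open import Data.Sum using (_⊎_; inj₁; inj₂)
  open import Data.Empty using (⊥; ⊥-elim)
  open import Relation.Nullary using (¬_)
  open import Relation.Binary.PropositionalEquality as ≡ using (_≡_)
  open import Tactic.RingSolver.Core.Expression using (Κ; _⊕_; _⊗_; ⊝_)

  module Rigidity {c ℓ} (F : CharZeroField c ℓ) (G : Graph) (conn : Connected G) (D k : ℕ)
    (dr : DistanceRegular G D) (ab : AlmostBipartite G D) (3≤D : 3 ≤ D) (val : Valency G k) (girth : Girth G 6)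
    (3≤k : 3 ≤ k) (B : BalancedSequences.BalancedSequence F G conn D k dr ab 3≤D val girth) where

    open LocalCounts G conn D k dr ab 3≤D val girth 3≤k
    open Field F
    open Equations F G conn D k dr ab 3≤D val girth 3≤k B
    open BalancedSequences F G conn D k dr ab 3≤D val girth using (module BalancedSequence)
    open BalancedSequence B
    open Elimination F G conn D k dr ab 3≤D val girth 3≤k B using (b; x)

    module Solved (norm : u 1 + - u 2 ≈ 1#) {M h : ℕ} (k≡ : k ≡ suc (suc M)) (c₃≡ : c₃ ≡ suc (suc h)) where
      open Elimination F G conn D k dr ab 3≤D val girth 3≤k B
        using (m; e; C≈γb; γ≉0; 1+x≉0; M≢0; Attached; Detached; module Counted)

      mₖ eₖ : Carrier
      mₖ = m norm k≡ c₃≡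
      eₖ = e norm k≡ c₃≡

      u-step : ∀ i → suc (suc i) ≤ D → b * (u (suc i) + - u (suc (suc i))) ≈ u i + - u (nxt (suc (suc i)))
      u-step i le = *-cancelˡ-≉0 (γ≉0 norm k≡ c₃≡) (by-linear₂ 1# (- (u (suc i) + - u (suc (suc i)))) (recurrence i le) (C≈γb norm k≡ c₃≡)
        (solve 7 (λ g b c p q r s → g ⊗ (b ⊗ (q :- r)) ⊜ g ⊗ (p :- s) ⊕ :1 ⊗ (c ⊗ q :- c ⊗ r :- g ⊗ (p :- s)) ⊕ (⊝ (q :- r)) ⊗ (c :- g ⊗ b))
          refl γ b C (u i) (u (suc i)) (u (suc (suc i))) (u (nxt (suc (suc i))))))

      record Odd : Set ℓ where
        field
          h≡0 : h ≡ 0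
          b≈  : b ≈ - 1#
          mx≈ : mₖ * x ≈ 1# + - mₖ

      module _ (g g′ : ℕ) (attached-eq : Attached norm k≡ c₃≡ (suc g)) (detached-eq : Detached norm k≡ c₃≡ g′)
        (R : ℕ) (M≡ : M ≡ R ℕ.+ suc h) (R≥1 : 1 ≤ R) where
        open Counted norm k≡ c₃≡ g g′ attached-eq detached-eq

        ρ : Carrier
        ρ = ι R

        m≈ : mₖ ≈ ρ + eₖ
        m≈ = trans (reflexive (≡.cong ι M≡)) (ι-+ R (suc h))

        ρ≉0 : ¬ ρ ≈ 0#
        ρ≉0 = ι≉0 (λ e → ℕₚ.<⇒≢ R≥1 (≡.sym e))

        m≉0 : ¬ mₖ ≈ 0#
        m≉0 = ι≉0 (M≢0 norm k≡ c₃≡)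

        φ≉0 : ¬ φ ≈ 0#
        φ≉0 φ≈0 = 1+x≉0 norm k≡ c₃≡ (trans (sym φN) (trans (*-congʳ φ≈0) (zeroˡ _)))

        -- As mφx = -ρ, this is mφ(1 + x), a product of nonzero factors.
        mφ-ρ≉0 : ¬ mₖ * φ + - ρ ≈ 0#
        mφ-ρ≉0 h = *-≉0 (*-≉0 m≉0 φ≉0) (1+x≉0 norm k≡ c₃≡) (by-linear₃ 1# (- 1#) 1# h m≈ m[1+φx]
          (solve 5 (λ m e p x r → m ⊗ p ⊗ (:1 ⊕ x) ⊜ Κ (+ 0) ⊕ :1 ⊗ (m ⊗ p :- r :- Κ (+ 0)) ⊕ (⊝ :1) ⊗ (m :- (r ⊕ e)) ⊕ :1 ⊗ (m ⊗ (:1 ⊕ p ⊗ x) :- e))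
            refl mₖ eₖ φ x ρ))

        φbρ : φ * b * ρ ≈ mₖ * φ + - ρ + - (mₖ * φ * φ)
        φbρ = by-linear₂ 1# (- (φ * b + 1#)) (Counted.φbr norm k≡ c₃≡ g g′ attached-eq detached-eq) m≈
          (solve 5 (λ m e p b r → p ⊗ b ⊗ r ⊜ m ⊗ p :- r :- m ⊗ p ⊗ p
            ⊕ :1 ⊗ (p ⊗ b ⊗ (m :- e) :- (m ⊗ p :- (m :- e) :- m ⊗ p ⊗ p)) ⊕ (⊝ (p ⊗ b ⊕ :1)) ⊗ (m :- (r ⊕ e)))
            refl mₖ eₖ φ b ρ)

        -- `φ[b-2][b+1]` is multiplied by mφρ², so that b occurs only in φbρ and `φbρ` eliminates
        -- it. Both sides then contain mφ - ρ = mφ(1 + x), which cancels.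
        key : mₖ * ((φ + - 1#) * (φ * (φ + - 1#) * eₖ + (φ * φ + φ + 1#) * ρ)) ≈ ι h * ρ * ρ
        key = *-cancelˡ-≉0 mφ-ρ≉0 (trans expand (trans middle collect))
          where
          p p′ : Carrier
          p  = φ * b * ρ
          p′ = mₖ * φ + - ρ + - (mₖ * φ * φ)
          expand : (mₖ * φ + - ρ) * (mₖ * ((φ + - 1#) * (φ * (φ + - 1#) * eₖ + (φ * φ + φ + 1#) * ρ))) ≈
            mₖ * ((p′ + - ((φ + φ) * ρ)) * (p′ + φ * ρ))
          expand = by-linear₁ (- (mₖ * (mₖ * φ + - ρ) * (φ + - 1#) * φ * (φ + - 1#))) m≈
            (solve 4 (λ m e f r → (m ⊗ f :- r) ⊗ (m ⊗ ((f :- :1) ⊗ (f ⊗ (f :- :1) ⊗ e ⊕ (f ⊗ f ⊕ f ⊕ :1) ⊗ r))) ⊜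
              m ⊗ ((m ⊗ f :- r :- m ⊗ f ⊗ f :- (f ⊕ f) ⊗ r) ⊗ (m ⊗ f :- r :- m ⊗ f ⊗ f ⊕ f ⊗ r))
              ⊕ (⊝ (m ⊗ (m ⊗ f :- r) ⊗ (f :- :1) ⊗ f ⊗ (f :- :1))) ⊗ (m :- (r ⊕ e)))
              refl mₖ eₖ φ ρ)
          middle : mₖ * ((p′ + - ((φ + φ) * ρ)) * (p′ + φ * ρ)) ≈ mₖ * ((p + - ((φ + φ) * ρ)) * (p + φ * ρ))
          middle = *-congˡ (*-cong (+-congʳ (sym φbρ)) (+-congʳ (sym φbρ)))
          collect : mₖ * ((p + - ((φ + φ) * ρ)) * (p + φ * ρ)) ≈ (mₖ * φ + - ρ) * (ι h * ρ * ρ)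
          collect = by-linear₃ (mₖ * φ * ρ * ρ) (ι h * ρ * ρ) (- (ι h * ρ * ρ)) φ[b-2][b+1] m[1+φx] m≈
            (solve 7 (λ m e f r b x h → m ⊗ ((f ⊗ b ⊗ r :- (f ⊕ f) ⊗ r) ⊗ (f ⊗ b ⊗ r ⊕ f ⊗ r)) ⊜ (m ⊗ f :- r) ⊗ (h ⊗ r ⊗ r)
              ⊕ m ⊗ f ⊗ r ⊗ r ⊗ (f ⊗ (b ⊗ b :- b :- (:1 ⊕ :1)) :- h ⊗ (:1 ⊕ x))
              ⊕ h ⊗ r ⊗ r ⊗ (m ⊗ (:1 ⊕ f ⊗ x) :- e) ⊕ (⊝ (h ⊗ r ⊗ r)) ⊗ (m :- (r ⊕ e)))
              refl mₖ eₖ φ ρ b x (ι h))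

        -- For φ = -q the left side of `key` is negative, since q² - q + 1 > 0, and the right side
        -- is not. The negative terms are moved across to obtain an equation of natural numbers.
        nonpositive-impossible : ∀ q → g′ ℕ.+ q ≡ suc g → ⊥
        nonpositive-impossible q eq = ℕₚ.<⇒≢ (ℕₚ.≤-trans strict (ℕₚ.m≤m+n _ (h ℕ.* R ℕ.* R))) (≡.sym identity)
          where
          s : ℕ
          s = suc h
          φ≈ : φ ≈ - ι q
          φ≈ = by-linear₁ 1# (trans (sym (ι-+ g′ q)) (reflexive (≡.cong ι eq)))
            (solve 3 (λ a b c → a :- c ⊜ ⊝ b ⊕ :1 ⊗ (a ⊕ b :- c)) refl (ι g′) (ι q) (ι (suc g)))
          identity : M ℕ.* ((1 ℕ.+ q) ℕ.* (q ℕ.* (1 ℕ.+ q) ℕ.* s ℕ.+ (q ℕ.* q ℕ.+ 1) ℕ.* R)) ℕ.+ h ℕ.* R ℕ.* R ≡ M ℕ.* ((1 ℕ.+ q) ℕ.* (q ℕ.* R))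
          identity = ℕ-identity
            (vM `* ((`1 `+ vq) `* (vq `* (`1 `+ vq) `* vs `+ (vq `* vq `+ `1) `* vR)) `+ vh `* vR `* vR)
            (vM `* ((`1 `+ vq) `* (vq `* vR))) (M ∷ q ∷ s ∷ R ∷ h ∷ [])
            (by-linear₁ (- 1#) (trans (*-congˡ (*-cong (+-congʳ (sym φ≈)) (+-cong (*-congʳ (*-cong (sym φ≈) (+-congʳ (sym φ≈)))) (*-congʳ (+-congʳ (+-cong (*-cong (sym φ≈) (sym φ≈)) (sym φ≈))))))) key)
              (solve 5 (λ m q e r h → m ⊗ ((:1 ⊕ q) ⊗ (q ⊗ (:1 ⊕ q) ⊗ e ⊕ (q ⊗ q ⊕ :1) ⊗ r)) ⊕ h ⊗ r ⊗ r ⊜ m ⊗ ((:1 ⊕ q) ⊗ (q ⊗ r))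
                ⊕ (⊝ :1) ⊗ (m ⊗ ((⊝ q :- :1) ⊗ ((⊝ q) ⊗ (⊝ q :- :1) ⊗ e ⊕ ((⊝ q) ⊗ (⊝ q) ⊕ ⊝ q ⊕ :1) ⊗ r)) :- h ⊗ r ⊗ r))
                refl mₖ (ι q) eₖ ρ (ι h)))
            where
            vM vq vs vR vh : NatExpr 5
            vM = ` Fin.zero
            vq = ` Fin.suc Fin.zero
            vs = ` Fin.suc (Fin.suc Fin.zero)
            vR = ` Fin.suc (Fin.suc (Fin.suc Fin.zero))
            vh = ` Fin.suc (Fin.suc (Fin.suc (Fin.suc Fin.zero)))
          q≤q² : ∀ q → q ≤ q ℕ.* q
          q≤q² zero    = z≤n
          q≤q² (suc q) = ℕₚ.m≤m+n (suc q) (q ℕ.* suc q)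
          strict : M ℕ.* ((1 ℕ.+ q) ℕ.* (q ℕ.* R)) < M ℕ.* ((1 ℕ.+ q) ℕ.* (q ℕ.* (1 ℕ.+ q) ℕ.* s ℕ.+ (q ℕ.* q ℕ.+ 1) ℕ.* R))
          strict = ℕₚ.*-monoʳ-< M {{ℕ.≢-nonZero (M≢0 norm k≡ c₃≡)}} (ℕₚ.*-monoʳ-< (1 ℕ.+ q)
            (ℕₚ.≤-<-trans (ℕₚ.*-monoˡ-≤ R (q≤q² q)) (ℕₚ.<-≤-trans
              (ℕₚ.*-monoˡ-< R {{ℕ.>-nonZero R≥1}} (ℕₚ.≤-reflexive (ℕₚ.+-comm 1 (q ℕ.* q))))
              (ℕₚ.m≤n+m ((q ℕ.* q ℕ.+ 1) ℕ.* R) (q ℕ.* (1 ℕ.+ q) ℕ.* s)))))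

        -- φ = 1 annihilates the left side of `key`, and ρ ≠ 0 leaves h = 0; then `φbρ` gives b and
        -- `m[1+φx]` gives x.
        odd-case : g′ ≡ suc (suc g) → Odd
        odd-case eq = record { h≡0 = h≡0 ; b≈ = b≈ ; mx≈ = mx≈ }
          where
          φ≈1 : φ ≈ 1#
          φ≈1 = trans (+-congʳ (reflexive (≡.cong ι eq))) (solve 1 (λ a → :1 ⊕ a :- a ⊜ :1) refl (ι (suc g)))
          hρρ≈0 : ι h * (ρ * ρ) ≈ 0#
          hρρ≈0 = trans (sym (*-assoc _ _ _)) (trans (sym key) (trans (*-congˡ (trans (*-congʳ (trans (+-congʳ φ≈1) (-‿inverseʳ 1#))) (zeroˡ _))) (zeroʳ _)))
          h≡0 : h ≡ 0
          h≡0 = ι≈0⇒≡0 h (*-zero-cancelˡ (*-≉0 ρ≉0 ρ≉0) (trans (*-comm _ _) hρρ≈0))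
          b≈ : b ≈ - 1#
          b≈ = *-cancelˡ-≉0 ρ≉0 (by-linear₂ 1# (mₖ + - (mₖ * (φ + 1#)) + - (b * ρ)) φbρ φ≈1
            (solve 4 (λ m f b r → r ⊗ b ⊜ r ⊗ (⊝ :1) ⊕ :1 ⊗ (f ⊗ b ⊗ r :- (m ⊗ f :- r :- m ⊗ f ⊗ f)) ⊕ (m :- m ⊗ (f ⊕ :1) :- b ⊗ r) ⊗ (f :- :1))
              refl mₖ φ b ρ))
          e≈1 : eₖ ≈ 1#
          e≈1 = trans (reflexive (≡.cong (λ j → ι (suc j)) h≡0)) ι-1
          mx≈ : mₖ * x ≈ 1# + - mₖ
          mx≈ = by-linear₃ 1# (- (mₖ * x)) 1# m[1+φx] φ≈1 e≈1
            (solve 4 (λ m e f x → m ⊗ x ⊜ :1 :- m ⊕ :1 ⊗ (m ⊗ (:1 ⊕ f ⊗ x) :- e) ⊕ (⊝ (m ⊗ x)) ⊗ (f :- :1) ⊕ :1 ⊗ (e :- :1)) refl mₖ eₖ φ x)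

        -- F is now the natural number φ ≥ 2 and shadows the field.
        module Large (F q : ℕ) (F≡ : F ≡ 1 ℕ.+ q) (q≥1 : 1 ≤ q) (g′≡ : g′ ≡ suc g ℕ.+ F) where
          φ≈F : φ ≈ ι F
          φ≈F = trans (+-congʳ (trans (reflexive (≡.cong ι g′≡)) (ι-+ (suc g) F)))
            (solve 2 (λ a b → a ⊕ b :- a ⊜ b) refl (ι (suc g)) (ι F))

          F≈ : ι F ≈ 1# + ι q
          F≈ = reflexive (≡.cong ι F≡)

          φ-1≈q : φ + - 1# ≈ ι q
          φ-1≈q = trans (+-congʳ (trans φ≈F F≈)) (solve 1 (λ a → :1 ⊕ a :- :1 ⊜ a) refl (ι q))

          s : ℕ
          s = suc h

          keyℕ : M ℕ.* (q ℕ.* (F ℕ.* q ℕ.* s ℕ.+ (F ℕ.* F ℕ.+ F ℕ.+ 1) ℕ.* R)) ≡ h ℕ.* R ℕ.* R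
          keyℕ = ℕ-identity (vM `* (vq `* (vF `* vq `* vs `+ (vF `* vF `+ vF `+ `1) `* vR))) (vh `* vR `* vR) (M ∷ q ∷ s ∷ R ∷ h ∷ F ∷ [])
            (trans (*-congˡ (*-cong (sym φ-1≈q) (+-cong (*-congʳ (*-cong (sym φ≈F) (sym φ-1≈q))) (*-congʳ (+-congʳ (+-cong (*-cong (sym φ≈F) (sym φ≈F)) (sym φ≈F))))))) key)
            where
            vM vq vs vR vh vF : NatExpr 6
            vM = ` Fin.zero
            vq = ` Fin.suc Fin.zero
            vs = ` Fin.suc (Fin.suc Fin.zero)
            vR = ` Fin.suc (Fin.suc (Fin.suc Fin.zero))
            vh = ` Fin.suc (Fin.suc (Fin.suc (Fin.suc Fin.zero)))
            vF = ` Fin.suc (Fin.suc (Fin.suc (Fin.suc (Fin.suc Fin.zero))))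

          diameter-3 : D ≡ 3 → ⊥
          diameter-3 D≡3 = diameter-3-impossible {F} {q} {h} {s} {R} {M} {g} F≡ q≥1 ≡.refl M≡ R≥1 mg keyℕ R≡ (proj₁ sphere₃-count)
              (≡.subst₂ (λ c k → c ℕ.* proj₁ sphere₃-count ≡ k ℕ.* ((k ℕ.∸ 1) ℕ.* (k ℕ.∸ 1))) c₃≡ k≡ (proj₂ sphere₃-count))
            where
            nxt-3 : nxt 3 ≡ 3
            nxt-3 = ≡.subst (λ j → nxt j ≡ j) D≡3 nxt-D
            -- For D = 3 the sequence stops: u₄ = u₃, and bx = u₁ - u₄ becomes u₁ - u₃.
            bx≈1+x : b * x ≈ 1# + x
            bx≈1+x = by-linear₂ 1# 1# (trans (u-step 1 3≤D) (+-congˡ (-‿cong (reflexive (≡.cong u nxt-3))))) norm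
              (solve 4 (λ b u₁ u₂ u₃ → b ⊗ (u₂ :- u₃) ⊜ :1 ⊕ (u₂ :- u₃) ⊕ :1 ⊗ (b ⊗ (u₂ :- u₃) :- (u₁ :- u₃)) ⊕ :1 ⊗ (u₁ :- u₂ :- :1)) refl b (u 1) (u 2) (u 3))
            ρ≈Fs : ρ ≈ φ * eₖ
            ρ≈Fs = by-linear₄ (- 1#) (1# + φ) (mₖ * φ) (mₖ * φ * φ) m≈ m[1+φx] φN bx≈1+x
              (solve 6 (λ m e f b x r → r ⊜ f ⊗ e ⊕ (⊝ :1) ⊗ (m :- (r ⊕ e)) ⊕ (:1 ⊕ f) ⊗ (m ⊗ (:1 ⊕ f ⊗ x) :- e) ⊕ (m ⊗ f) ⊗ (f ⊗ (:1 :- b ⊗ x) :- (:1 ⊕ x)) ⊕ (m ⊗ f ⊗ f) ⊗ (b ⊗ x :- (:1 ⊕ x)))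
                refl mₖ eₖ φ b x ρ)
            R≡ : R ≡ F ℕ.* s
            R≡ = ι-injective R (F ℕ.* s) (trans ρ≈Fs (trans (*-congʳ φ≈F) (sym (ι-* F s))))

          private
            j : ℕ
            j = quotient {F} {q} {h} {s} {R} {M} {g} F≡ q≥1 ≡.refl M≡ R≥1 mg keyℕ

            j-spec : F ℕ.* q ℕ.* s ≡ j ℕ.* R
            j-spec = Fqs≡ {F} {q} {h} {s} {R} {M} {g} F≡ q≥1 ≡.refl M≡ R≥1 mg keyℕ

            module Cont = Continuant F (q ℕ.* q ℕ.+ j)
            open Cont using (W; W-recurrence)

            β : ℕ
            β = F ℕ.+ F ℕ.+ (q ℕ.* q ℕ.+ j)

            ιβ : ι β ≈ φ + φ + ((φ + - 1#) * (φ + - 1#) + ι j)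
            ιβ = trans (ι-+ (F ℕ.+ F) (q ℕ.* q ℕ.+ j)) (+-cong (trans (ι-+ F F) (+-cong (sym φ≈F) (sym φ≈F)))
              (trans (ι-+ (q ℕ.* q) j) (+-congʳ (trans (ι-* q q) (*-cong (sym φ-1≈q) (sym φ-1≈q))))))

            jρ : φ * (φ + - 1#) * eₖ ≈ ι j * ρ
            jρ = trans (*-congʳ (*-cong φ≈F φ-1≈q)) (trans (*-congʳ (sym (ι-* F q))) (trans (sym (ι-* (F ℕ.* q) s))
              (trans (reflexive (≡.cong ι j-spec)) (ι-* j R))))

            -- Dividing `φbρ` by ρ leaves the fraction φ(φ - 1)e/ρ, which is the natural number j by
            -- the rational root argument.
            φ[1-b] : φ * (1# + - b) ≈ ι β
            φ[1-b] = *-cancelˡ-≉0 ρ≉0 (by-linear₄ (- 1#) (φ * φ + - φ) 1# (- ρ) φbρ m≈ jρ ιβ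
              (solve 7 (λ m e f b r j β → r ⊗ (f ⊗ (:1 :- b)) ⊜ r ⊗ β ⊕ (⊝ :1) ⊗ (f ⊗ b ⊗ r :- (m ⊗ f :- r :- m ⊗ f ⊗ f))
                ⊕ (f ⊗ f :- f) ⊗ (m :- (r ⊕ e)) ⊕ :1 ⊗ (f ⊗ (f :- :1) ⊗ e :- j ⊗ r) ⊕ (⊝ r) ⊗ (β :- (f ⊕ f ⊕ ((f :- :1) ⊗ (f :- :1) ⊕ j))))
                refl mₖ eₖ φ b ρ (ι j) (ι β)))

            W-step : ∀ n → ι (W (suc (suc n))) + φ * φ * ι (W n) ≈ ι β * ι (W (suc n))
            W-step n = transfer (W (suc (suc n))) (W n) (W (suc n)) (W-recurrence n)
              where
              transfer : ∀ w″ w w′ → w″ ℕ.+ F ℕ.* F ℕ.* w ≡ β ℕ.* w′ → ι w″ + φ * φ * ι w ≈ ι β * ι w′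
              transfer w″ w w′ eq = trans (+-congˡ (*-congʳ (*-cong φ≈F φ≈F))) (trans (+-congˡ (trans (*-congʳ (sym (ι-* F F))) (sym (ι-* (F ℕ.* F) w))))
                (trans (sym (ι-+ w″ (F ℕ.* F ℕ.* w))) (trans (reflexive (≡.cong ι eq)) (ι-* β w′))))

            Δ : ℕ → Carrier
            Δ i = u i + - u (nxt i)

            -- The right side of `u-step` is a sum of three consecutive differences.
            Δ-recurrence : ∀ i → suc (suc i) ≤ D → Δ i + Δ (suc i) + Δ (suc (suc i)) ≈ b * Δ (suc i)
            Δ-recurrence i le = begin
              Δ i + Δ (suc i) + Δ (suc (suc i))
                ≈⟨ +-congʳ (+-cong (+-congˡ (-‿cong (reflexive (≡.cong u (nxt-< (ℕₚ.<-trans (ℕₚ.n<1+n i) le))))))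
                                   (+-congˡ (-‿cong (reflexive (≡.cong u (nxt-< le)))))) ⟩
              (u i + - u (suc i)) + (u (suc i) + - u (suc (suc i))) + Δ (suc (suc i))
                ≈⟨ solve 4 (λ p q r s → (p :- q) ⊕ (q :- r) ⊕ (r :- s) ⊜ p :- s) refl (u i) (u (suc i)) (u (suc (suc i))) (u (nxt (suc (suc i)))) ⟩
              u i + - u (nxt (suc (suc i)))
                ≈⟨ u-step i le ⟨
              b * (u (suc i) + - u (suc (suc i)))
                ≈⟨ *-congˡ (+-congˡ (-‿cong (reflexive (≡.cong u (nxt-< le))))) ⟨
              b * Δ (suc i) ∎

            -- The recurrence run backwards from Δ D = 0.
            Δ-ratio : ∀ n i → i ℕ.+ suc n ≡ D → φ * ι (W n) * Δ i + ι (W (suc n)) * Δ (suc i) ≈ 0#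
            Δ-ratio zero i eq = trans (+-cong (trans (*-congʳ (zeroʳ φ)) (zeroˡ _)) (trans (*-congˡ Δ-D) (zeroʳ _))) (+-identityˡ 0#)
              where
              Δ-D : Δ (suc i) ≈ 0#
              Δ-D = x≈y⇒x∙y⁻¹≈ε (reflexive (≡.cong u (≡.sym (≡.subst (λ j → nxt j ≡ j) (≡.trans (≡.sym eq) (ℕₚ.+-comm i 1)) nxt-D))))
            Δ-ratio (suc n) i eq = step (W n) (W (suc n)) (W (suc (suc n))) (Δ-ratio n (suc i) (≡.trans (≡.sym (ℕₚ.+-suc i (suc n))) eq)) (W-step n)
              where
              step : ∀ w w′ w″ → φ * ι w * Δ (suc i) + ι w′ * Δ (suc (suc i)) ≈ 0# → ι w″ + φ * φ * ι w ≈ ι β * ι w′ →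
                φ * ι w′ * Δ i + ι w″ * Δ (suc i) ≈ 0#
              step w w′ w″ ih rec = by-linear₄ (φ * ι w′) (- (ι w′ * Δ (suc i))) (- φ) (Δ (suc i))
                (Δ-recurrence i (≡.subst (suc (suc i) ≤_) (≡.trans (≡.sym (≡.trans (ℕₚ.+-suc i (suc n)) (≡.cong suc (ℕₚ.+-suc i n)))) eq) (s≤s (s≤s (ℕₚ.m≤m+n i n)))))
                φ[1-b] ih rec
                (solve 9 (λ f b w w′ w″ p q r β → f ⊗ w′ ⊗ p ⊕ w″ ⊗ q ⊜ Κ (+ 0)
                  ⊕ f ⊗ w′ ⊗ (p ⊕ q ⊕ r :- b ⊗ q) ⊕ (⊝ (w′ ⊗ q)) ⊗ (f ⊗ (:1 :- b) :- β)
                  ⊕ (⊝ f) ⊗ (f ⊗ w ⊗ q ⊕ w′ ⊗ r :- Κ (+ 0)) ⊕ q ⊗ (w″ ⊕ f ⊗ f ⊗ w :- β ⊗ w′))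
                  refl φ b (ι w) (ι w′) (ι w″) (Δ i) (Δ (suc i)) (Δ (suc (suc i))) (ι β))

          larger-diameter : ∀ n → D ≡ 4 ℕ.+ n → ⊥
          larger-diameter n D≡ = larger-diameter-impossible {F} {q} {h} {s} {R} {M} {g} F≡ q≥1 ≡.refl M≡ R≥1 mg keyℕ n
              (conclude (W (3 ℕ.+ n)) (W (2 ℕ.+ n)) (Δ-ratio (2 ℕ.+ n) 1 (≡.sym D≡)))
            where
            -- At the near end Δ 1 = 1 and Δ 2 = x, and mφx = -ρ turns the ratio into one of natural
            -- numbers.
            conclude : ∀ w′ w → φ * ι w * Δ 1 + ι w′ * Δ 2 ≈ 0# → w′ ℕ.* R ≡ F ℕ.* F ℕ.* M ℕ.* w
            conclude w′ w eq = ι-injective (w′ ℕ.* R) (F ℕ.* F ℕ.* M ℕ.* w) (trans (ι-* w′ R) (trans field-eq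
              (trans (*-congʳ (trans (*-congʳ (trans (*-cong φ≈F φ≈F) (sym (ι-* F F)))) (sym (ι-* (F ℕ.* F) M)))) (sym (ι-* (F ℕ.* F ℕ.* M) w)))))
              where
              Δ₁ : Δ 1 ≈ 1#
              Δ₁ = trans (+-congˡ (-‿cong (reflexive (≡.cong u nxt-1)))) norm
              Δ₂ : Δ 2 ≈ x
              Δ₂ = +-congˡ (-‿cong (reflexive (≡.cong u nxt-2)))
              field-eq : ι w′ * ρ ≈ φ * φ * mₖ * ι w
              field-eq = by-linear₃ (- (mₖ * φ)) (ι w′) (- ι w′)
                (trans (+-cong (*-congˡ (sym Δ₁)) (*-congˡ (sym Δ₂))) eq) m[1+φx] m≈
                (solve 7 (λ w w′ f m e x r → w′ ⊗ r ⊜ f ⊗ f ⊗ m ⊗ w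
                  ⊕ (⊝ (m ⊗ f)) ⊗ (f ⊗ w ⊗ :1 ⊕ w′ ⊗ x :- Κ (+ 0)) ⊕ w′ ⊗ (m ⊗ (:1 ⊕ f ⊗ x) :- e) ⊕ (⊝ w′) ⊗ (m :- (r ⊕ e)))
                  refl (ι w) (ι w′) φ mₖ eₖ x ρ)

          large-impossible : ⊥
          large-impossible with ≤D-cases 3≤D
          ... | inj₁ 4≤D = larger-diameter (D ℕ.∸ 4) (≡.sym (ℕₚ.m+[n∸m]≡n 4≤D))
          ... | inj₂ e   = diameter-3 (≡.sym e)

        odd : Odd
        odd = compare (ℕₚ.≤-total g′ (suc g))
          where
          above : ∀ F → suc g ℕ.+ F ≡ g′ → 0 < F → Odd
          above (suc zero)    eq _ = odd-case (≡.trans (≡.sym eq) (ℕₚ.+-comm (suc g) 1))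
          above (suc (suc q)) eq _ = ⊥-elim (Large.large-impossible (suc (suc q)) (suc q) ≡.refl (s≤s z≤n) (≡.sym eq))
          compare : g′ ≤ suc g ⊎ suc g ≤ g′ → Odd
          compare (inj₁ le) = ⊥-elim (nonpositive-impossible (suc g ℕ.∸ g′) (ℕₚ.m+[n∸m]≡n le))
          compare (inj₂ le) with ℕₚ.m≤n⇒m<n∨m≡n le
          ... | inj₁ lt = above (g′ ℕ.∸ suc g) (ℕₚ.m+[n∸m]≡n le) (ℕₚ.m<n⇒0<n∸m lt)
          ... | inj₂ e  = ⊥-elim (nonpositive-impossible 0 (≡.trans (ℕₚ.+-identityʳ g′) (≡.sym e)))

-- The numerical data of the Odd graph.

module OddParametersConstruction where
  open Summation
  open FieldTools
  open GraphMetric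
  open Counting
  open AlmostBipartite
  open BalancedSequenceConstruction
  open LocalCounting
  open DistanceEquations
  open EliminationOfUnknowns
  open ParameterRigidity
  open import Data.Bool using (Bool; true; false; if_then_else_)
  open import Data.Nat as ℕ using (ℕ; zero; suc; _≤_; _<_; _≡ᵇ_; z≤n)
  import Data.Nat.Properties as ℕₚ
  open import Data.Integer as ℤ using (+_)
  open import Data.Fin using (_≟_)
  open import Data.Product using (_,_; proj₁; proj₂; ∃)
  open import Data.Sum using (_⊎_; inj₁; inj₂)
  import Data.Sum as Sum
  open import Relation.Nullary using (¬_)
  open import Relation.Nullary.Decidable using (decidable-stable; _⊎-dec_)
  open import Relation.Binary.PropositionalEquality as ≡ using (_≡_)
  open import Tactic.RingSolver.Core.Expression using (_⊕_; _⊗_; ⊝_)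

  module OddSequence (G : Graph) (conn : Connected G) (D k : ℕ)
    (dr : DistanceRegular G D) (ab : AlmostBipartite G D) (3≤D : 3 ≤ D) (val : Valency G k) (girth : Girth G 6)
    (3≤k : 3 ≤ k) where

    open LocalCounts G conn D k dr ab 3≤D val girth 3≤k

    -- In the Odd graph ν i is the size of the difference of two vertices at distance i.
    alternating : ℕ → ℕ → ℕ
    alternating zero          j = j
    alternating (suc zero)    j = D ℕ.∸ j
    alternating (suc (suc i)) j = alternating i (suc j)

    ν : ℕ → ℕ
    ν i = alternating i 0

    alternating-even : ∀ i j → alternating (i ℕ.+ i) j ≡ i ℕ.+ j
    alternating-even zero    j = ≡.refl
    alternating-even (suc i) j = ≡.trans (≡.cong (λ a → alternating (suc a) j) (ℕₚ.+-suc i i))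
      (≡.trans (alternating-even i (suc j)) (ℕₚ.+-suc i j))

    alternating-odd : ∀ i j → alternating (suc (i ℕ.+ i)) j ≡ D ℕ.∸ (i ℕ.+ j)
    alternating-odd zero    j = ≡.refl
    alternating-odd (suc i) j = ≡.trans (≡.cong (λ a → alternating (suc (suc a)) j) (ℕₚ.+-suc i i))
      (≡.trans (alternating-odd i (suc j)) (≡.cong (D ℕ.∸_) (ℕₚ.+-suc i j)))

    -- Each field is a family of decidable statements about natural numbers, which is why `stable`
    -- can remove the double negation. The last two are the eigenvalue equation, with eigenvalue -D,
    -- and the balanced set condition, with factor -2, written without subtraction.
    record OddParameters : Set where
      field
        k≡      : k ≡ suc D
        c₃≡     : c₃ ≡ 2
        ν≡0⇒≡0  : ∀ {i} → i ≤ D → ν i ≡ 0 → i ≡ 0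
        ν≡D⇒≡1  : ∀ {i} → i ≤ D → ν i ≡ D → i ≡ 1
        ν-edge  : ∀ {i} → i ≤ D → ν i ℕ.+ ν (nxt i) ≡ D ⊎ ν i ℕ.+ ν (nxt i) ≡ suc D
        ν-neighbours : ∀ x v → ℕSum.sumIf (λ z → d x z ≡ᵇ 1) (λ z → ν (d z v)) ℕ.+ D ℕ.* ν (d x v) ≡ D ℕ.* suc D
        ν-balanced : ∀ {x y} v → d x y ≡ 3 →
          ℕSum.sumIf (sphere² x y 1 2) (λ z → ν (d z v)) ℕ.+ (ν (d x v) ℕ.+ ν (d x v)) ≡
          ℕSum.sumIf (sphere² x y 2 1) (λ z → ν (d z v)) ℕ.+ (ν (d y v) ℕ.+ ν (d y v))

    stable : ¬ ¬ OddParameters → OddParameters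
    stable h = record
      { k≡ = decidable-stable (_ ℕ.≟ _) (λ ne → h (λ p → ne (k≡ p)))
      ; c₃≡ = decidable-stable (_ ℕ.≟ _) (λ ne → h (λ p → ne (c₃≡ p)))
      ; ν≡0⇒≡0 = λ le e → decidable-stable (_ ℕ.≟ _) (λ ne → h (λ p → ne (ν≡0⇒≡0 p le e)))
      ; ν≡D⇒≡1 = λ le e → decidable-stable (_ ℕ.≟ _) (λ ne → h (λ p → ne (ν≡D⇒≡1 p le e)))
      ; ν-edge = λ le → decidable-stable ((_ ℕ.≟ _) ⊎-dec (_ ℕ.≟ _)) (λ ne → h (λ p → ne (ν-edge p le)))
      ; ν-neighbours = λ x v → decidable-stable (_ ℕ.≟ _) (λ ne → h (λ p → ne (ν-neighbours p x v)))
      ; ν-balanced = λ v e → decidable-stable (_ ℕ.≟ _) (λ ne → h (λ p → ne (ν-balanced p v e)))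
      }
      where open OddParameters

  module FromOdd {c ℓ} (F : CharZeroField c ℓ) (G : Graph) (conn : Connected G) (D k : ℕ)
    (dr : DistanceRegular G D) (ab : AlmostBipartite G D) (3≤D : 3 ≤ D) (val : Valency G k) (girth : Girth G 6)
    (3≤k : 3 ≤ k) (B : BalancedSequences.BalancedSequence F G conn D k dr ab 3≤D val girth) where

    open LocalCounts G conn D k dr ab 3≤D val girth 3≤k
    open OddSequence G conn D k dr ab 3≤D val girth 3≤k
    open Field F
    open Equations F G conn D k dr ab 3≤D val girth 3≤k B using (sumIf-const; #N; eq-eigen₀; C; K)
    open BalancedSequences F G conn D k dr ab 3≤D val girth using (module BalancedSequence)
    open BalancedSequence B
    open Elimination F G conn D k dr ab 3≤D val girth 3≤k B using (b; x; t≈; K≈; C≈; C≈γb; M≢0)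
    open Rigidity F G conn D k dr ab 3≤D val girth 3≤k B using (module Solved)

    module _ (norm : u 1 + - u 2 ≈ 1#) {M h : ℕ} (k≡₂ : k ≡ suc (suc M)) (c₃≡₂ : c₃ ≡ suc (suc h))
      (h≡0 : h ≡ 0) (b≈ : b ≈ - 1#) (mx≈ : ι M * x ≈ 1# + - ι M) where
      private
        m : Carrier
        m = ι M

        m≉0 : ¬ m ≈ 0#
        m≉0 = ι≉0 (M≢0 norm k≡₂ c₃≡₂)

        -- The affine image of u with w₀ = 0 and w₂ = 1; it will coincide with ν.
        w : ℕ → Carrier
        w i = m * (u i + - u 0)

        w-injective : ∀ {i j} → i ≤ D → j ≤ D → w i ≈ w j → i ≡ j
        w-injective {i} {j} i≤D j≤D e = distinct i≤D j≤D (by-linear₁ 1# (*-cancelˡ-≉0 m≉0 e)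
          (solve 3 (λ p q r → p ⊜ q ⊕ :1 ⊗ (p :- r :- (q :- r))) refl (u i) (u j) (u 0)))

        w₀ : w 0 ≈ 0#
        w₀ = trans (*-congˡ (-‿inverseʳ (u 0))) (zeroʳ m)

        w₁ : w 1 ≈ 1# + m
        w₁ = by-linear₃ m (- m) 1# norm b≈ mx≈
          (solve 5 (λ m p q r s → m ⊗ (q :- p) ⊜ :1 ⊕ m ⊕ m ⊗ (q :- r :- :1) ⊕ (⊝ m) ⊗ (p :- s :- ⊝ :1) ⊕ :1 ⊗ (m ⊗ (r :- s) :- (:1 :- m)))
            refl m (u 0) (u 1) (u 2) (u 3))

        w₂ : w 2 ≈ 1#
        w₂ = by-linear₂ (- m) 1# b≈ mx≈
          (solve 4 (λ m p r s → m ⊗ (r :- p) ⊜ :1 ⊕ (⊝ m) ⊗ (p :- s :- ⊝ :1) ⊕ :1 ⊗ (m ⊗ (r :- s) :- (:1 :- m)))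
            refl m (u 0) (u 2) (u 3))

        -- For b = -1, `u-step` says that the sum of two consecutive values of w does not change
        -- when both indices grow by 2; these are the initial sums k - 1 and k.
        σ : ℕ → Carrier
        σ zero          = 1# + m
        σ (suc zero)    = 1# + (1# + m)
        σ (suc (suc i)) = σ i

        w-sum : ∀ i → i ≤ D → w i + w (nxt i) ≈ σ i
        w-sum zero _ = trans (+-cong w₀ (trans (reflexive (≡.cong w nxt-0)) w₁)) (+-identityˡ _)
        w-sum (suc zero) _ = trans (+-cong w₁ (trans (reflexive (≡.cong w nxt-1)) w₂)) (+-comm _ _)
        w-sum (suc (suc i)) le = trans (by-linear₂ m (- (m * (u (suc i) + - u (suc (suc i))))) (Solved.u-step norm k≡₂ c₃≡₂ i le) b≈
          (solve 7 (λ m b a p q r s → m ⊗ (r :- a) ⊕ m ⊗ (s :- a) ⊜ m ⊗ (p :- a) ⊕ m ⊗ (q :- a)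
            ⊕ m ⊗ (b ⊗ (q :- r) :- (p :- s)) ⊕ (⊝ (m ⊗ (q :- r))) ⊗ (b :- ⊝ :1)) refl m b (u 0) (u i) (u (suc i)) (u (suc (suc i))) (u (nxt (suc (suc i))))))
          (trans (+-congˡ (reflexive (≡.cong w (≡.sym (nxt-< i<D))))) (w-sum i (ℕₚ.<⇒≤ i<D)))
          where
          i<D : i < D
          i<D = ℕₚ.<-trans (ℕₚ.n<1+n i) le

        w-suc : ∀ i → suc i ≤ D → w (suc i) ≈ σ i + - w i
        w-suc i le = by-linear₁ 1# (trans (+-congˡ (reflexive (≡.cong w (≡.sym (nxt-< le))))) (w-sum i (ℕₚ.<⇒≤ le)))
          (solve 3 (λ a b s → b ⊜ s :- a ⊕ :1 ⊗ (a ⊕ b :- s)) refl (w i) (w (suc i)) (σ i))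

        σ-even : ∀ j → σ (j ℕ.+ j) ≈ 1# + m
        σ-even zero    = refl
        σ-even (suc j) = trans (reflexive (≡.cong (λ a → σ (suc a)) (ℕₚ.+-suc j j))) (σ-even j)

        σ-odd : ∀ j → σ (suc (j ℕ.+ j)) ≈ 1# + (1# + m)
        σ-odd zero    = refl
        σ-odd (suc j) = trans (reflexive (≡.cong (λ a → σ (suc (suc a))) (ℕₚ.+-suc j j))) (σ-odd j)

        w-even : ∀ j → j ℕ.+ j ≤ D → w (j ℕ.+ j) ≈ ι j
        w-odd  : ∀ j → suc (j ℕ.+ j) ≤ D → w (suc (j ℕ.+ j)) ≈ 1# + m + - ι j
        w-even zero    _  = w₀
        w-even (suc j) le = trans (reflexive (≡.cong (λ a → w (suc a)) (ℕₚ.+-suc j j)))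
          (trans (w-suc (suc (j ℕ.+ j)) le′) (trans (+-cong (σ-odd j) (-‿cong (w-odd j (ℕₚ.<⇒≤ le′))))
            (solve 2 (λ m j → :1 ⊕ (:1 ⊕ m) :- (:1 ⊕ m :- j) ⊜ :1 ⊕ j) refl m (ι j))))
          where
          le′ : suc (suc (j ℕ.+ j)) ≤ D
          le′ = ≡.subst (λ a → suc a ≤ D) (ℕₚ.+-suc j j) le
        w-odd j le = trans (w-suc (j ℕ.+ j) le) (+-cong (σ-even j) (-‿cong (w-even j (ℕₚ.<⇒≤ le))))

        parity : ∀ i → ∃ λ j → i ≡ j ℕ.+ j ⊎ i ≡ suc (j ℕ.+ j)
        parity zero = 0 , inj₁ ≡.refl
        parity (suc i) with parity i
        ... | j , inj₁ e = j , inj₂ (≡.cong suc e)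
        ... | j , inj₂ e = suc j , inj₁ (≡.cong suc (≡.trans e (≡.sym (ℕₚ.+-suc j j))))

        w-D : w D + w D ≈ σ D
        w-D = trans (+-congˡ (reflexive (≡.cong w (≡.sym nxt-D)))) (w-sum D ℕₚ.≤-refl)

        -- Since `nxt D` is D, the last of these sums is 2w_D. Comparison with the closed form of w
        -- gives D = k - 1 for either parity.
        D≡1+M : D ≡ suc M
        D≡1+M with parity D
        ... | j , inj₁ e = ≡.trans e (ι-injective (j ℕ.+ j) (suc M) (trans (ι-+ j j)
          (trans (sym (+-cong wD wD)) (trans w-D (trans (reflexive (≡.cong σ e)) (σ-even j))))))
          where
          wD : w D ≈ ι j
          wD = trans (reflexive (≡.cong w e)) (w-even j (ℕₚ.≤-reflexive (≡.sym e)))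
        ... | j , inj₂ e = ≡.trans e (≡.cong suc (ι-injective (j ℕ.+ j) M (trans (ι-+ j j) (by-linear₁ (- 1#)
            (trans (sym (+-cong wD wD)) (trans w-D (trans (reflexive (≡.cong σ e)) (σ-odd j))))
            (solve 2 (λ m j → j ⊕ j ⊜ m ⊕ (⊝ :1) ⊗ ((:1 ⊕ m :- j) ⊕ (:1 ⊕ m :- j) :- (:1 ⊕ (:1 ⊕ m)))) refl m (ι j))))))
          where
          wD : w D ≈ 1# + m + - ι j
          wD = trans (reflexive (≡.cong w e)) (w-odd j (ℕₚ.≤-reflexive (≡.sym e)))

        ιD≈ : ι D ≈ 1# + m
        ιD≈ = reflexive (≡.cong ι D≡1+M)

        w≈ν : ∀ i → i ≤ D → w i ≈ ι (ν i)
        w≈ν i le with parity i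
        ... | j , inj₁ e = trans (reflexive (≡.cong w e)) (trans (w-even j (≡.subst (_≤ D) e le))
          (reflexive (≡.cong ι (≡.sym (≡.trans (≡.cong ν e) (≡.trans (alternating-even j 0) (ℕₚ.+-identityʳ j)))))))
        ... | j , inj₂ e = trans (reflexive (≡.cong w e)) (trans (w-odd j (≡.subst (_≤ D) e le))
          (trans (by-linear₁ (- 1#) (trans (sym (ι-+ j (D ℕ.∸ j))) (trans (reflexive (≡.cong ι (ℕₚ.m+[n∸m]≡n j≤D))) ιD≈))
            (solve 3 (λ m j r → :1 ⊕ m :- j ⊜ r ⊕ (⊝ :1) ⊗ (j ⊕ r :- (:1 ⊕ m))) refl m (ι j) (ι (D ℕ.∸ j))))
            (reflexive (≡.cong ι (≡.sym νi)))))
          where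
          j≤D : j ≤ D
          j≤D = ℕₚ.≤-trans (ℕₚ.≤-trans (ℕₚ.m≤m+n j j) (ℕₚ.n≤1+n _)) (≡.subst (_≤ D) e le)
          νi : ν i ≡ D ℕ.∸ j
          νi = ≡.trans (≡.cong ν e) (≡.trans (alternating-odd j 0) (≡.cong (D ℕ.∸_) (ℕₚ.+-identityʳ j)))

        ν₁ : ν 1 ≡ D
        ν₁ = ≡.refl

        1≤D : 1 ≤ D
        1≤D = ℕₚ.<⇒≤ 1<D

        t≈-m : t ≈ - (1# + m)
        t≈-m = by-linear₄ 1# x 1# 1# (t≈ norm k≡₂ c₃≡₂) (K≈ norm k≡₂ c₃≡₂) b≈ mx≈
          (solve 5 (λ t k m b x → t ⊜ ⊝ (:1 ⊕ m) ⊕ :1 ⊗ (t :- (k ⊗ x ⊕ b :- (x ⊕ x) :- :1)) ⊕ x ⊗ (k :- (:1 ⊕ (:1 ⊕ m)))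
            ⊕ :1 ⊗ (b :- ⊝ :1) ⊕ :1 ⊗ (m ⊗ x :- (:1 :- m))) refl t K m b x)

        γ≈-2 : γ ≈ - (1# + 1#)
        γ≈-2 = by-linear₄ (- 1#) 1# γ (- 1#) (C≈ norm k≡₂ c₃≡₂) (C≈γb norm k≡₂ c₃≡₂) b≈ e≈1
          (solve 4 (λ g c b e → g ⊜ ⊝ (:1 ⊕ :1) ⊕ (⊝ :1) ⊗ (c :- (:1 ⊕ e)) ⊕ :1 ⊗ (c :- g ⊗ b) ⊕ g ⊗ (b :- ⊝ :1) ⊕ (⊝ :1) ⊗ (e :- :1))
            refl γ C b (ι (suc h)))
          where
          e≈1 : ι (suc h) ≈ 1#
          e≈1 = trans (reflexive (≡.cong (λ j → ι (suc j)) h≡0)) ι-1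

        wd≈ν : ∀ x v → w (d x v) ≈ ι (ν (d x v))
        wd≈ν x v = w≈ν (d x v) (d≤D x v)

        ι-sumIf : ∀ (P : X → Bool) v →
          ι (ℕSum.sumIf P (λ z → ν (d z v))) ≈ m * (sumIf P (λ z → u (d z v)) + - (ι (# P) * u 0))
        ι-sumIf P v = begin
          ι (ℕSum.sumIf P (λ z → ν (d z v)))
            ≈⟨ ι-sumFin (λ z → if P z then ν (d z v) else 0) ⟩
          sumFin (λ z → ι (if P z then ν (d z v) else 0))
            ≈⟨ sumFin-cong (λ z → pointwise z (P z)) ⟩
          sumFin (λ z → m * ((if P z then u (d z v) else 0#) + - 1# * (if P z then u 0 else 0#)))
            ≈⟨ *-distribˡ-sumFin m _ ⟨
          m * sumFin (λ z → (if P z then u (d z v) else 0#) + - 1# * (if P z then u 0 else 0#))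
            ≈⟨ *-congˡ (trans (sumFin-+ _ _) (+-congˡ (trans (sym (*-distribˡ-sumFin (- 1#) _))
                 (trans (*-congˡ (sumIf-const P (λ _ _ → refl))) (solve 1 (λ a → (⊝ :1) ⊗ a ⊜ ⊝ a) refl (ι (# P) * u 0)))))) ⟩
          m * (sumIf P (λ z → u (d z v)) + - (ι (# P) * u 0)) ∎
          where
          pointwise : ∀ z p → ι (if p then ν (d z v) else 0) ≈ m * ((if p then u (d z v) else 0#) + - 1# * (if p then u 0 else 0#))
          pointwise z true  = trans (sym (wd≈ν z v)) (*-congˡ (+-congˡ (solve 1 (λ a → ⊝ a ⊜ (⊝ :1) ⊗ a) refl (u 0))))
          pointwise z false = sym (trans (*-congˡ (trans (+-identityˡ _) (zeroʳ _))) (zeroʳ m))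

      oddParameters : OddParameters
      oddParameters = record
        { k≡ = ≡.trans k≡₂ (≡.cong suc (≡.sym D≡1+M))
        ; c₃≡ = ≡.trans c₃≡₂ (≡.cong (λ j → suc (suc j)) h≡0)
        ; ν≡0⇒≡0 = λ {i} le e → w-injective le z≤n (trans (w≈ν i le) (trans (reflexive (≡.cong ι e)) (sym w₀)))
        ; ν≡D⇒≡1 = λ {i} le e → w-injective le 1≤D (trans (w≈ν i le) (trans (reflexive (≡.cong ι (≡.trans e (≡.sym ν₁)))) (sym (w≈ν 1 1≤D))))
        ; ν-edge = λ {i} le → edge i le
        ; ν-neighbours = neighbours
        ; ν-balanced = balancedν
        }
        where
        σ-cases : ∀ i → σ i ≈ ι D ⊎ σ i ≈ ι (suc D)
        σ-cases zero          = inj₁ (sym ιD≈)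
        σ-cases (suc zero)    = inj₂ (+-congˡ (sym ιD≈))
        σ-cases (suc (suc i)) = σ-cases i
        edge : ∀ i → i ≤ D → ν i ℕ.+ ν (nxt i) ≡ D ⊎ ν i ℕ.+ ν (nxt i) ≡ suc D
        edge i le = Sum.map to to (σ-cases i)
          where
          to : ∀ {j} → σ i ≈ ι j → ν i ℕ.+ ν (nxt i) ≡ j
          to {j} h = ι-injective (ν i ℕ.+ ν (nxt i)) j (trans (ι-+ (ν i) (ν (nxt i)))
            (trans (sym (+-cong (w≈ν i le) (w≈ν (nxt i) (nxt≤D le)))) (trans (w-sum i le) h)))
        neighbours : ∀ x v → ℕSum.sumIf (λ z → d x z ≡ᵇ 1) (λ z → ν (d z v)) ℕ.+ D ℕ.* ν (d x v) ≡ D ℕ.* suc D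
        neighbours y v = ι-injective (S ℕ.+ D ℕ.* ν (d y v)) (D ℕ.* suc D) (begin
          ι (S ℕ.+ D ℕ.* ν (d y v))
            ≈⟨ trans (ι-+ S (D ℕ.* ν (d y v))) (+-congˡ (ι-* D (ν (d y v)))) ⟩
          ι S + ι D * ι (ν (d y v))
            ≈⟨ +-cong (trans (ι-sumIf (λ z → d y z ≡ᵇ 1) v) (*-congˡ (+-cong (eigen y v) (-‿cong (*-congʳ (#N y))))))
                      (*-cong ιD≈ (sym (wd≈ν y v))) ⟩
          m * (t * u (d y v) + - (K * u 0)) + (1# + m) * w (d y v)
            ≈⟨ by-linear₄ (m * (u (d y v) + - u 0)) (- m) K (1# + m) t≈-m eq-eigen₀ w₁ (K≈ norm k≡₂ c₃≡₂)
                 (solve 6 (λ m t k a p q → m ⊗ (t ⊗ p :- k ⊗ a) ⊕ (:1 ⊕ m) ⊗ (m ⊗ (p :- a)) ⊜ (:1 ⊕ m) ⊗ (:1 ⊕ (:1 ⊕ m))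
                   ⊕ m ⊗ (p :- a) ⊗ (t :- ⊝ (:1 ⊕ m)) ⊕ (⊝ m) ⊗ (k ⊗ q :- t ⊗ a) ⊕ k ⊗ (m ⊗ (q :- a) :- (:1 ⊕ m)) ⊕ (:1 ⊕ m) ⊗ (k :- (:1 ⊕ (:1 ⊕ m))))
                   refl m t K (u 0) (u (d y v)) (u 1)) ⟩
          (1# + m) * (1# + (1# + m))
            ≈⟨ *-cong ιD≈ (+-congˡ ιD≈) ⟨
          ι D * ι (suc D)
            ≈⟨ ι-* D (suc D) ⟨
          ι (D ℕ.* suc D) ∎)
          where
          S = ℕSum.sumIf (λ z → d y z ≡ᵇ 1) (λ z → ν (d z v))
        balancedν : ∀ {x y} v → d x y ≡ 3 →
          ℕSum.sumIf (sphere² x y 1 2) (λ z → ν (d z v)) ℕ.+ (ν (d x v) ℕ.+ ν (d x v)) ≡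
          ℕSum.sumIf (sphere² x y 2 1) (λ z → ν (d z v)) ℕ.+ (ν (d y v) ℕ.+ ν (d y v))
        balancedν {y} {y′} v e = ι-injective (S₁ ℕ.+ (a ℕ.+ a)) (S₂ ℕ.+ (a′ ℕ.+ a′)) (begin
          ι (S₁ ℕ.+ (a ℕ.+ a))
            ≈⟨ trans (ι-+ S₁ (a ℕ.+ a)) (+-cong (trans (ι-sumIf (sphere² y y′ 1 2) v) (*-congˡ (+-congˡ (-‿cong (*-congʳ (reflexive (≡.cong ι (#P e))))))))
                 (trans (ι-+ a a) (+-cong (sym (wd≈ν y v)) (sym (wd≈ν y v))))) ⟩
          m * (U₁ + - (C * u 0)) + (w (d y v) + w (d y v))
            ≈⟨ by-linear₂ m (m * (u (d y v) + - u (d y′ v))) (balanced y y′ v e) γ≈-2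
                 (solve 8 (λ m c a p q U V g → m ⊗ (U :- c ⊗ a) ⊕ (m ⊗ (p :- a) ⊕ m ⊗ (p :- a)) ⊜ m ⊗ (V :- c ⊗ a) ⊕ (m ⊗ (q :- a) ⊕ m ⊗ (q :- a))
                   ⊕ m ⊗ (U :- V :- g ⊗ (p :- q)) ⊕ m ⊗ (p :- q) ⊗ (g :- ⊝ (:1 ⊕ :1)))
                   refl m C (u 0) (u (d y v)) (u (d y′ v)) U₁ U₂ γ) ⟩
          m * (U₂ + - (C * u 0)) + (w (d y′ v) + w (d y′ v))
            ≈⟨ trans (ι-+ S₂ (a′ ℕ.+ a′)) (+-cong (trans (ι-sumIf (sphere² y y′ 2 1) v) (*-congˡ (+-congˡ (-‿cong (*-congʳ (reflexive (≡.cong ι (#Q e))))))))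
                 (trans (ι-+ a′ a′) (+-cong (sym (wd≈ν y′ v)) (sym (wd≈ν y′ v))))) ⟨
          ι (S₂ ℕ.+ (a′ ℕ.+ a′)) ∎)
          where
          S₁ = ℕSum.sumIf (sphere² y y′ 1 2) (λ z → ν (d z v))
          S₂ = ℕSum.sumIf (sphere² y y′ 2 1) (λ z → ν (d z v))
          U₁ = sumIf (sphere² y y′ 1 2) (λ z → u (d z v))
          U₂ = sumIf (sphere² y y′ 2 1) (λ z → u (d z v))
          a  = ν (d y v)
          a′ = ν (d y′ v)

  module QPolynomialOdd {c ℓ} (F : CharZeroField c ℓ) (G : Graph) (conn : Connected G) (D k : ℕ)
    (dr : DistanceRegular G D) (ab : AlmostBipartite G D) (3≤D : 3 ≤ D) (val : Valency G k) (girth : Girth G 6)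
    (3≤k : 3 ≤ k) where

    open LocalCounts G conn D k dr ab 3≤D val girth 3≤k
    open OddSequence G conn D k dr ab 3≤D val girth 3≤k
    open Field F
    open BalancedSequences F G conn D k dr ab 3≤D val girth
    open NormalisedSequence F G conn D k dr ab 3≤D val girth

    k≡ : k ≡ suc (suc (k ℕ.∸ 2))
    k≡ = ≡.sym (ℕₚ.m+[n∸m]≡n (ℕₚ.≤-trans (ℕₚ.n≤1+n 2) 3≤k))

    c₃≡₂ : c₃ ≡ suc (suc (c₃ ℕ.∸ 2))
    c₃≡₂ = ≡.sym (ℕₚ.m+[n∸m]≡n c₃≥2)

    fromNormalised : (B : BalancedSequence) → BalancedSequence.u B 1 + - BalancedSequence.u B 2 ≈ 1# → OddParameters
    fromNormalised B norm = FromOdd.oddParameters F G conn D k dr ab 3≤D val girth 3≤k B norm k≡ c₃≡₂ h≡0 b≈ mx≈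
      where
      open Elimination F G conn D k dr ab 3≤D val girth 3≤k B
      open Rigidity F G conn D k dr ab 3≤D val girth 3≤k B
      lt : suc (c₃ ℕ.∸ 2) < k ℕ.∸ 2
      lt = suc-h<M norm k≡ c₃≡₂
      odd : Solved.Odd norm k≡ c₃≡₂
      odd = Solved.odd norm k≡ c₃≡₂
        (proj₁ (attached norm k≡ c₃≡₂)) (proj₁ (detached norm k≡ c₃≡₂))
        (proj₂ (attached norm k≡ c₃≡₂)) (proj₂ (detached norm k≡ c₃≡₂))
        (k ℕ.∸ 2 ℕ.∸ suc (c₃ ℕ.∸ 2)) (≡.sym (ℕₚ.m∸n+n≡m (ℕₚ.<⇒≤ lt))) (ℕₚ.m<n⇒0<n∸m lt)
      open Solved.Odd odd

    oddParameters : QPolynomial F G D → OddParameters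
    oddParameters qp = stable (λ h → balancedSequence qp (λ B →
      h (fromNormalised (proj₁ (normalise B)) (proj₂ (normalise B)))))

-- Points as labels of edges, and vertices as sets of points.

module OddGraphReconstruction where
  open Summation
  open GraphMetric
  open Counting
  open AlmostBipartite
  open BoseMesnerAlgebra
  open BalancedSequenceConstruction
  open LocalCounting
  open DistanceEquations
  open EliminationOfUnknowns
  open Arithmetic
  open OddParametersConstruction
  open import Data.Bool using (Bool; true; false; _∧_; if_then_else_; not)
  open import Data.Nat as ℕ using (ℕ; zero; suc; _≤_; _<_; _≡ᵇ_; s≤s; _+_; _*_)
  import Data.Nat.Properties as ℕₚ
  open import Data.Integer as ℤ using (+_)
  open import Data.Fin using (Fin; _≟_)
  import Data.Fin as Fin
  open import Data.Product using (_×_; _,_; proj₁; proj₂; ∃)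
  open import Data.Vec as Vec using (Vec; []; _∷_)
  open import Data.Sum using (_⊎_; inj₁; inj₂)
  import Data.Sum as Sum
  open import Data.Empty using (⊥; ⊥-elim)
  open import Relation.Nullary using (Dec; does; yes; no; contradiction)
  open import Relation.Nullary.Decidable using (dec-true; dec-false)
  open import Relation.Binary.PropositionalEquality using (_≡_; _≢_; refl; sym; trans; cong; cong₂; subst; module ≡-Reasoning)
  open import Data.Fin.Subset as Subset using (Subset; ∣_∣)
  open import Data.Fin.Subset.Properties using (x∈p∩q⁺; x∈p∩q⁻)
  open import Data.Vec.Properties using (lookup∘tabulate; tabulate∘lookup; tabulate-cong; []=⇒lookup; lookup⇒[]=; toList∘fromList)
  open import Data.List using (List; []; _∷_; _++_; map; allFin; length; filterᵇ)
  open import Data.List.Properties using (length-++; length-map)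
  open import Data.List.Membership.Propositional using (_∈_)
  open import Data.List.Membership.Propositional.Properties using (∈-allFin; ∈-map⁺; ∈-++⁺ˡ; ∈-++⁺ʳ; ∈-map⁻; ∈-++⁻)
  open import Data.List.Relation.Unary.Any using (here; there)
  open import Function.Bundles using (mk⇔)
  open import Data.Nat.Tactic.RingSolver using (solve-∀)
  open import Data.Bool.Properties using (∧-zeroʳ; ∧-identityʳ; ∧-comm)

  #-all : ∀ m → # (λ (_ : Fin m) → true) ≡ m
  #-all zero    = ℕSum.sumFin≡sumOver {0} _
  #-all (suc m) = trans (ℕSum.sumFin-suc _) (cong suc (#-all m))

  #-subset : ∀ {m} {p q : Fin m → Bool} → (∀ i → p i ≡ true → q i ≡ true) → # q ≤ # p → ∀ i → q i ≡ p i
  #-subset {p = p} {q} p⊆q le i with p i in e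
  ... | true  = p⊆q i e
  ... | false = ≢true⇒≡false (λ qi → ℕₚ.<⇒≱ (strict qi) le)
    where
    q∧p≡p : ∀ j → q j ∧ p j ≡ p j
    q∧p≡p j with p j in e
    ... | true  = ∧-true⁺ (p⊆q j e) refl
    ... | false = ∧-zeroʳ (q j)
    strict : q i ≡ true → # p < # q
    strict qi = subst (# p <_) (sym (trans (#-split q p) (cong (_+ # (λ j → q j ∧ not (p j))) (#-cong q∧p≡p))))
      (ℕₚ.<-≤-trans (ℕₚ.n<1+n (# p)) (ℕₚ.≤-trans (ℕₚ.≤-reflexive (ℕₚ.+-comm 1 (# p)))
        (ℕₚ.+-monoʳ-≤ (# p) (#≥1 (λ j → q j ∧ not (p j)) (∧-true⁺ qi (cong not e))))))

  #-mono : ∀ {m} {p q : Fin m → Bool} → (∀ i → p i ≡ true → q i ≡ true) → # p ≤ # q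
  #-mono {p = p} {q} p⊆q = subst (# p ≤_) (sym (trans (#-split q p) (cong (_+ # (λ j → q j ∧ not (p j))) (#-cong q∧p≡p)))) (ℕₚ.m≤m+n (# p) _)
    where
    q∧p≡p : ∀ j → q j ∧ p j ≡ p j
    q∧p≡p j with p j in e
    ... | true  = ∧-true⁺ (p⊆q j e) refl
    ... | false = ∧-zeroʳ (q j)

  #-⊈ : ∀ {m} {p q : Fin m → Bool} → # (λ i → p i ∧ not (q i)) ≢ 0 → ∃ λ i → p i ≡ true × q i ≡ false
  #-⊈ {p = p} {q} ne with #≢0⇒∃ (λ i → p i ∧ not (q i)) ne
  ... | i , h = i , proj₁ (∧-true⁻ {p i} h) , not-true (proj₂ (∧-true⁻ {p i} h))
    where
    not-true : ∀ {a} → not a ≡ true → a ≡ false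
    not-true {false} _ = refl

  ∣tabulate∣ : ∀ {m} (f : Fin m → Bool) → ∣ Vec.tabulate f ∣ ≡ # f
  ∣tabulate∣ {zero}  f = sym (ℕSum.sumFin≡sumOver _)
  ∣tabulate∣ {suc m} f with f Fin.zero in e
  ... | true  = trans (cong suc (∣tabulate∣ (λ i → f (Fin.suc i)))) (sym (trans (ℕSum.sumFin-suc _) (cong (λ b → (if b then 1 else 0) + # (λ i → f (Fin.suc i))) e)))
  ... | false = trans (∣tabulate∣ (λ i → f (Fin.suc i))) (sym (trans (ℕSum.sumFin-suc _) (cong (λ b → (if b then 1 else 0) + # (λ i → f (Fin.suc i))) e)))

  module _ {A : Set} where
    #-lookup : ∀ {m} (es : Vec A m) (p : A → Bool) →
      # (λ i → p (Vec.lookup es i)) ≡ ℕSum.sumOver (Vec.toList es) (λ e → if p e then 1 else 0)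
    #-lookup []       p = ℕSum.sumFin≡sumOver _
    #-lookup (e ∷ es) p = trans (ℕSum.sumFin-suc _) (cong ((if p e then 1 else 0) ℕ.+_) (#-lookup es p))

    ∈-toList⇒lookup : ∀ {m} (es : Vec A m) {e} → e ∈ Vec.toList es → ∃ λ i → Vec.lookup es i ≡ e
    ∈-toList⇒lookup (_ ∷ es) (here refl) = Fin.zero , refl
    ∈-toList⇒lookup (_ ∷ es) (there e∈)    with ∈-toList⇒lookup es e∈
    ... | i , eq = Fin.suc i , eq

    lookup∈toList : ∀ {m} (es : Vec A m) i → Vec.lookup es i ∈ Vec.toList es
    lookup∈toList (_ ∷ es) Fin.zero    = here refl
    lookup∈toList (_ ∷ es) (Fin.suc i) = there (lookup∈toList es i)

    vectorise : ∀ {m} (L : List A) → length L ≡ m → ∃ λ (es : Vec A m) → Vec.toList es ≡ L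
    vectorise L refl = Vec.fromList L , toList∘fromList L

    ∈-filterᵇ⁺ : ∀ (p : A → Bool) {xs x} → x ∈ xs → p x ≡ true → x ∈ filterᵇ p xs
    ∈-filterᵇ⁺ p {y ∷ xs} (here refl) h rewrite h = here refl
    ∈-filterᵇ⁺ p {y ∷ xs} (there x∈)    h with p y
    ... | true  = there (∈-filterᵇ⁺ p x∈ h)
    ... | false = ∈-filterᵇ⁺ p x∈ h

    ∈-filterᵇ⁻ : ∀ (p : A → Bool) xs {x} → x ∈ filterᵇ p xs → p x ≡ true
    ∈-filterᵇ⁻ p (y ∷ xs) x∈ with p y in e
    ∈-filterᵇ⁻ p (y ∷ xs) (here refl) | true = e
    ∈-filterᵇ⁻ p (y ∷ xs) (there x∈)    | true = ∈-filterᵇ⁻ p xs x∈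
    ∈-filterᵇ⁻ p (y ∷ xs) x∈            | false = ∈-filterᵇ⁻ p xs x∈

    sumOver-filterᵇ : ∀ (p q : A → Bool) xs → ℕSum.sumOver (filterᵇ p xs) (λ x → if q x then 1 else 0) ≡
      ℕSum.sumOver xs (λ x → if p x ∧ q x then 1 else 0)
    sumOver-filterᵇ p q []       = refl
    sumOver-filterᵇ p q (x ∷ xs) with p x
    ... | true  = cong ((if q x then 1 else 0) ℕ.+_) (sumOver-filterᵇ p q xs)
    ... | false = sumOver-filterᵇ p q xs

    length-filterᵇ : ∀ (p : A → Bool) xs → length (filterᵇ p xs) ≡ ℕSum.sumOver xs (λ x → if p x then 1 else 0)
    length-filterᵇ p []       = refl
    length-filterᵇ p (x ∷ xs) with p x
    ... | true  = cong suc (length-filterᵇ p xs)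
    ... | false = length-filterᵇ p xs

  module Reconstruction (G : Graph) (conn : Connected G) (D k : ℕ)
    (dr : DistanceRegular G D) (ab : AlmostBipartite G D) (3≤D : 3 ≤ D) (val : Valency G k) (girth : Girth G 6)
    (3≤k : 3 ≤ k) (params : OddSequence.OddParameters G conn D k dr ab 3≤D val girth 3≤k) where

    open LocalCounts G conn D k dr ab 3≤D val girth 3≤k
    open OddSequence G conn D k dr ab 3≤D val girth 3≤k
    open OddParameters params

    ν₀ : ∀ {x y} → d x y ≡ 0 → ν (d x y) ≡ 0
    ν₀ e = cong ν e

    ν₁ : ∀ {x y} → d x y ≡ 1 → ν (d x y) ≡ D
    ν₁ e = cong ν e

    ν₂ : ∀ {x y} → d x y ≡ 2 → ν (d x y) ≡ 1
    ν₂ e = cong ν e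

    -- In the Odd graph `ν (d x v)` counts the points of v outside x. For disjoint x and z the two
    -- counts add up to D, plus 1 if v contains the point outside both.
    weight : X → X → X → ℕ
    weight x z v = ν (d x v) + ν (d z v)

    -- In the Odd graph the edge xz corresponds to the only point outside x and z, and label x z v
    -- says whether v contains that point.
    label : X → X → X → Bool
    label x z v = weight x z v ≡ᵇ suc D

    label-sym : ∀ x z v → label x z v ≡ label z x v
    label-sym x z v = cong (_≡ᵇ suc D) (ℕₚ.+-comm (ν (d x v)) (ν (d z v)))

    weight-cases : ∀ {x z} v → d x z ≡ 1 → weight x z v ≡ D ⊎ weight x z v ≡ suc D
    weight-cases {x} {z} v xz with neighbour-distance v xz
    ... | inj₂ e = Sum.map (trans (cong (λ j → ν (d x v) + ν j) e)) (trans (cong (λ j → ν (d x v) + ν j) e)) (ν-edge (d≤D x v))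
    ... | inj₁ e = Sum.map (trans eq) (trans eq) (ν-edge (d≤D z v))
      where
      eq : weight x z v ≡ ν (d z v) + ν (nxt (d z v))
      eq = trans (ℕₚ.+-comm (ν (d x v)) (ν (d z v)))
        (cong (λ j → ν (d z v) + ν j) (sym (trans (nxt-< (subst (_≤ D) (sym e) (d≤D x v))) e)))

    label-end : ∀ {x z} → d x z ≡ 1 → label x z x ≡ false
    label-end {x} {z} xz = ≡ᵇ-false⁺ (λ e → ℕₚ.<⇒≢ (ℕₚ.n<1+n D)
      (trans (sym (cong₂ ℕ._+_ (ν₀ (d-refl x)) (ν₁ (d-flip xz)))) e))

    label-other : ∀ {x z y} → d x z ≡ 1 → d x y ≡ 1 → y ≢ z → label x z y ≡ true
    label-other {x} {z} {y} xz xy y≢z = ≡ᵇ-true⁺ (trans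
      (cong₂ ℕ._+_ (ν₁ xy) (ν₂ (no-triangle (d-flip xz) xy (λ e → y≢z (sym e))))) (ℕₚ.+-comm D 1))

    weight-label : ∀ {x z} v → d x z ≡ 1 → weight x z v ≡ D + (if label x z v then 1 else 0)
    weight-label {x} {z} v xz with weight-cases v xz
    ... | inj₁ e = trans e (sym (trans (cong (λ b → D + (if b then 1 else 0))
      (≡ᵇ-false⁺ (λ e′ → ℕₚ.<⇒≢ (ℕₚ.n<1+n D) (trans (sym e) e′)))) (ℕₚ.+-identityʳ D)))
    ... | inj₂ e = trans e (sym (trans (cong (λ b → D + (if b then 1 else 0)) (≡ᵇ-true⁺ e)) (ℕₚ.+-comm D 1)))

    N : X → X → Bool
    N x z = d x z ≡ᵇ 1

    sumIf-const : ∀ (P : X → Bool) a → ℕSum.sumIf P (λ _ → a) ≡ # P * a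
    sumIf-const P a = sym (trans (ℕSum.*-distribʳ-sumFin a _) (ℕSum.sumFin-cong (λ z → pointwise (P z))))
      where
      pointwise : ∀ p → (if p then 1 else 0) * a ≡ (if p then a else 0)
      pointwise true  = ℕₚ.+-identityʳ a
      pointwise false = refl

    sumIf-+ : ∀ (P : X → Bool) (f g : X → ℕ) → ℕSum.sumIf P (λ z → f z + g z) ≡ ℕSum.sumIf P f + ℕSum.sumIf P g
    sumIf-+ P f g = trans (ℕSum.sumFin-cong (λ z → pointwise (P z))) (ℕSum.sumFin-+ _ _)
      where
      pointwise : ∀ {a b} p → (if p then a + b else 0) ≡ (if p then a else 0) + (if p then b else 0)
      pointwise true  = refl
      pointwise false = refl

    -- The sum of the weights over the D + 1 edges at x is evaluated through the labels and through
    -- `ν-neighbours`. In the Odd graph the edges at x stand for the points outside x.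
    #labels : ∀ x v → # (λ z → N x z ∧ label x z v) ≡ ν (d x v)
    #labels x v = ℕₚ.+-cancelˡ-≡ (suc D * D) (# (λ z → N x z ∧ label x z v)) (ν (d x v)) (begin
      suc D * D + # (λ z → N x z ∧ label x z v)
        ≡⟨ cong₂ ℕ._+_ (cong (_* D) (trans (sym k≡) (sym (#neighbours x)))) (ℕSum.sumFin-cong (λ z → if-and (N x z) (label x z v))) ⟩
      # (N x) * D + L
        ≡⟨ cong (_+ L) (sumIf-const (N x) D) ⟨
      ℕSum.sumIf (N x) (λ _ → D) + L
        ≡⟨ sumIf-+ (N x) (λ _ → D) (λ z → if label x z v then 1 else 0) ⟨
      ℕSum.sumIf (N x) (λ z → D + (if label x z v then 1 else 0))
        ≡⟨ ℕSum.sumIf-cong (N x) (λ z h → sym (weight-label v (≡ᵇ-true⁻ {d x z} h))) ⟩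
      ℕSum.sumIf (N x) (λ z → ν (d x v) + ν (d z v))
        ≡⟨ sumIf-+ (N x) (λ _ → ν (d x v)) (λ z → ν (d z v)) ⟩
      ℕSum.sumIf (N x) (λ _ → ν (d x v)) + S
        ≡⟨ cong (_+ S) (trans (sumIf-const (N x) (ν (d x v))) (cong (_* ν (d x v)) (trans (#neighbours x) k≡))) ⟩
      suc D * ν (d x v) + S
        ≡⟨ rearrange D (ν (d x v)) (S) ⟩
      S + D * ν (d x v) + ν (d x v)
        ≡⟨ cong (_+ ν (d x v)) (trans (ν-neighbours x v) (ℕₚ.*-comm D (suc D))) ⟩
      suc D * D + ν (d x v) ∎)
      where
      open ≡-Reasoning
      L S : ℕ
      L = ℕSum.sumIf (N x) (λ z → if label x z v then 1 else 0)
      S = ℕSum.sumIf (N x) (λ z → ν (d z v))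
      if-and : ∀ a b → (if a ∧ b then 1 else 0) ≡ (if a then (if b then 1 else 0) else 0)
      if-and true  b = refl
      if-and false b = refl
      rearrange : ∀ D a S → suc D * a + S ≡ S + D * a + a
      rearrange = solve-∀

    sumIf-pair : ∀ (P : X → Bool) {a b} (f : X → ℕ) → # P ≡ 2 → P a ≡ true → P b ≡ true → a ≢ b → ℕSum.sumIf P f ≡ f a + f b
    sumIf-pair P {a} {b} f two Pa Pb a≢b = begin
      ℕSum.sumIf P f
        ≡⟨ ℕSum.sumFin-cong (λ z → pointwise z) ⟩
      ℕSum.sumFin (λ z → (if does (z ≟ a) then f z else 0) + (if does (z ≟ b) then f z else 0))
        ≡⟨ ℕSum.sumFin-+ _ _ ⟩
      ℕSum.sumIf (λ z → does (z ≟ a)) f + ℕSum.sumIf (λ z → does (z ≟ b)) f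
        ≡⟨ cong₂ ℕ._+_ (single a) (single b) ⟩
      f a + f b ∎
      where
      open ≡-Reasoning
      single : ∀ c → ℕSum.sumIf (λ z → does (z ≟ c)) f ≡ f c
      single c = trans (ℕSum.sumFin-only _ c (λ z z≢c → cong (λ e → if e then f z else 0) (dec-false (z ≟ c) z≢c)))
        (cong (λ e → if e then f c else 0) (dec-true (c ≟ c) refl))
      rest : ∀ z → P z ≡ true → z ≢ a → z ≡ b
      rest z Pz z≢a = #≤1⇒unique (P ∖ a) (ℕₚ.≤-reflexive (ℕₚ.suc-injective (trans (sym (#-∖ P Pa)) two)))
        (∖⁺ P Pz z≢a) (∖⁺ P Pb (λ e → a≢b (sym e)))
      pointwise : ∀ z → (if P z then f z else 0) ≡ (if does (z ≟ a) then f z else 0) + (if does (z ≟ b) then f z else 0)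
      pointwise z with z ≟ a | z ≟ b | P z in e
      ... | yes p | yes q | _     = contradiction (trans (sym p) q) a≢b
      ... | yes p | no _  | true  = sym (ℕₚ.+-identityʳ (f z))
      ... | yes p | no _  | false = contradiction (trans (sym (trans (cong P p) Pa)) e) true≢false
      ... | no _  | yes q | true  = refl
      ... | no _  | yes q | false = contradiction (trans (sym (trans (cong P q) Pb)) e) true≢false
      ... | no p  | no q  | true  = contradiction (rest z e p) q
      ... | no _  | no _  | false = refl

    -- As c₃ = 2, every set in the balanced set condition for opposite vertices consists of two
    -- vertices of the hexagon. The conditions for p, s and for r, o combine to three times the
    -- claim.
    hexagon-opposite : ∀ {p q r s t o} → d p q ≡ 1 → d q r ≡ 1 → d r s ≡ 1 → d t s ≡ 1 → d o t ≡ 1 → d p o ≡ 1 →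
      p ≢ r → q ≢ s → r ≢ t → s ≢ o → p ≢ t → q ≢ o → ∀ v → weight r s v ≡ weight p o v
    hexagon-opposite {p} {q} {r} {s} {t} {o} pq qr rs ts ot po p≢r q≢s r≢t s≢o p≢t q≢o v =
      cancel (ν (d p v)) (ν (d q v)) (ν (d r v)) (ν (d s v)) (ν (d t v)) (ν (d o v))
        (balance {p} {s} {q} {o} {r} {t} (geodesic₃ pq qr rs p≢r q≢s) pq (no-triangle qr rs q≢s) po (no-triangle ot ts (λ e → s≢o (sym e))) q≢o
          (no-triangle pq qr p≢r) rs (no-triangle po ot p≢t) ts r≢t)
        (balance {r} {o} {q} {s} {p} {t} (geodesic₃ (d-flip qr) (d-flip pq) po (λ e → p≢r (sym e)) q≢o) (d-flip qr) (no-triangle (d-flip pq) po q≢o) rs (no-triangle (d-flip ts) (d-flip ot) s≢o) q≢s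
          (no-triangle (d-flip qr) (d-flip pq) (λ e → p≢r (sym e))) po (no-triangle rs (d-flip ts) r≢t) (d-flip ot) p≢t)
      where
      balance : ∀ {x y a b a′ b′} → d x y ≡ 3 → d x a ≡ 1 → d a y ≡ 2 → d x b ≡ 1 → d b y ≡ 2 → a ≢ b →
        d x a′ ≡ 2 → d a′ y ≡ 1 → d x b′ ≡ 2 → d b′ y ≡ 1 → a′ ≢ b′ →
        ν (d a v) + ν (d b v) + (ν (d x v) + ν (d x v)) ≡ ν (d a′ v) + ν (d b′ v) + (ν (d y v) + ν (d y v))
      balance {x} {y} xy xa ay xb by a≢b xa′ a′y xb′ b′y a′≢b′ = trans
        (cong (_+ (ν (d x v) + ν (d x v))) (sym (sumIf-pair (sphere² x y 1 2) (λ z → ν (d z v)) (trans (#P xy) c₃≡) (sphere²⁺ xa ay) (sphere²⁺ xb by) a≢b)))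
        (trans (ν-balanced v xy)
          (cong (_+ (ν (d y v) + ν (d y v))) (sumIf-pair (sphere² x y 2 1) (λ z → ν (d z v)) (trans (#Q xy) c₃≡) (sphere²⁺ xa′ a′y) (sphere²⁺ xb′ b′y) a′≢b′)))
      cancel : ∀ p q r s t o → q + o + (p + p) ≡ r + t + (s + s) → q + s + (r + r) ≡ p + t + (o + o) → r + s ≡ p + o
      cancel p q r s t o h h′ = ℕₚ.*-cancelˡ-≡ (r + s) (p + o) 3 (ℕₚ.+-cancelˡ-≡ (q + t) _ _ (trans (e₁ p q r s t o)
        (trans (cong₂ ℕ._+_ h′ (sym h)) (e₂ p q r s t o))))
        where
        e₁ : ∀ p q r s t o → q + t + 3 * (r + s) ≡ (q + s + (r + r)) + (r + t + (s + s))
        e₁ = solve-∀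
        e₂ : ∀ p q r s t o → (p + t + (o + o)) + (q + o + (p + p)) ≡ q + t + 3 * (p + o)
        e₂ = solve-∀

    -- A second vertex o of Γ(p) ∩ Γ₂(s), which exists by c₃ ≥ 2, and its partner close the path to
    -- a hexagon.
    opposite-edge : ∀ {p q r s} → d p q ≡ 1 → d q r ≡ 1 → d r s ≡ 1 → p ≢ r → q ≢ s →
      ∃ λ o → d p o ≡ 1 × (∀ v → weight r s v ≡ weight p o v)
    opposite-edge {p} {q} {r} {s} pq qr rs p≢r q≢s =
      close (#≥2⇒∃-other P (subst (2 ≤_) (sym (#P ps)) c₃≥2) (sphere²⁺ pq (no-triangle qr rs q≢s)))
      where
      ps : d p s ≡ 3
      ps = geodesic₃ pq qr rs p≢r q≢s
      P : X → Bool
      P = sphere² p s 1 2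
      Opposite : Set
      Opposite = ∃ λ o → d p o ≡ 1 × (∀ v → weight r s v ≡ weight p o v)
      finish : ∀ {o} → q ≢ o → d p o ≡ 1 → (∃ λ t → d o t ≡ 1 × d t s ≡ 1 × d p t ≡ 2) → Opposite
      finish {o} q≢o po (t , ot , ts , pt) = o , po , hexagon-opposite pq qr rs ts ot po p≢r q≢s
        (λ r≡t → q≢o (common-neighbour-unique (no-triangle pq qr p≢r) pq qr po (trans (cong (d o) r≡t) ot)))
        (λ s≡o → contradiction (trans (sym ps) (trans (cong (d p) s≡o) po)) (λ ()))
        (d≢ s ps ts (λ ())) q≢o
      close : (∃ λ o → P o ≡ true × q ≢ o) → Opposite
      close (o , Po , q≢o) = finish q≢o (proj₁ (sphere²⁻ {p} {s} {1} {2} Po))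
        (partner ps (proj₁ (sphere²⁻ {p} {s} {1} {2} Po)) (proj₂ (sphere²⁻ {p} {s} {1} {2} Po)))

    LabelAt : X → (X → Bool) → Set
    LabelAt x f = ∃ λ z → d x z ≡ 1 × (∀ v → label x z v ≡ f v)

    LabelNear : X → X → (X → Bool) → Set
    LabelNear x z f = LabelAt x f ⊎ LabelAt z f

    near-step : ∀ {x z z′ f} → d x z ≡ 1 → d x z′ ≡ 1 → LabelAt z′ f → LabelNear x z f
    near-step {x} {z} {z′} {f} xz xz′ (y , z′y , h) = go (y ≟ x) (z ≟ z′)
      where
      go : Dec (y ≡ x) → Dec (z ≡ z′) → LabelNear x z f
      go (yes y≡x) _ = inj₁ (z′ , xz′ , λ v →
        trans (label-sym x z′ v) (trans (cong (λ w → label z′ w v) (sym y≡x)) (h v)))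
      go (no _) (yes z≡z′) = inj₂ (subst (λ w → LabelAt w f) (sym z≡z′) (y , z′y , h))
      go (no y≢x) (no z≢z′) = via (opposite-edge (d-flip xz) xz′ z′y z≢z′ (λ e → y≢x (sym e)))
        where
        via : (∃ λ o → d z o ≡ 1 × (∀ v → weight z′ y v ≡ weight z o v)) → LabelNear x z f
        via (o , zo , eq) = inj₂ (o , zo , λ v → trans (cong (_≡ᵇ suc D) (sym (eq v))) (h v))

    -- A labelled edge is carried along a geodesic towards the edge xz, each time replaced by its
    -- opposite in a hexagon when it does not already meet the next edge.
    label-near : ∀ {x z f} → d x z ≡ 1 → ∀ y → LabelAt y f → LabelNear x z f
    label-near {x} {z} {f} xz y at = go (d x y) x z refl xz
      where
      go : ∀ i x z → d x y ≡ i → d x z ≡ 1 → LabelNear x z f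
      extend : ∀ i x z → d x z ≡ 1 → (∃ λ x′ → d x x′ ≡ 1 × d x′ y ≡ i) → LabelNear x z f
      go zero    x z xy xz = inj₁ (subst (λ w → LabelAt w f) (sym (d≡0⇒≡ xy)) at)
      go (suc i) x z xy xz = extend i x z xz (∃-prev xy)
      extend i x z xz (x′ , xx′ , x′y) = Sum.[ near-step xz xx′ , inj₁ ]′ (go i x′ x x′y (d-flip xx′))

    base : ∃ λ x → ∃ λ z → d x z ≡ 1
    base with ∃-at-distance 1 (ℕₚ.<⇒≤ 1<D)
    ... | x , z , e = x , z , e

    module Points (x₀ z₀ : X) (x₀z₀ : d x₀ z₀ ≡ 1) where

      -- By `label-near` every label occurs on an edge that meets the base edge. There are D + 1
      -- such edges at x₀ and D further ones at z₀.
      edgeList : List (X × X)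
      edgeList = map (x₀ ,_) (filterᵇ (N x₀) (allFin n)) ++ map (z₀ ,_) (filterᵇ (N z₀ ∖ x₀) (allFin n))

      N-x₀ : # (N z₀ ∖ x₀) ≡ D
      N-x₀ = ℕₚ.suc-injective (trans (sym (#-∖ (N z₀) (≡ᵇ-true⁺ (d-flip x₀z₀)))) (trans (#neighbours z₀) k≡))

      length-filter : ∀ (p : X → Bool) → length (filterᵇ p (allFin n)) ≡ # p
      length-filter p = trans (length-filterᵇ p (allFin n)) (sym (ℕSum.sumFin≡sumOver _))

      length-edgeList : length edgeList ≡ suc (D + D)
      length-edgeList = trans (length-++ (map (x₀ ,_) (filterᵇ (N x₀) (allFin n)))) (cong₂ ℕ._+_
        (trans (length-map (x₀ ,_) (filterᵇ (N x₀) (allFin n))) (trans (length-filter (N x₀)) (trans (#neighbours x₀) k≡)))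
        (trans (length-map (z₀ ,_) (filterᵇ (N z₀ ∖ x₀) (allFin n))) (trans (length-filter (N z₀ ∖ x₀)) N-x₀)))

      Point : Set
      Point = Fin (suc (D + D))

      edges : ∃ λ (es : Vec (X × X) (suc (D + D))) → Vec.toList es ≡ edgeList
      edges = vectorise edgeList length-edgeList

      opaque
        edge : Point → X × X
        edge i = Vec.lookup (proj₁ edges) i

        edge-adjacent : ∀ i → d (proj₁ (edge i)) (proj₂ (edge i)) ≡ 1
        edge-adjacent i = adjacent (∈-++⁻ (map (x₀ ,_) (filterᵇ (N x₀) (allFin n))) (subst (edge i ∈_) (proj₂ edges) (lookup∈toList (proj₁ edges) i)))
          where
          adjacent : ∀ {e} → e ∈ map (x₀ ,_) (filterᵇ (N x₀) (allFin n)) ⊎ e ∈ map (z₀ ,_) (filterᵇ (N z₀ ∖ x₀) (allFin n)) → d (proj₁ e) (proj₂ e) ≡ 1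
          adjacent (inj₁ h) with ∈-map⁻ (x₀ ,_) h
          ... | z , z∈ , refl = ≡ᵇ-true⁻ (∈-filterᵇ⁻ (N x₀) (allFin n) z∈)
          adjacent (inj₂ h) with ∈-map⁻ (z₀ ,_) h
          ... | z , z∈ , refl = ≡ᵇ-true⁻ (proj₁ (∖⁻ (N z₀) (∈-filterᵇ⁻ (N z₀ ∖ x₀) (allFin n) z∈)))

        edge-surjective : ∀ {e} → e ∈ edgeList → ∃ λ i → edge i ≡ e
        edge-surjective e∈ = ∈-toList⇒lookup (proj₁ edges) (subst (_ ∈_) (sym (proj₂ edges)) e∈)

        #-edge : ∀ (p : X × X → Bool) → # (λ i → p (edge i)) ≡
          # (λ z → N x₀ z ∧ p (x₀ , z)) + # (λ z → (N z₀ ∖ x₀) z ∧ p (z₀ , z))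
        #-edge p = trans (#-lookup (proj₁ edges) p) (trans (cong (λ L → ℕSum.sumOver L (λ e → if p e then 1 else 0)) (proj₂ edges))
          (trans (ℕSum.sumOver-++ (map (x₀ ,_) (filterᵇ (N x₀) (allFin n))) (map (z₀ ,_) (filterᵇ (N z₀ ∖ x₀) (allFin n))) (λ e → if p e then 1 else 0))
            (cong₂ ℕ._+_ (part x₀ (N x₀)) (part z₀ (N z₀ ∖ x₀)))))
          where
          part : ∀ x (q : X → Bool) → ℕSum.sumOver (map (x ,_) (filterᵇ q (allFin n))) (λ e → if p e then 1 else 0) ≡ # (λ z → q z ∧ p (x , z))
          part x q = trans (ℕSum.sumOver-map (x ,_) (filterᵇ q (allFin n)) (λ e → if p e then 1 else 0))
            (trans (sumOver-filterᵇ q (λ z → p (x , z)) (allFin n)) (sym (ℕSum.sumFin≡sumOver _)))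

      contains : X → Point → Bool
      contains v i = label (proj₁ (edge i)) (proj₂ (edge i)) v

      point-labels : ∀ i → LabelAt (proj₁ (edge i)) (λ v → contains v i)
      point-labels i = proj₂ (edge i) , edge-adjacent i , λ v → refl

      label-point : ∀ {x z} → d x z ≡ 1 → ∃ λ i → ∀ v → label x z v ≡ contains v i
      label-point {x} {z} xz = find (label-near x₀z₀ x (z , xz , λ v → refl))
        where
        at-edge : ∀ {e} → e ∈ edgeList → (∀ v → label (proj₁ e) (proj₂ e) v ≡ label x z v) → ∃ λ i → ∀ v → label x z v ≡ contains v i
        at-edge e∈ h = located (edge-surjective e∈) h
          where
          located : ∀ {e} → (∃ λ i → edge i ≡ e) → (∀ v → label (proj₁ e) (proj₂ e) v ≡ label x z v) → ∃ λ i → ∀ v → label x z v ≡ contains v i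
          located (i , refl) h = i , λ v → sym (h v)
        in-x₀ : ∀ {y} → d x₀ y ≡ 1 → (x₀ , y) ∈ edgeList
        in-x₀ x₀y = ∈-++⁺ˡ (∈-map⁺ (x₀ ,_) (∈-filterᵇ⁺ (N x₀) (∈-allFin _) (≡ᵇ-true⁺ x₀y)))
        find : LabelNear x₀ z₀ (label x z) → ∃ λ i → ∀ v → label x z v ≡ contains v i
        find (inj₁ (y , x₀y , h)) = at-edge (in-x₀ x₀y) h
        find (inj₂ (y , z₀y , h)) = at-z₀ (y ≟ x₀)
          where
          at-z₀ : Dec (y ≡ x₀) → ∃ λ i → ∀ v → label x z v ≡ contains v i
          at-z₀ (yes y≡x₀) = at-edge (in-x₀ x₀z₀) (λ v → trans (label-sym x₀ z₀ v)
            (trans (cong (λ w → label z₀ w v) (sym y≡x₀)) (h v)))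
          at-z₀ (no y≢x₀) = at-edge (∈-++⁺ʳ (map (x₀ ,_) (filterᵇ (N x₀) (allFin n)))
            (∈-map⁺ (z₀ ,_) (∈-filterᵇ⁺ (N z₀ ∖ x₀) (∈-allFin _) (∖⁺ (N z₀) (≡ᵇ-true⁺ z₀y) y≢x₀)))) h

      -- `#labels` at x₀ and at z₀ together give the weight of the base edge, which is counted twice
      -- if its label holds at v; exactly then the weight is D + 1 instead of D.
      #contains : ∀ v → # (contains v) ≡ D
      #contains v = trans (#-edge (λ e → label (proj₁ e) (proj₂ e) v)) (total (label z₀ x₀ v) refl)
        where
        rest : X → Bool
        rest z = (N z₀ ∖ x₀) z ∧ label z₀ z v
        Nlabel : X → Bool
        Nlabel z = N z₀ z ∧ label z₀ z v
        weight≡ : weight z₀ x₀ v ≡ ν (d x₀ v) + ν (d z₀ v)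
        weight≡ = ℕₚ.+-comm (ν (d z₀ v)) (ν (d x₀ v))
        rest≡ : ∀ z → rest z ≡ (Nlabel ∖ x₀) z
        rest≡ z = swap (N z₀ z) (not (does (z ≟ x₀))) (label z₀ z v)
          where
          swap : ∀ a b c → (a ∧ b) ∧ c ≡ (a ∧ c) ∧ b
          swap true  true  c = sym (∧-comm c true)
          swap true  false c = sym (∧-comm c false)
          swap false b     c = refl
        total : ∀ b → label z₀ x₀ v ≡ b → # (λ z → N x₀ z ∧ label x₀ z v) + # rest ≡ D
        total true e = ℕₚ.suc-injective (trans (sym (ℕₚ.+-suc _ _)) (trans
          (cong₂ ℕ._+_ (#labels x₀ v) (trans (cong suc (#-cong rest≡))
            (trans (sym (#-∖ Nlabel (∧-true⁺ (≡ᵇ-true⁺ (d-flip x₀z₀)) e))) (#labels z₀ v))))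
          (trans (sym weight≡) (≡ᵇ-true⁻ e))))
        total false e = trans (cong₂ ℕ._+_ (#labels x₀ v) (trans (#-cong unaffected) (#labels z₀ v)))
          (trans (sym weight≡) (Sum.[ (λ h → h) , (λ h → contradiction (trans (sym (≡ᵇ-true⁺ h)) e) true≢false) ]′ (weight-cases v (d-flip x₀z₀))))
          where
          unaffected : ∀ z → rest z ≡ Nlabel z
          unaffected z with z ≟ x₀
          ... | yes refl = trans (cong (_∧ label z₀ x₀ v) (∧-zeroʳ (N z₀ x₀)))
            (sym (trans (cong (N z₀ x₀ ∧_) e) (∧-zeroʳ (N z₀ x₀))))
          ... | no _ = cong (_∧ label z₀ z v) (∧-identityʳ (N z₀ z))

      -- Every point is represented by an edge at v or at w, and a label is false at the ends of its
      -- edge.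
      disjoint : ∀ {v w} → d v w ≡ 1 → ∀ i → contains v i ≡ true → contains w i ≡ false
      disjoint {v} {w} vw i h = Sum.[ at-v , at-w ]′ (label-near vw (proj₁ (edge i)) (point-labels i))
        where
        at-v : LabelAt v (λ y → contains y i) → contains w i ≡ false
        at-v (z , vz , eq) = contradiction (trans (sym h) (trans (sym (eq v)) (label-end vz))) true≢false
        at-w : LabelAt w (λ y → contains y i) → contains w i ≡ false
        at-w (z , wz , eq) = trans (sym (eq w)) (label-end wz)

      -- The labels of all edges at v are false at v, hence at w, and `#labels` gives ν = 0.
      contains-injective : ∀ v w → (∀ i → contains v i ≡ contains w i) → v ≡ w
      contains-injective v w h = d≡0⇒≡ (ν≡0⇒≡0 (d≤D v w) (begin
        ν (d v w)                              ≡⟨ #labels v w ⟨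
        # (λ z → N v z ∧ label v z w)          ≡⟨ #-none _ (λ z hz → none z (∧-true⁻ {N v z} hz)) ⟩
        0 ∎))
        where
        open ≡-Reasoning
        none : ∀ z → N v z ≡ true × label v z w ≡ true → ⊥
        none z (vz , e) = absurd (label-point (≡ᵇ-true⁻ {d v z} vz))
          where
          absurd : (∃ λ i → ∀ y → label v z y ≡ contains y i) → ⊥
          absurd (i , eq) = true≢false (trans (sym e) (trans (eq w) (trans (sym (h i)) (trans (sym (eq v)) (label-end (≡ᵇ-true⁻ {d v z} vz))))))

      -- Let v′ be a neighbour of v. The labels of its edges other than v′v are true at v, so false
      -- at w, and ν at v′ and w is 1 or 0 according to the label of v′v. The weight of that edge
      -- then gives ν = D at v and w in both cases.
      disjoint⇒adjacent : ∀ v w → (∀ i → contains v i ≡ true → contains w i ≢ true) → d v w ≡ 1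
      disjoint⇒adjacent v w disj = ν≡D⇒≡1 (d≤D v w) (go (∃-nxt v v))
        where
        go : (∃ λ v′ → d v v′ ≡ 1 × d v′ v ≡ nxt (d v v)) → ν (d v w) ≡ D
        go (v′ , vv′ , _) = conclude (label v′ v w) refl (weight-cases w vv′)
          where
          only : ∀ z → N v′ z ∧ label v′ z w ≡ true → z ≡ v
          only z hz = decide (z ≟ v)
            where
            v′z : d v′ z ≡ 1
            v′z = ≡ᵇ-true⁻ {d v′ z} (proj₁ (∧-true⁻ {N v′ z} hz))
            absurd : z ≢ v → (∃ λ i → ∀ y → label v′ z y ≡ contains y i) → ⊥
            absurd z≢v (i , eq) = disj i (trans (sym (eq v)) (label-other v′z (d-flip vv′) (λ e → z≢v (sym e))))
              (trans (sym (eq w)) (proj₂ (∧-true⁻ {N v′ z} hz)))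
            decide : Dec (z ≡ v) → z ≡ v
            decide (yes e)  = e
            decide (no z≢v) = ⊥-elim (absurd z≢v (label-point v′z))
          conclude : ∀ b → label v′ v w ≡ b → weight v v′ w ≡ D ⊎ weight v v′ w ≡ suc D → ν (d v w) ≡ D
          conclude true e _ = ℕₚ.+-cancelʳ-≡ 1 (ν (d v w)) D (trans
            (cong (ν (d v w) ℕ.+_) (trans (sym (#-only (λ z → N v′ z ∧ label v′ z w) v (∧-true⁺ (≡ᵇ-true⁺ (d-flip vv′)) e) only)) (#labels v′ w)))
            (trans (≡ᵇ-true⁻ (trans (label-sym v v′ w) e)) (ℕₚ.+-comm 1 D)))
          conclude false e (inj₂ h) = contradiction (trans (sym (trans (label-sym v′ v w) (≡ᵇ-true⁺ h))) e) true≢false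
          conclude false e (inj₁ h) = trans (sym (ℕₚ.+-identityʳ (ν (d v w)))) (trans
            (cong (ν (d v w) ℕ.+_) (trans (sym (#-none (λ z → N v′ z ∧ label v′ z w) none)) (#labels v′ w))) h)
            where
            none : ∀ z → N v′ z ∧ label v′ z w ≢ true
            none z hz = true≢false (trans (sym (trans (cong (λ y → label v′ y w) (sym (only z hz))) (proj₂ (∧-true⁻ {N v′ z} hz)))) e)

      #not-contains : ∀ v → # (λ i → not (contains v i)) ≡ suc D
      #not-contains v = ℕₚ.+-cancelˡ-≡ D _ _ (trans (cong (_+ # (λ i → not (contains v i))) (sym (#contains v)))
        (trans (sym (#-split (λ _ → true) (contains v))) (trans (#-all (suc (D + D))) (sym (ℕₚ.+-suc D D)))))

      -- The point i is represented at v or at a neighbour w of v. In the second case the edge must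
      -- be wv, as the other edges at w have labels true at v. So some neighbour avoids both v and
      -- i, and it fills the rest by cardinality.
      neighbour-missing : ∀ v i → contains v i ≡ false →
        ∃ λ w → ∀ j → ((λ j → not (contains v j)) ∖ i) j ≡ contains w j
      neighbour-missing v i h = start (∃-nxt v v)
        where
        Missing : Set
        Missing = ∃ λ w → ∀ j → ((λ j → not (contains v j)) ∖ i) j ≡ contains w j
        complement : ∀ w → d v w ≡ 1 → contains w i ≡ false → Missing
        complement w vw wi = w , #-subset inside-complement (ℕₚ.≤-reflexive (trans size (sym (#contains w))))
          where
          size : # ((λ j → not (contains v j)) ∖ i) ≡ D
          size = ℕₚ.suc-injective (trans (sym (#-∖ (λ j → not (contains v j)) (cong not h))) (#not-contains v))
          inside-complement : ∀ j → contains w j ≡ true → ((λ j → not (contains v j)) ∖ i) j ≡ true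
          inside-complement j wj = ∖⁺ (λ j → not (contains v j)) (cong not (disjoint (d-flip vw) j wj))
            (λ e → true≢false (trans (sym wj) (trans (cong (contains w) e) wi)))
        from : ∀ {w} → d v w ≡ 1 → LabelNear v w (λ y → contains y i) → Missing
        from vw (inj₁ (z , vz , eq)) = complement z vz (trans (sym (eq z)) (trans (label-sym v z z) (label-end (d-flip vz))))
        from {w} vw (inj₂ (y , wy , eq)) = at (y ≟ v)
          where
          at : Dec (y ≡ v) → Missing
          at (yes y≡v) = complement w vw (trans (sym (eq w)) (label-end wy))
          at (no y≢v) = contradiction (trans (sym (label-other wy (d-flip vw) (λ e → y≢v (sym e)))) (trans (eq v) h)) true≢false
        start : (∃ λ w → d v w ≡ 1 × d w v ≡ nxt (d v v)) → Missing
        start (w , vw , _) = from vw (label-near vw (proj₁ (edge i)) (point-labels i))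

      module _ (s : Point → Bool) (#s : # s ≡ D) where
        private
          outer : X → Point → Bool
          outer v i = s i ∧ not (contains v i)

        -- Choose a in s but not in v, and b in v but not in s; both exist because the sizes agree.
        -- Passing to the neighbour that misses a, and from there to the one that misses b, replaces
        -- b by a in v.
        exchange : ∀ v → # (outer v) ≢ 0 → ∃ λ w → # (outer w) < # (outer v)
        exchange v ne = pick (#-⊈ ne) (#-⊈ other)
          where
          inner : Point → Bool
          inner i = s i ∧ contains v i
          same : # (outer v) ≡ # (λ i → contains v i ∧ not (s i))
          same = ℕₚ.+-cancelˡ-≡ (# inner) _ _ (trans (sym (#-split s (contains v))) (trans #s (trans (sym (#contains v))
            (trans (#-split (contains v) s) (cong (_+ # (λ i → contains v i ∧ not (s i))) (#-cong (λ i → ∧-comm (contains v i) (s i))))))))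
          other : # (λ i → contains v i ∧ not (s i)) ≢ 0
          other e = ne (trans same e)
          pick : (∃ λ a → s a ≡ true × contains v a ≡ false) → (∃ λ b → contains v b ≡ true × s b ≡ false) → ∃ λ w → # (outer w) < # (outer v)
          pick (a , sa , va) (b , vb , sb) = first (neighbour-missing v a va)
            where
            a≢b : a ≢ b
            a≢b e = true≢false (trans (sym vb) (trans (cong (contains v) (sym e)) va))
            first : (∃ λ w → ∀ j → ((λ j → not (contains v j)) ∖ a) j ≡ contains w j) → ∃ λ w → # (outer w) < # (outer v)
            first (v′ , h′) = second (neighbour-missing v′ b (trans (sym (h′ b)) (cong (λ c → not c ∧ not (does (b ≟ a))) vb)))
              where
              second : (∃ λ w → ∀ j → ((λ j → not (contains v′ j)) ∖ b) j ≡ contains w j) → ∃ λ w → # (outer w) < # (outer v)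
              second (w , h″) = w , subst (# (outer w) <_) (sym (#-∖ (outer v) (∧-true⁺ sa (cong not va)))) (s≤s (#-mono smaller))
                where
                smaller : ∀ i → outer w i ≡ true → (outer v ∖ a) i ≡ true
                smaller i hi = ∖⁺ (outer v) (∧-true⁺ si (cong not vi)) i≢a
                  where
                  si : s i ≡ true
                  si = proj₁ (∧-true⁻ {s i} hi)
                  wi : contains w i ≢ true
                  wi e = true≢false (trans (sym (proj₂ (∧-true⁻ {s i} hi))) (cong not e))
                  i≢b : i ≢ b
                  i≢b e = true≢false (trans (sym si) (trans (cong s e) sb))
                  v′i : contains v′ i ≢ false
                  v′i e = wi (trans (sym (h″ i)) (∖⁺ (λ j → not (contains v′ j)) (cong not e) i≢b))
                  v′i≡true : contains v′ i ≡ true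
                  v′i≡true with contains v′ i in e
                  ... | true  = refl
                  ... | false = contradiction e v′i
                  split = ∖⁻ (λ j → not (contains v j)) (trans (h′ i) v′i≡true)
                  vi : contains v i ≡ false
                  vi = ≢true⇒≡false (λ e → true≢false (trans (sym (proj₁ split)) (cong not e)))
                  i≢a : i ≢ a
                  i≢a = proj₂ split

        reach-set : ∀ m v → # (outer v) ≤ m → ∃ λ w → # (outer w) ≡ 0
        reach-set zero    v le = v , ℕₚ.n≤0⇒n≡0 le
        reach-set (suc m) v le = go (# (outer v) ℕ.≟ 0)
          where
          next : (∃ λ w → # (outer w) < # (outer v)) → ∃ λ w → # (outer w) ≡ 0
          next (w , lt) = reach-set m w (ℕ.s≤s⁻¹ (ℕₚ.≤-trans lt le))
          go : Dec (# (outer v) ≡ 0) → ∃ λ w → # (outer w) ≡ 0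
          go (yes e) = v , e
          go (no ne) = next (exchange v ne)

        contains-surjective : ∃ λ v → ∀ i → contains v i ≡ s i
        contains-surjective = finish (reach-set (# (outer x₀)) x₀ ℕₚ.≤-refl)
          where
          finish : (∃ λ w → # (outer w) ≡ 0) → ∃ λ v → ∀ i → contains v i ≡ s i
          finish (w , e) = w , #-subset s⊆w (ℕₚ.≤-reflexive (trans (#contains w) (sym #s)))
            where
            s⊆w : ∀ i → s i ≡ true → contains w i ≡ true
            s⊆w i si with contains w i in wi
            ... | true  = refl
            ... | false = contradiction (subst (1 ≤_) e (#≥1 (outer w) (∧-true⁺ si (cong not wi)))) (λ ())

      isOddGraph : IsOddGraph G D
      isOddGraph = record
        { φ = φ
        ; size = λ x → trans (∣tabulate∣ (contains x)) (#contains x)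
        ; inj = λ x y e → contains-injective x y (λ i → trans (sym (lookup-φ x i)) (trans (cong (λ s → Vec.lookup s i) e) (lookup-φ y i)))
        ; surj = λ s e → onto s (contains-surjective (Vec.lookup s) (trans (sym (∣tabulate∣ (Vec.lookup s))) (trans (cong ∣_∣ (tabulate∘lookup s)) e)))
        ; adjIff = λ x y → mk⇔
            (λ a → λ { (i , i∈) → apart x y a i (x∈p∩q⁻ (φ x) (φ y) i∈) })
            (λ empty → d≡1⇒adj (disjoint⇒adjacent x y (λ i hx hy → empty (i , x∈p∩q⁺ (∈φ x i hx , ∈φ y i hy)))))
        }
        where
        φ : X → Subset (suc (D + D))
        φ x = Vec.tabulate (contains x)
        lookup-φ : ∀ x i → Vec.lookup (φ x) i ≡ contains x i
        lookup-φ x i = lookup∘tabulate (contains x) i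
        ∈φ : ∀ x i → contains x i ≡ true → i Subset.∈ φ x
        ∈φ x i h = lookup⇒[]= i (φ x) (trans (lookup-φ x i) h)
        φ∈ : ∀ x i → i Subset.∈ φ x → contains x i ≡ true
        φ∈ x i h = trans (sym (lookup-φ x i)) ([]=⇒lookup h)
        apart : ∀ x y → adj x y ≡ true → ∀ i → i Subset.∈ φ x × i Subset.∈ φ y → ⊥
        apart x y a i (hx , hy) = true≢false (trans (sym (φ∈ y i hy)) (disjoint (adj⇒d≡1 a) i (φ∈ x i hx)))
        onto : ∀ s → (∃ λ v → ∀ i → contains v i ≡ Vec.lookup s i) → ∃ λ x → φ x ≡ s
        onto s (v , h) = v , trans (tabulate-cong h) (tabulate∘lookup s)

    reconstructed : IsOddGraph G D
    reconstructed = Points.isOddGraph (proj₁ base) (proj₁ (proj₂ base)) (proj₂ (proj₂ base))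

theorem4p1 : ∀ {c ℓ} (F : CharZeroField c ℓ) (G : Graph) (D k : ℕ) →
    Connected G → DistanceRegular G D → QPolynomial F G D →
    AlmostBipartite G D → 3 ≤ D → Valency G k → 3 ≤ k → Girth G 6 →
    IsOddGraph G D
theorem4p1 F G D k conn dr qp ab 3≤D val 3≤k girth =
  Reconstruction.reconstructed G conn D k dr ab 3≤D val girth 3≤k
    (QPolynomialOdd.oddParameters F G conn D k dr ab 3≤D val girth 3≤k qp)
  where
  open OddParametersConstruction using (module QPolynomialOdd)
  open OddGraphReconstruction using (module Reconstruction)
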